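{- Let $P,Q\subset\mathbb R^3$ be empty lattice tetrahedra such that $L(P+Q)=2$. Then each of $P$ and $Q$ is equivalent to $S_1$ or to $S_2$.
   Context: A lattice polytope is empty if its only lattice points are its vertices. The Minkowski length $L(P)$ is the largest $L$ such that $P$ contains a Minkowski sum of $L$ lattice polytopes each of positive dimension. Equivalence is via affine unimodular maps $x\mapsto Ux+b$, $U\in\mathrm{GL}(3,\mathbb Z)$, $b\in\mathbb Z^3$. $S_1=\operatorname{conv}\{0,e_1,e_2,e_3\}$, $S_2=\operatorname{conv}\{e_1,e_2,e_3,e_1+e_2+e_3\}$. -}

module Defs where

open import Data.Nat using (ℕ; zero; suc) renaming (_≤_ to _≤ℕ_)
open import Data.Integer as ℤ using (ℤ)
open import Data.Rational as ℚ using (ℚ; 0ℚ; 1ℚ; _/_)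
open import Data.Product using (Σ; ∃; ∃₂; _×_; _,_)
open import Data.Sum using (_⊎_)
open import Data.Vec using (Vec; []; _∷_; lookup; map)
open import Data.Vec.Relation.Unary.All using (All)
open import Data.Vec.Membership.Propositional using (_∈_)
open import Data.Fin using (Fin)
open import Relation.Binary.PropositionalEquality using (_≡_; _≢_)
open import Relation.Nullary using (¬_)
open import Function.Bundles using (_⇔_)

ℚ³ : Set
ℚ³ = ℚ × ℚ × ℚ

ℤ³ : Set
ℤ³ = ℤ × ℤ × ℤ

ι : ℤ³ → ℚ³
ι (a , b , c) = (a / 1) , (b / 1) , (c / 1)

_+³_ : ℚ³ → ℚ³ → ℚ³
(a , b , c) +³ (a' , b' , c') = (a ℚ.+ a') , (b ℚ.+ b') , (c ℚ.+ c')

_·³_ : ℚ → ℚ³ → ℚ³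
t ·³ (a , b , c) = (t ℚ.* a) , (t ℚ.* b) , (t ℚ.* c)

0³ : ℚ³
0³ = 0ℚ , 0ℚ , 0ℚ

Region : Set₁
Region = ℚ³ → Set

_⊆R_ : Region → Region → Set
R ⊆R S = ∀ x → R x → S x

sumℚ : ∀ {n} → Vec ℚ n → ℚ
sumℚ [] = 0ℚ
sumℚ (t ∷ ts) = t ℚ.+ sumℚ ts

combo : ∀ {n} → Vec ℚ n → Vec ℤ³ n → ℚ³
combo [] [] = 0³
combo (t ∷ ts) (v ∷ vs) = (t ·³ ι v) +³ combo ts vs

conv : ∀ {n} → Vec ℤ³ n → Region
conv {n} vs x = Σ (Vec ℚ n) λ w → All (0ℚ ℚ.≤_) w × sumℚ w ≡ 1ℚ × x ≡ combo w vs

record LatticePolytope : Set where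
  constructor lpoly
  field
    k   : ℕ
    pts : Vec ℤ³ (suc k)

⟦_⟧ : LatticePolytope → Region
⟦ lpoly k pts ⟧ = conv pts

PosDim : LatticePolytope → Set
PosDim (lpoly k pts) = ∃₂ λ (i j : Fin (suc k)) → lookup pts i ≢ lookup pts j

_⊕_ : Region → Region → Region
(R ⊕ S) x = ∃₂ λ a b → R a × S b × x ≡ a +³ b

MinkSum : ∀ {L} → Vec Region L → Region
MinkSum [] x = x ≡ 0³
MinkSum (R ∷ Rs) = R ⊕ MinkSum Rs

ContainsSumOf : Region → ℕ → Set
ContainsSumOf R L = Σ (Vec LatticePolytope L) λ Qs →
  All PosDim Qs × (MinkSum (map ⟦_⟧ Qs) ⊆R R)

MinkowskiLength≡ : Region → ℕ → Set
MinkowskiLength≡ R L = ContainsSumOf R L × (∀ M → ContainsSumOf R M → M ≤ℕ L)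

det3 : ℤ³ → ℤ³ → ℤ³ → ℤ
det3 (a , b , c) (d , e , f) (g , h , i) =
  a ℤ.* (e ℤ.* i ℤ.- f ℤ.* h)
  ℤ.- b ℤ.* (d ℤ.* i ℤ.- f ℤ.* g)
  ℤ.+ c ℤ.* (d ℤ.* h ℤ.- e ℤ.* g)

_-ℤ³_ : ℤ³ → ℤ³ → ℤ³
(a , b , c) -ℤ³ (a' , b' , c') = (a ℤ.- a') , (b ℤ.- b') , (c ℤ.- c')

IsTetrahedron : Vec ℤ³ 4 → Set
IsTetrahedron (v₀ ∷ v₁ ∷ v₂ ∷ v₃ ∷ []) =
  det3 (v₁ -ℤ³ v₀) (v₂ -ℤ³ v₀) (v₃ -ℤ³ v₀) ≢ ℤ.0ℤ

IsEmptyLattice : ∀ {n} → Vec ℤ³ n → Set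
IsEmptyLattice vs = ∀ (z : ℤ³) → conv vs (ι z) → z ∈ vs

EmptyTetrahedron : Vec ℤ³ 4 → Set
EmptyTetrahedron vs = IsTetrahedron vs × IsEmptyLattice vs

Mat3 : Set
Mat3 = ℤ³ × ℤ³ × ℤ³

dotℚ : ℤ³ → ℚ³ → ℚ
dotℚ (a , b , c) (x , y , z) = (a / 1) ℚ.* x ℚ.+ (b / 1) ℚ.* y ℚ.+ (c / 1) ℚ.* z

affine : Mat3 → ℤ³ → ℚ³ → ℚ³
affine (r₁ , r₂ , r₃) b x = (dotℚ r₁ x , dotℚ r₂ x , dotℚ r₃ x) +³ ι b

InGL3Z : Mat3 → Set
InGL3Z (r₁ , r₂ , r₃) = det3 r₁ r₂ r₃ ≡ ℤ.1ℤ ⊎ det3 r₁ r₂ r₃ ≡ ℤ.-1ℤ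

Equivalent : Region → Region → Set
Equivalent R S = Σ Mat3 λ U → InGL3Z U × Σ ℤ³ λ b →
  ∀ y → ((∃ λ x → R x × y ≡ affine U b x) ⇔ S y)

e₀ e₁ e₂ e₃ e₁₂₃ : ℤ³
e₀ = ℤ.0ℤ , ℤ.0ℤ , ℤ.0ℤ
e₁ = ℤ.1ℤ , ℤ.0ℤ , ℤ.0ℤ
e₂ = ℤ.0ℤ , ℤ.1ℤ , ℤ.0ℤ
e₃ = ℤ.0ℤ , ℤ.0ℤ , ℤ.1ℤ
e₁₂₃ = ℤ.1ℤ , ℤ.1ℤ , ℤ.1ℤ

S₁ S₂ : Region
S₁ = conv (e₀ ∷ e₁ ∷ e₂ ∷ e₃ ∷ [])
S₂ = conv (e₁ ∷ e₂ ∷ e₃ ∷ e₁₂₃ ∷ [])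

{-# OPTIONS --safe #-}
module Submission where

open import Defs
open import Data.Vec using (Vec)
open import Data.Sum using (_⊎_)
open import Data.Product using (_×_)

-- L(P + Q) = 2 enters by contradiction: no three lattice segments of positive length may fit into P
-- + Q. The obstacle is that Q has no normal form relative to P. White's theorem reduces P alone,
-- from volume 3 on, to the vertices 0, e₁, e₂, (1, b, q) with b coprime to q, so finitely many P
-- remain once q is bounded. The bound comes from single edges of Q. If an edge has lattice height K
-- over a facet of P, the part j / K of it, with 3 j ≤ K, may become a lattice vector after a small
-- correction parallel to the facet, and then three copies of this vector fit. Smallness is measured
-- by the difference body of the facet, a hexagon, and for K ≥ 18 such a j always exists. So all
-- edges of Q have height at most 17 over every facet of P. The heights over two of the facets
-- differ by q times a coordinate, and 17 + 17 < 35 ≤ q would make Q flat. For q < 35 the same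
-- heights confine the vertices of Q to a finite box, where a search with certificates decides.

module White where

  open import Data.Nat
  open import Data.Nat.Properties
  open import Data.Nat.DivMod
  open import Data.Nat.Tactic.RingSolver using (solve-∀)
  open import Data.Product using (_×_; _,_; proj₁; proj₂)
  open import Data.Sum using (_⊎_; inj₁; inj₂; [_,_]′)
  open import Data.Empty using (⊥; ⊥-elim)
  open import Relation.Nullary using (¬_; yes; no)
  open import Relation.Binary.PropositionalEquality

  -- White's theorem as a statement on residues

  *≤⇒≤/ : ∀ {j x} q .{{_ : NonZero q}} → j * q ≤ x → j ≤ x / q
  *≤⇒≤/ {j} {x} q jq≤x = subst (_≤ x / q) (m*n/n≡m j q) (/-monoˡ-≤ q jq≤x)

  ≤/⇒*≤ : ∀ {j x} q .{{_ : NonZero q}} → j ≤ x / q → j * q ≤ x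
  ≤/⇒*≤ {j} {x} q j≤ = ≤-trans (*-monoˡ-≤ q j≤) (m/n*n≤m x q)

  x<[1+x/q]*q : ∀ x q .{{_ : NonZero q}} → x < suc (x / q) * q
  x<[1+x/q]*q x q = ≰⇒> λ le → 1+n≰n (*≤⇒≤/ q le)

  -- The jump times ⌈m q / b⌉ of ⌊k b / q⌋ would be the union of those of ⌊k a₁ / q⌋ and ⌊k a₂ / q⌋. At the first
  -- jump k₂ of the slower sequence the other one skips a jump of b, and then catches up too early.
  no-merge : ∀ q′ b a₁ a₂ → let q = suc q′ in a₂ ≤ a₁ → 2 ≤ a₂ → 1 ≤ q′ → .{{_ : NonZero b}} → 2 * b < q →
    (∀ k → 0 < k → k < q → k * b / q ≡ k * a₁ / q + k * a₂ / q) → ⊥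
  no-merge q′ b a₁ a₂ a₂≤a₁ 2≤a₂ 1≤q′ 2b<q split = <-irrefl refl (<-≤-trans k₃b< k₃b≥)
    where
      open ≤-Reasoning
      q = suc q′
      instance _ = >-nonZero (≤-trans (s≤s z≤n) 2≤a₂)
      n₂ = q′ / a₂
      n₁ = q′ / b
      k₂ = suc n₂
      k₁ = suc n₁
      n₂a₂≤ : n₂ * a₂ ≤ q′
      n₂a₂≤ = m/n*n≤m q′ a₂
      q≤k₂a₂ : q ≤ k₂ * a₂
      q≤k₂a₂ = x<[1+x/q]*q q′ a₂
      2n₂≤ : n₂ + n₂ ≤ q′
      2n₂≤ = begin
        n₂ + n₂   ≡⟨ double n₂ ⟩
        n₂ * 2    ≤⟨ *-monoʳ-≤ n₂ 2≤a₂ ⟩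
        n₂ * a₂   ≤⟨ n₂a₂≤ ⟩
        q′        ∎
        where
          double : ∀ n → n + n ≡ n * 2
          double = solve-∀
      k₂<q : k₂ < q
      k₂<q = s≤s (suc-≤ n₂ 2n₂≤)
        where
          suc-≤ : ∀ n → n + n ≤ q′ → suc n ≤ q′
          suc-≤ zero _ = 1≤q′
          suc-≤ (suc n) le = ≤-trans (s≤s (≤-trans (m≤n+m (suc n) n) ≤-refl)) le
      j = k₂ * a₁ / q
      jq≤k₂a₁ : j * q ≤ k₂ * a₁
      jq≤k₂a₁ = m/n*n≤m (k₂ * a₁) q
      k₂a₁< : k₂ * a₁ < suc j * q
      k₂a₁< = x<[1+x/q]*q (k₂ * a₁) q
      jump₂ : suc j * q ≤ k₂ * b
      jump₂ = ≤/⇒*≤ q (begin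
        suc j                          ≡⟨ +-comm 1 j ⟩
        j + 1                          ≤⟨ +-monoʳ-≤ j (*≤⇒≤/ q (subst (_≤ k₂ * a₂) (sym (*-identityˡ q)) q≤k₂a₂)) ⟩
        j + k₂ * a₂ / q                ≡⟨ split k₂ (s≤s z≤n) k₂<q ⟨
        k₂ * b / q                     ∎)
      n′ = j * q / b
      k′ = suc n′
      n′b≤ : n′ * b ≤ j * q
      n′b≤ = m/n*n≤m (j * q) b
      jq≤k′b : j * q ≤ k′ * b
      jq≤k′b = <⇒≤ (x<[1+x/q]*q (j * q) b)
      -- Two multiples of `b` stay below `q`, so `b` reaches the level `j * q` well before `k₂`. At
      -- that time `a₂` has not jumped yet, and `a₁` alone accounts for all `j` jumps.
      k′<n₂ : k′ < n₂
      k′<n₂ = ≰⇒> λ n₂≤k′ → <-irrefl refl (begin-strict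
        k₂ * b                ≤⟨ *-monoˡ-≤ b (s≤s n₂≤k′) ⟩
        suc (suc n′) * b      ≡⟨ ring n′ b ⟩
        n′ * b + 2 * b        <⟨ +-mono-≤-< n′b≤ 2b<q ⟩
        j * q + q             ≡⟨ +-comm (j * q) q ⟩
        suc j * q             ≤⟨ jump₂ ⟩
        k₂ * b                ∎)
        where
          ring : ∀ n b → suc (suc n) * b ≡ n * b + 2 * b
          ring = solve-∀
      jq≤k′a₁ : j * q ≤ k′ * a₁
      jq≤k′a₁ = ≤/⇒*≤ q (begin
        j                              ≤⟨ *≤⇒≤/ q jq≤k′b ⟩
        k′ * b / q                     ≡⟨ split k′ (s≤s z≤n) (<-trans (<-trans k′<n₂ ≤-refl) k₂<q) ⟩
        k′ * a₁ / q + k′ * a₂ / q      ≡⟨ cong (k′ * a₁ / q +_) (m<n⇒m/n≡0 (s≤s (≤-trans (*-monoˡ-≤ a₂ (<⇒≤ k′<n₂)) n₂a₂≤))) ⟩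
        k′ * a₁ / q + 0                ≡⟨ +-identityʳ _ ⟩
        k′ * a₁ / q                    ∎)
      n₁b≤ : n₁ * b ≤ q′
      n₁b≤ = m/n*n≤m q′ b
      q≤k₁b : q ≤ k₁ * b
      q≤k₁b = x<[1+x/q]*q q′ b
      k₁≤k₂ : k₁ ≤ k₂
      k₁≤k₂ = s≤s (≮⇒≥ λ n₂<n₁ → <-irrefl refl (begin-strict
        k₂ * b       ≤⟨ *-monoˡ-≤ b n₂<n₁ ⟩
        n₁ * b       ≤⟨ n₁b≤ ⟩
        q′           <⟨ ≤-refl ⟩
        q            ≤⟨ m≤m+n q (j * q) ⟩
        suc j * q    ≤⟨ jump₂ ⟩
        k₂ * b       ∎))
      q≤k₁a₁ : q ≤ k₁ * a₁
      q≤k₁a₁ = ≮⇒≥ λ k₁a₁<q → 1+n≰n (begin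
        1                              ≤⟨ *≤⇒≤/ q (subst (_≤ k₁ * b) (sym (*-identityˡ q)) q≤k₁b) ⟩
        k₁ * b / q                     ≡⟨ split k₁ (s≤s z≤n) (≤-<-trans k₁≤k₂ k₂<q) ⟩
        k₁ * a₁ / q + k₁ * a₂ / q      ≡⟨ cong₂ _+_ (m<n⇒m/n≡0 k₁a₁<q) (m<n⇒m/n≡0 (≤-<-trans (*-monoʳ-≤ k₁ a₂≤a₁) k₁a₁<q)) ⟩
        0                              ∎)
      -- By time `k′` the sequence of `a₁` has made `j` jumps and by time `k₁` one, so by `k₃` it
      -- has made `suc j`. Hence `k₃` is not before `k₂`, `a₂` has jumped as well, and `b` would
      -- have to make one jump more than `k₃ * b` allows.
      k₃ = k′ + k₁
      k₃<q : k₃ < q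
      k₃<q = s≤s (≤-pred (begin-strict
        k′ + k₁        <⟨ +-mono-<-≤ k′<n₂ k₁≤k₂ ⟩
        n₂ + suc n₂    ≡⟨ +-suc n₂ n₂ ⟩
        suc (n₂ + n₂)  ≤⟨ s≤s 2n₂≤ ⟩
        suc q′         ∎))
      k₃a₁≥ : suc j * q ≤ k₃ * a₁
      k₃a₁≥ = begin
        q + j * q             ≡⟨ +-comm q (j * q) ⟩
        j * q + q             ≤⟨ +-mono-≤ jq≤k′a₁ q≤k₁a₁ ⟩
        k′ * a₁ + k₁ * a₁     ≡⟨ *-distribʳ-+ a₁ k′ k₁ ⟨
        k₃ * a₁               ∎
      k₂≤k₃ : k₂ ≤ k₃
      k₂≤k₃ = ≮⇒≥ λ k₃<k₂ → <-irrefl refl (≤-<-trans (≤-trans k₃a₁≥ (*-monoˡ-≤ a₁ (<⇒≤ k₃<k₂))) k₂a₁<)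
      k₃b≥ : suc (suc j) * q ≤ k₃ * b
      k₃b≥ = ≤/⇒*≤ q (begin
        suc (suc j)                    ≡⟨ +-comm 1 (suc j) ⟩
        suc j + 1                      ≤⟨ +-mono-≤ (*≤⇒≤/ q k₃a₁≥)
                                            (*≤⇒≤/ q (subst (_≤ k₃ * a₂) (sym (*-identityˡ q)) (≤-trans q≤k₂a₂ (*-monoˡ-≤ a₂ k₂≤k₃)))) ⟩
        k₃ * a₁ / q + k₃ * a₂ / q      ≡⟨ split k₃ (s≤s z≤n) k₃<q ⟨
        k₃ * b / q                     ∎)
      k₃b< : k₃ * b < suc (suc j) * q
      k₃b< = begin-strict
        k₃ * b                       ≡⟨ ring n′ n₁ b ⟩
        n′ * b + (n₁ * b + 2 * b)    <⟨ +-mono-≤-< n′b≤ (+-mono-≤-< (≤-trans n₁b≤ (n≤1+n q′)) 2b<q) ⟩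
        j * q + (q + q)              ≡⟨ ring′ j q ⟩
        suc (suc j) * q              ∎
        where
          ring : ∀ n m b → (suc n + suc m) * b ≡ n * b + (m * b + 2 * b)
          ring = solve-∀
          ring′ : ∀ j q → j * q + (q + q) ≡ suc (suc j) * q
          ring′ = solve-∀

  -- The condition of the terminal lemma for the weights (a₀, a₁, a₂, -1) modulo q: together with
  -- the residue q - k of -k, the four residues of every multiple sum to 2 q.
  record Terminal (q a₀ a₁ a₂ : ℕ) .{{_ : NonZero q}} : Set where
    constructor terminal
    field
      sum-residues : ∀ k → 0 < k → k < q → k * a₀ % q + (k * a₁ % q + k * a₂ % q) ≡ q + k
      residue₀ : ∀ k → 0 < k → k < q → 0 < k * a₀ % q
      residue₁ : ∀ k → 0 < k → k < q → 0 < k * a₁ % q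
      residue₂ : ∀ k → 0 < k → k < q → 0 < k * a₂ % q

  open Terminal

  terminal-swap₁₂ : ∀ {q a₀ a₁ a₂} .{{_ : NonZero q}} → Terminal q a₀ a₁ a₂ → Terminal q a₀ a₂ a₁
  terminal-swap₁₂ {q} {a₀} {a₁} {a₂} t = terminal
    (λ k p r → trans (cong (k * a₀ % q +_) (+-comm (k * a₂ % q) (k * a₁ % q))) (sum-residues t k p r))
    (residue₀ t) (residue₂ t) (residue₁ t)

  terminal-cycle : ∀ {q a₀ a₁ a₂} .{{_ : NonZero q}} → Terminal q a₀ a₁ a₂ → Terminal q a₁ a₂ a₀
  terminal-cycle {q} {a₀} {a₁} {a₂} t = terminal
    (λ k p r → trans (ring (k * a₀ % q) (k * a₁ % q) (k * a₂ % q)) (sum-residues t k p r))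
    (residue₁ t) (residue₂ t) (residue₀ t)
    where
      ring : ∀ x y z → y + (z + x) ≡ x + (y + z)
      ring = solve-∀

  quotient-unique : ∀ {x m s} q .{{_ : NonZero q}} → x ≡ m * q + s → s < q → x / q ≡ m
  quotient-unique {x} {m} {s} q refl s<q = ≤-antisym
    (≤-pred (m<n*o⇒m/o<n {x} {suc m} {q} (subst (x <_) (+-comm (m * q) q) (+-monoʳ-< (m * q) s<q))))
    (*≤⇒≤/ q (m≤m+n (m * q) s))

  module _ {q′ a₀ a₁ a₂ : ℕ} (1≤q′ : 1 ≤ q′) (t : Terminal (suc q′) a₀ a₁ a₂)
    (a₀<q : a₀ < suc q′) (a₁<q : a₁ < suc q′) (a₂<q : a₂ < suc q′) where
    private
      q = suc q′

      residue-1 : ∀ {a} → a < q → 1 * a % q ≡ a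
      residue-1 {a} a<q = trans (cong (_% q) (*-identityˡ a)) (m<n⇒m%n≡m a<q)

      sum-weights : a₀ + (a₁ + a₂) ≡ q + 1
      sum-weights = trans (sym (cong₂ _+_ (residue-1 a₀<q) (cong₂ _+_ (residue-1 a₁<q) (residue-1 a₂<q))))
        (sum-residues t 1 (s≤s z≤n) (s≤s 1≤q′))

    -- The case k = 1 says that the weights sum to q + 1. Removing the residues, of sum q + k, from
    -- k (q + 1) leaves (k - 1) q for the quotients.
    sum-quotients : ∀ k → 0 < k → k < q → suc (k * a₀ / q + (k * a₁ / q + k * a₂ / q)) ≡ k
    sum-quotients k 0<k k<q = *-cancelʳ-≡ _ k q (+-cancelˡ-≡ k _ (k * q) (begin
      k + suc (A + (B + C)) * q                      ≡⟨ ring k q A B C ⟩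
      (q + k) + (A * q + (B * q + C * q))            ≡⟨ cong (_+ (A * q + (B * q + C * q))) (sum-residues t k 0<k k<q) ⟨
      (r + (s + u)) + (A * q + (B * q + C * q))      ≡⟨ regroup r s u (A * q) (B * q) (C * q) ⟩
      (r + A * q) + ((s + B * q) + (u + C * q))      ≡⟨ cong₂ _+_ (m≡m%n+[m/n]*n (k * a₀) q) (cong₂ _+_ (m≡m%n+[m/n]*n (k * a₁) q) (m≡m%n+[m/n]*n (k * a₂) q)) ⟨
      k * a₀ + (k * a₁ + k * a₂)                     ≡⟨ factor k a₀ a₁ a₂ ⟩
      k * (a₀ + (a₁ + a₂))                           ≡⟨ cong (k *_) sum-weights ⟩
      k * (q + 1)                                    ≡⟨ expand k q ⟩
      k + k * q                                      ∎))
      where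
        open ≡-Reasoning
        A = k * a₀ / q
        B = k * a₁ / q
        C = k * a₂ / q
        r = k * a₀ % q
        s = k * a₁ % q
        u = k * a₂ % q
        ring : ∀ k q A B C → k + suc (A + (B + C)) * q ≡ (q + k) + (A * q + (B * q + C * q))
        ring = solve-∀
        regroup : ∀ r s u x y z → (r + (s + u)) + (x + (y + z)) ≡ (r + x) + ((s + y) + (u + z))
        regroup = solve-∀
        factor : ∀ k a b c → k * a + (k * b + k * c) ≡ k * (a + (b + c))
        factor = solve-∀
        expand : ∀ k q → k * (q + 1) ≡ k + k * q
        expand = solve-∀

    -- If a₀ is the weight above q/2, then b = q - a₀ satisfies ⌊k b / q⌋ = ⌊k a₁ / q⌋ + ⌊k a₂ / q⌋.
    large-weight : 1 ≤ 2 * a₀ / q → a₁ ≡ 1 ⊎ a₂ ≡ 1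
    large-weight 1≤ = by-size (a₁ ≤? 1) (a₂ ≤? 1)
      where
        open ≡-Reasoning
        b = q ∸ a₀
        b+a₀ : b + a₀ ≡ q
        b+a₀ = m∸n+n≡m (<⇒≤ a₀<q)
        instance _ = >-nonZero (m<n⇒0<n∸m a₀<q)
        split : ∀ k → 0 < k → k < q → k * b / q ≡ k * a₁ / q + k * a₂ / q
        -- `k * b` is `k * q` minus `k * a₀`. Since the residue `r` is positive, `q ∸ r` is a
        -- genuine remainder below `q`, which costs exactly the 1 in `sum-quotients`.
        split k 0<k k<q = quotient-unique {m = B + C} {q ∸ r} q (+-cancelʳ-≡ (r + A * q) (k * b) ((B + C) * q + (q ∸ r)) (begin
          k * b + (r + A * q)                             ≡⟨ cong (k * b +_) (m≡m%n+[m/n]*n (k * a₀) q) ⟨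
          k * b + k * a₀                                  ≡⟨ *-distribˡ-+ k b a₀ ⟨
          k * (b + a₀)                                    ≡⟨ cong (k *_) b+a₀ ⟩
          k * q                                           ≡⟨ cong (_* q) (sum-quotients k 0<k k<q) ⟨
          suc (A + (B + C)) * q                           ≡⟨ ring q A B C ⟩
          (B + C) * q + (q + A * q)                       ≡⟨ cong (λ x → (B + C) * q + (x + A * q)) (m∸n+n≡m r≤q) ⟨
          (B + C) * q + ((q ∸ r + r) + A * q)             ≡⟨ regroup ((B + C) * q) (q ∸ r) r (A * q) ⟩
          (B + C) * q + (q ∸ r) + (r + A * q)             ∎))
          (∸-monoʳ-< (residue₀ t k 0<k k<q) r≤q)
          where
            A = k * a₀ / q
            B = k * a₁ / q
            C = k * a₂ / q
            r = k * a₀ % q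
            r≤q : r ≤ q
            r≤q = <⇒≤ (m%n<n (k * a₀) q)
            ring : ∀ q A B C → suc (A + (B + C)) * q ≡ (B + C) * q + (q + A * q)
            ring = solve-∀
            regroup : ∀ x y r z → x + ((y + r) + z) ≡ x + y + (r + z)
            regroup = solve-∀
        split′ : ∀ k → 0 < k → k < q → k * b / q ≡ k * a₂ / q + k * a₁ / q
        split′ k p r = trans (split k p r) (+-comm (k * a₁ / q) (k * a₂ / q))
        q≤2a₀ : q ≤ 2 * a₀
        q≤2a₀ = subst (_≤ 2 * a₀) (*-identityˡ q) (≤/⇒*≤ q 1≤)
        -- Equality would make the residue of `2 * a₀` vanish.
        q≢2a₀ : 1 < q′ → q ≢ 2 * a₀
        q≢2a₀ 1<q′ e = <-irrefl refl (subst (0 <_) (trans (cong (_% q) (sym e)) (n%n≡0 q)) (residue₀ t 2 (s≤s z≤n) (s≤s 1<q′)))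
        2b<q : 1 < q′ → 2 * b < q
        2b<q 1<q′ = +-cancelʳ-< (2 * a₀) (2 * b) q
          (subst (_< q + 2 * a₀) (trans (sym (cong (2 *_) b+a₀)) (*-distribˡ-+ 2 b a₀))
            (subst (_< q + 2 * a₀) (cong (q +_) (sym (+-identityʳ q))) (+-monoʳ-< q (≤∧≢⇒< q≤2a₀ (q≢2a₀ 1<q′)))))
        positive : ∀ {a} → a < q → 0 < 1 * a % q → 0 < a
        positive a<q = subst (0 <_) (residue-1 a<q)
        2≤⇒1<q′ : ∀ {a} → a < q → 2 ≤ a → 1 < q′
        2≤⇒1<q′ a<q 2≤a = ≤-pred (≤-trans (s≤s 2≤a) a<q)
        by-size : _ → _ → a₁ ≡ 1 ⊎ a₂ ≡ 1
        by-size (yes a₁≤1) _ = inj₁ (≤-antisym a₁≤1 (positive a₁<q (residue₁ t 1 (s≤s z≤n) (s≤s 1≤q′))))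
        by-size (no _) (yes a₂≤1) = inj₂ (≤-antisym a₂≤1 (positive a₂<q (residue₂ t 1 (s≤s z≤n) (s≤s 1≤q′))))
        by-size (no a₁≰1) (no a₂≰1) = ⊥-elim (by-order (≤-total a₂ a₁))
          where
            2<q = 2b<q (2≤⇒1<q′ a₁<q (≰⇒> a₁≰1))
            by-order : a₂ ≤ a₁ ⊎ a₁ ≤ a₂ → ⊥
            by-order (inj₁ a₂≤a₁) = no-merge q′ b a₁ a₂ a₂≤a₁ (≰⇒> a₂≰1) 1≤q′ 2<q split
            by-order (inj₂ a₁≤a₂) = no-merge q′ b a₂ a₁ a₁≤a₂ (≰⇒> a₁≰1) 1≤q′ 2<q split′

  -- White's theorem in the form: one of the weights (a₀, a₁, a₂, -1) is 1.
  terminal-weight : ∀ {q′ a₀ a₁ a₂} → 2 ≤ q′ → Terminal (suc q′) a₀ a₁ a₂ →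
    a₀ < suc q′ → a₁ < suc q′ → a₂ < suc q′ → a₀ ≡ 1 ⊎ a₁ ≡ 1 ⊎ a₂ ≡ 1
  terminal-weight {q′} {a₀} {a₁} {a₂} 2≤q′ t a₀<q a₁<q a₂<q = by-half (1 ≤? 2 * a₀ / q) (1 ≤? 2 * a₁ / q) (1 ≤? 2 * a₂ / q)
    where
      q = suc q′
      1≤q′ = ≤-trans (s≤s z≤n) 2≤q′
      by-half : _ → _ → _ → a₀ ≡ 1 ⊎ a₁ ≡ 1 ⊎ a₂ ≡ 1
      by-half (yes p) _ _ = inj₂ (large-weight 1≤q′ t a₀<q a₁<q a₂<q p)
      by-half (no _) (yes p) _ = [ (λ e → inj₂ (inj₂ e)) , inj₁ ]′ (large-weight 1≤q′ (terminal-cycle t) a₁<q a₂<q a₀<q p)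
      by-half (no _) (no _) (yes p) = [ inj₁ , (λ e → inj₂ (inj₁ e)) ]′
        (large-weight 1≤q′ (terminal-cycle (terminal-cycle t)) a₂<q a₀<q a₁<q p)
      -- At k = 2 the quotients sum to 1, so some weight reaches half of `q`.
      by-half (no a) (no b) (no c) = ⊥-elim (0≢1+n (suc-injective (trans (sym (cong suc none)) two)))
        where
          none : 2 * a₀ / q + (2 * a₁ / q + 2 * a₂ / q) ≡ 0
          none = cong₂ _+_ (n<1⇒n≡0 (≰⇒> a)) (cong₂ _+_ (n<1⇒n≡0 (≰⇒> b)) (n<1⇒n≡0 (≰⇒> c)))
          two = sum-quotients 1≤q′ t a₀<q a₁<q a₂<q 2 (s≤s z≤n) (s≤s 2≤q′)

open White using (Terminal; terminal; terminal-weight; x<[1+x/q]*q)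

open import Data.Bool using (Bool; true; false; _∧_; _∨_; not; T; if_then_else_)
open import Data.Bool.Properties using (T-∧; T-∨)
open import Data.Empty using (⊥; ⊥-elim)
open import Data.Fin as Fin using (Fin; zero; suc; toℕ; fromℕ<; combine)
import Data.Fin.Properties as Fin
open import Data.Integer as ℤ using (ℤ; +_; -[1+_]; 0ℤ; 1ℤ; -1ℤ; _+_; _*_; -_; _-_; _≤_; _<_; ∣_∣)
import Data.Integer.DivMod as ℤ
import Data.Integer.Properties as ℤ
open import Data.Integer.Tactic.RingSolver using (solve-∀)
open import Data.List as List using (List; []; _∷_; concatMap; upTo; _++_)
import Data.List.Membership.Propositional as L
open import Data.List.Membership.Propositional.Properties using (∈-map⁺; ∈-++⁺ˡ; ∈-++⁺ʳ; ∈-upTo⁺)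
open import Data.List.Relation.Unary.All as L using ([]; _∷_)
open import Data.List.Relation.Unary.Any using (here; there)
open import Data.Nat as ℕ using (ℕ; zero; suc; _≤ᵇ_)
import Data.Nat.Divisibility as ℕ
import Data.Nat.DivMod as ℕ
open import Data.Nat.Induction using (<-rec)
import Data.Nat.Properties as ℕ
open import Data.Product using (Σ; ∃; ∃₂; _,_; proj₁; proj₂)
open import Data.Rational as ℚ using (ℚ; 0ℚ; 1ℚ; _/_)
import Data.Rational.Properties as ℚ
import Data.Rational.Unnormalised as ℚᵘ
import Data.Rational.Unnormalised.Properties as ℚᵘ
open import Data.Sum using (inj₁; inj₂; [_,_]′)
open import Data.Unit using (tt)
open import Data.Vec using ([]; _∷_; map)
open import Data.Vec.Membership.Propositional using (_∈_)
open import Data.Vec.Relation.Unary.All using (All; []; _∷_)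
open import Data.Vec.Relation.Unary.Any using (here; there)
open import Function using (id)
open import Function.Bundles using (Equivalence; mk⇔)
open import Level using (0ℓ)
open import Relation.Binary.Definitions using (tri<; tri≈; tri>)
open import Relation.Binary.PropositionalEquality using (_≡_; _≢_; refl; sym; trans; cong; cong₂; subst; subst₂; module ≡-Reasoning)
open import Relation.Nullary using (¬_; yes; no)
open import Relation.Nullary.Decidable using (dec⇒maybe)
import Tactic.RingSolver as RingSolver
open import Tactic.RingSolver.Core.AlmostCommutativeRing using (AlmostCommutativeRing; fromCommutativeRing)

ℚ-ring : AlmostCommutativeRing 0ℓ 0ℓ
ℚ-ring = fromCommutativeRing ℚ.+-*-commutativeRing (λ p → dec⇒maybe (0ℚ ℚ.≟ p))

-- Three lattice segments inside a Minkowski sum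

infixl 6 _+ᵥ_
infixl 7 _*ᵥ_
_+ᵥ_ : ℤ³ → ℤ³ → ℤ³
(a , b , c) +ᵥ (d , e , f) = a ℤ.+ d , b ℤ.+ e , c ℤ.+ f

_*ᵥ_ : ℤ → ℤ³ → ℤ³
t *ᵥ (a , b , c) = t ℤ.* a , t ℤ.* b , t ℤ.* c

×³-≡ : ∀ {A : Set} {a b c d e f : A} → a ≡ d → b ≡ e → c ≡ f → (a , b , c) ≡ (d , e , f)
×³-≡ refl refl refl = refl

data Cone (S : ℤ³ → Set) : ℤ → ℤ³ → Set where
  nil : Cone S ℤ.0ℤ e₀
  add : ∀ {v n y} → S v → ∀ a → ℤ.0ℤ ℤ.≤ a → Cone S n y → Cone S (a ℤ.+ n) (a *ᵥ v +ᵥ y)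

-- Membership of `z` in conv S + conv T with a common denominator `N`: both cone elements have total
-- weight `N`. Division is postponed to `inSum-⊕`, so that the whole combinatorial part stays in ℤ.
record InSum (S T : ℤ³ → Set) (z : ℤ³) : Set where
  constructor inSum
  field
    {N}     : ℤ
    {y₁ y₂} : ℤ³
    N-pos   : ℤ.0ℤ ℤ.< N
    cone₁   : Cone S N y₁
    cone₂   : Cone T N y₂
    split   : N *ᵥ z ≡ y₁ +ᵥ y₂

bit : Bool → ℤ³ → ℤ³
bit false _ = e₀
bit true  v = v

-- The obstruction to Minkowski length 2: by convexity the eight corners force the sum of the
-- segments [x, x + a], [0, b] and [0, c] into conv S + conv T. The three vectors may be parallel or
-- even equal.
record Triple (S T : ℤ³ → Set) : Set where
  constructor triple
  field
    x a b c : ℤ³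
    a≢0 : a ≢ e₀
    b≢0 : b ≢ e₀
    c≢0 : c ≢ e₀
    corner : ∀ i j k → InSum S T (x +ᵥ bit i a +ᵥ bit j b +ᵥ bit k c)

/1-+ : ∀ a b → (a ℤ.+ b) / 1 ≡ (a / 1) ℚ.+ (b / 1)
/1-+ a b = ℚ.toℚᵘ-injective (ℚᵘ.≃-trans (ℚ.toℚᵘ-fromℚᵘ (ℚᵘ.mkℚᵘ (a ℤ.+ b) 0)) (ℚᵘ.≃-sym
  (ℚᵘ.≃-trans (ℚ.toℚᵘ-homo-+ (a / 1) (b / 1))
  (ℚᵘ.≃-trans (ℚᵘ.+-cong (ℚ.toℚᵘ-fromℚᵘ (ℚᵘ.mkℚᵘ a 0)) (ℚ.toℚᵘ-fromℚᵘ (ℚᵘ.mkℚᵘ b 0)))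
    (ℚᵘ.*≡* (lem a b))))))
  where
    lem : ∀ a b → (a ℤ.* + 1 ℤ.+ b ℤ.* + 1) ℤ.* + 1 ≡ (a ℤ.+ b) ℤ.* + 1
    lem = solve-∀

/1-* : ∀ a b → (a ℤ.* b) / 1 ≡ (a / 1) ℚ.* (b / 1)
/1-* a b = ℚ.toℚᵘ-injective (ℚᵘ.≃-trans (ℚ.toℚᵘ-fromℚᵘ (ℚᵘ.mkℚᵘ (a ℤ.* b) 0)) (ℚᵘ.≃-sym
  (ℚᵘ.≃-trans (ℚ.toℚᵘ-homo-* (a / 1) (b / 1))
  (ℚᵘ.*-cong (ℚ.toℚᵘ-fromℚᵘ (ℚᵘ.mkℚᵘ a 0)) (ℚ.toℚᵘ-fromℚᵘ (ℚᵘ.mkℚᵘ b 0))))))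

/1-nonneg : ∀ {a} → ℤ.0ℤ ℤ.≤ a → 0ℚ ℚ.≤ a / 1
/1-nonneg {+ n} _ = ℚ.nonNegative⁻¹ (+ n / 1) ⦃ ℚ.normalize-nonNeg n 1 ⦄

ι-+ : ∀ u v → ι (u +ᵥ v) ≡ ι u +³ ι v
ι-+ (a , b , c) (d , e , f) = ×³-≡ (/1-+ a d) (/1-+ b e) (/1-+ c f)

ι-* : ∀ t u → ι (t *ᵥ u) ≡ (t / 1) ·³ ι u
ι-* t (a , b , c) = ×³-≡ (/1-* t a) (/1-* t b) (/1-* t c)

*-nonneg : ∀ {s t} → 0ℚ ℚ.≤ s → 0ℚ ℚ.≤ t → 0ℚ ℚ.≤ s ℚ.* t
*-nonneg {s} {t} 0≤s 0≤t = subst (ℚ._≤ s ℚ.* t) (ℚ.*-zeroʳ s) (ℚ.*-monoˡ-≤-nonNeg s ⦃ ℚ.nonNegative 0≤s ⦄ 0≤t)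

+-nonneg : ∀ {s t} → 0ℚ ℚ.≤ s → 0ℚ ℚ.≤ t → 0ℚ ℚ.≤ s ℚ.+ t
+-nonneg {s} {t} 0≤s 0≤t = subst (ℚ._≤ s ℚ.+ t) (ℚ.+-identityʳ 0ℚ) (ℚ.+-mono-≤ 0≤s 0≤t)

0≤1ℚ : 0ℚ ℚ.≤ 1ℚ
0≤1ℚ = ℚ.nonNegative⁻¹ 1ℚ

lin : ∀ {n} → ℚ → ℚ → Vec ℚ n → Vec ℚ n → Vec ℚ n
lin s t [] [] = []
lin s t (w ∷ ws) (w' ∷ ws') = s ℚ.* w ℚ.+ t ℚ.* w' ∷ lin s t ws ws'

lin-nonneg : ∀ {n s t} {w w' : Vec ℚ n} → 0ℚ ℚ.≤ s → 0ℚ ℚ.≤ t →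
  All (0ℚ ℚ.≤_) w → All (0ℚ ℚ.≤_) w' → All (0ℚ ℚ.≤_) (lin s t w w')
lin-nonneg 0≤s 0≤t [] [] = []
lin-nonneg 0≤s 0≤t (p ∷ ps) (p' ∷ ps') =
  +-nonneg (*-nonneg 0≤s p) (*-nonneg 0≤t p') ∷ lin-nonneg 0≤s 0≤t ps ps'

sum-lin : ∀ {n} s t (w w' : Vec ℚ n) → sumℚ (lin s t w w') ≡ s ℚ.* sumℚ w ℚ.+ t ℚ.* sumℚ w'
sum-lin s t [] [] = sym (trans (cong₂ ℚ._+_ (ℚ.*-zeroʳ s) (ℚ.*-zeroʳ t)) (ℚ.+-identityʳ 0ℚ))
sum-lin s t (w ∷ ws) (w' ∷ ws') = trans (cong (s ℚ.* w ℚ.+ t ℚ.* w' ℚ.+_) (sum-lin s t ws ws'))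
  (lem s t w w' (sumℚ ws) (sumℚ ws'))
  where
    lem : ∀ s t a b c d → s ℚ.* a ℚ.+ t ℚ.* b ℚ.+ (s ℚ.* c ℚ.+ t ℚ.* d) ≡ s ℚ.* (a ℚ.+ c) ℚ.+ t ℚ.* (b ℚ.+ d)
    lem = RingSolver.solve-∀ ℚ-ring

combo-lin : ∀ {n} s t (w w' : Vec ℚ n) vs →
  combo (lin s t w w') vs ≡ (s ·³ combo w vs) +³ (t ·³ combo w' vs)
combo-lin s t [] [] [] = sym (×³-≡ z z z)
  where z = trans (cong₂ ℚ._+_ (ℚ.*-zeroʳ s) (ℚ.*-zeroʳ t)) (ℚ.+-identityʳ 0ℚ)
combo-lin s t (w ∷ ws) (w' ∷ ws') (v@(a , b , c) ∷ vs)
  rewrite combo-lin s t ws ws' vs = ×³-≡ (lem s t w w' _ _ _) (lem s t w w' _ _ _) (lem s t w w' _ _ _)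
  where
    lem : ∀ s t a b v c d → (s ℚ.* a ℚ.+ t ℚ.* b) ℚ.* v ℚ.+ (s ℚ.* c ℚ.+ t ℚ.* d)
        ≡ s ℚ.* (a ℚ.* v ℚ.+ c) ℚ.+ t ℚ.* (b ℚ.* v ℚ.+ d)
    lem = RingSolver.solve-∀ ℚ-ring

Convex : Region → Set
Convex R = ∀ {s t x y} → 0ℚ ℚ.≤ s → 0ℚ ℚ.≤ t → s ℚ.+ t ≡ 1ℚ → R x → R y → R ((s ·³ x) +³ (t ·³ y))

conv-convex : ∀ {n} (vs : Vec ℤ³ n) → Convex (conv vs)
conv-convex vs {s} {t} 0≤s 0≤t s+t≡1 (w , w≥0 , Σw , refl) (w' , w'≥0 , Σw' , refl) =
  lin s t w w' , lin-nonneg 0≤s 0≤t w≥0 w'≥0 ,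
  trans (sum-lin s t w w') (trans (cong₂ (λ p q → s ℚ.* p ℚ.+ t ℚ.* q) Σw Σw')
    (trans (cong₂ ℚ._+_ (ℚ.*-identityʳ s) (ℚ.*-identityʳ t)) s+t≡1)) ,
  sym (combo-lin s t w w' vs)

⊕-convex : ∀ {R S} → Convex R → Convex S → Convex (R ⊕ S)
⊕-convex cR cS {s} {t} 0≤s 0≤t s+t≡1 (a , b , Ra , Sb , refl) (a' , b' , Ra' , Sb' , refl) =
  _ , _ , cR 0≤s 0≤t s+t≡1 Ra Ra' , cS 0≤s 0≤t s+t≡1 Sb Sb' ,
  ×³-≡ (lem s t _ _ _ _) (lem s t _ _ _ _) (lem s t _ _ _ _)
  where
    lem : ∀ s t a b c d → s ℚ.* (a ℚ.+ b) ℚ.+ t ℚ.* (c ℚ.+ d) ≡ (s ℚ.* a ℚ.+ t ℚ.* c) ℚ.+ (s ℚ.* b ℚ.+ t ℚ.* d)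
    lem = RingSolver.solve-∀ ℚ-ring

Weights : ∀ {n} → Vec ℤ³ n → ℚ → ℚ³ → Set
Weights {n} vs t x = Σ (Vec ℚ n) λ w → All (0ℚ ℚ.≤_) w × sumℚ w ≡ t × combo w vs ≡ x

zero-weights : ∀ {n} (vs : Vec ℤ³ n) → Weights vs 0ℚ 0³
zero-weights [] = [] , [] , refl , refl
zero-weights ((a , b , c) ∷ vs) with zero-weights vs
... | w , w≥0 , Σw , cw = 0ℚ ∷ w , ℚ.≤-refl ∷ w≥0 , trans (ℚ.+-identityˡ _) Σw ,
  trans (cong ((0ℚ ·³ ι (a , b , c)) +³_) cw) (×³-≡ (lem (a / 1)) (lem (b / 1)) (lem (c / 1)))
  where
    lem : ∀ p → 0ℚ ℚ.* p ℚ.+ 0ℚ ≡ 0ℚ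
    lem = RingSolver.solve-∀ ℚ-ring

vertex-weights : ∀ {n} {vs : Vec ℤ³ n} {v t} → v ∈ vs → 0ℚ ℚ.≤ t → Weights vs t (t ·³ ι v)
vertex-weights {vs = v@(a , b , c) ∷ vs} {t = t} (here refl) 0≤t with zero-weights vs
... | w , w≥0 , Σw , cw = t ∷ w , 0≤t ∷ w≥0 , trans (cong (t ℚ.+_) Σw) (ℚ.+-identityʳ t) ,
  trans (cong ((t ·³ ι v) +³_) cw)
    (×³-≡ (ℚ.+-identityʳ (t ℚ.* (a / 1))) (ℚ.+-identityʳ (t ℚ.* (b / 1))) (ℚ.+-identityʳ (t ℚ.* (c / 1))))
vertex-weights {vs = u@(a , b , c) ∷ _} {v@(d , e , f)} {t} (there v∈) 0≤t with vertex-weights v∈ 0≤t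
... | w , w≥0 , Σw , cw = 0ℚ ∷ w , ℚ.≤-refl ∷ w≥0 , trans (ℚ.+-identityˡ _) Σw ,
  trans (cong ((0ℚ ·³ ι u) +³_) cw) (×³-≡ (lem (a / 1) (t ℚ.* (d / 1))) (lem (b / 1) (t ℚ.* (e / 1))) (lem (c / 1) (t ℚ.* (f / 1))))
  where
    lem : ∀ p q → 0ℚ ℚ.* p ℚ.+ q ≡ q
    lem = RingSolver.solve-∀ ℚ-ring

-- `r` stands for the reciprocal of the total weight of the outermost cone. The tails have other
-- totals, so `r` has to be independent of the index for the induction.
cone-weights : ∀ {n} {vs : Vec ℤ³ n} {N y r} → 0ℚ ℚ.≤ r → Cone (_∈ vs) N y →
  Weights vs (r ℚ.* (N / 1)) (r ·³ ι y)
cone-weights {vs = vs} {r = r} _ nil with zero-weights vs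
... | w , w≥0 , Σw , cw = w , w≥0 , trans Σw (sym (ℚ.*-zeroʳ r)) ,
  trans cw (sym (×³-≡ (ℚ.*-zeroʳ r) (ℚ.*-zeroʳ r) (ℚ.*-zeroʳ r)))
cone-weights {vs = vs} {r = r} 0≤r (add {v} {n} {y} v∈ a 0≤a c)
  with vertex-weights v∈ (*-nonneg 0≤r (/1-nonneg 0≤a)) | cone-weights 0≤r c
... | w , w≥0 , Σw , cw | w' , w'≥0 , Σw' , cw' =
  lin 1ℚ 1ℚ w w' , lin-nonneg 0≤1ℚ 0≤1ℚ w≥0 w'≥0 ,
  trans (sum-lin 1ℚ 1ℚ w w') (trans (cong₂ (λ p q → 1ℚ ℚ.* p ℚ.+ 1ℚ ℚ.* q) Σw Σw')
    (trans (lem r (a / 1) (n / 1)) (cong (r ℚ.*_) (sym (/1-+ a n))))) ,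
  trans (combo-lin 1ℚ 1ℚ w w' vs) (trans (cong₂ (λ p q → (1ℚ ·³ p) +³ (1ℚ ·³ q)) cw cw')
    (trans (×³-≡ (lem' r (a / 1) _ _) (lem' r (a / 1) _ _) (lem' r (a / 1) _ _))
      (cong (r ·³_) (sym (trans (ι-+ (a *ᵥ v) y) (cong (_+³ ι y) (ι-* a v)))))))
  where
    lem : ∀ r a n → 1ℚ ℚ.* (r ℚ.* a) ℚ.+ 1ℚ ℚ.* (r ℚ.* n) ≡ r ℚ.* (a ℚ.+ n)
    lem = RingSolver.solve-∀ ℚ-ring
    lem' : ∀ r a v y → 1ℚ ℚ.* ((r ℚ.* a) ℚ.* v) ℚ.+ 1ℚ ℚ.* (r ℚ.* y) ≡ r ℚ.* (a ℚ.* v ℚ.+ y)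
    lem' = RingSolver.solve-∀ ℚ-ring

reciprocal : ∀ {N} → ℤ.0ℤ ℤ.< N → ∃ λ r → 0ℚ ℚ.≤ r × r ℚ.* (N / 1) ≡ 1ℚ
reciprocal {+ zero} (ℤ.+<+ ())
reciprocal {+ suc n} _ = 1/N , ℚ.nonNegative⁻¹ 1/N ⦃ ℚ.normalize-nonNeg 1 (suc n) ⦄ ,
  ℚ.toℚᵘ-injective (ℚᵘ.≃-trans (ℚ.toℚᵘ-homo-* 1/N (+ suc n / 1))
    (ℚᵘ.≃-trans (ℚᵘ.*-cong (ℚ.toℚᵘ-fromℚᵘ (ℚᵘ.mkℚᵘ (+ 1) n)) (ℚ.toℚᵘ-fromℚᵘ (ℚᵘ.mkℚᵘ (+ suc n) 0)))
      (ℚᵘ.*≡* (lem (+ suc n)))))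
  where
    1/N = + 1 / suc n
    lem : ∀ m → (+ 1 ℤ.* m) ℤ.* + 1 ≡ + 1 ℤ.* (m ℤ.* + 1)
    lem = solve-∀

·³-cancel : ∀ {r N} z → r ℚ.* (N / 1) ≡ 1ℚ → r ·³ ι (N *ᵥ z) ≡ ι z
·³-cancel {r} {N} z@(a , b , c) rN = trans (cong (r ·³_) (ι-* N z)) (×³-≡ (lem (a / 1)) (lem (b / 1)) (lem (c / 1)))
  where
    lem : ∀ p → r ℚ.* ((N / 1) ℚ.* p) ≡ p
    lem p = trans (sym (ℚ.*-assoc r (N / 1) p)) (trans (cong (ℚ._* p) rN) (ℚ.*-identityˡ p))

cone-conv : ∀ {n} {vs : Vec ℤ³ n} {N z} → ℤ.0ℤ ℤ.< N → Cone (_∈ vs) N (N *ᵥ z) → conv vs (ι z)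
cone-conv {N = N} {z} 0<N c with reciprocal 0<N
... | r , 0≤r , rN with cone-weights 0≤r c
... | w , w≥0 , Σw , cw = w , w≥0 , trans Σw rN , sym (trans cw (·³-cancel {r} {N} z rN))

inSum-⊕ : ∀ {m n} {P : Vec ℤ³ m} {Q : Vec ℤ³ n} {z} → InSum (_∈ P) (_∈ Q) z → (conv P ⊕ conv Q) (ι z)
inSum-⊕ {z = z} (inSum {N} {y₁} {y₂} 0<N c₁ c₂ eq) with reciprocal 0<N
... | r , 0≤r , rN with cone-weights 0≤r c₁ | cone-weights 0≤r c₂
... | w , w≥0 , Σw , cw | w' , w'≥0 , Σw' , cw' =
  r ·³ ι y₁ , r ·³ ι y₂ , (w , w≥0 , trans Σw rN , sym cw) , (w' , w'≥0 , trans Σw' rN , sym cw') ,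
  trans (sym (·³-cancel {r} {N} z rN)) (trans (cong (r ·³_) (trans (cong ι eq) (ι-+ y₁ y₂)))
    (distrib (ι y₁) (ι y₂)))
  where
    distrib : ∀ u v → r ·³ (u +³ v) ≡ (r ·³ u) +³ (r ·³ v)
    distrib (a , b , c) (d , e , f) = ×³-≡ (ℚ.*-distribˡ-+ r a d) (ℚ.*-distribˡ-+ r b e) (ℚ.*-distribˡ-+ r c f)

-- One direction of the interpolation. The trailing zeros are those that `conv` of a two-point
-- vector unfolds to.
segment-mix : ∀ {R} → Convex R → ∀ {s t} p q m → 0ℚ ℚ.≤ s → 0ℚ ℚ.≤ t → s ℚ.+ (t ℚ.+ 0ℚ) ≡ 1ℚ →
  R (p +³ m) → R (q +³ m) → R (((s ·³ p) +³ ((t ·³ q) +³ 0³)) +³ m)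
segment-mix {R} cR {s} {t} p q m@(m₁ , m₂ , m₃) 0≤s 0≤t st Rp Rq =
  subst R (×³-≡ (lem _ _ m₁) (lem _ _ m₂) (lem _ _ m₃))
    (cR 0≤s 0≤t (trans (cong (s ℚ.+_) (sym (ℚ.+-identityʳ t))) st) Rp Rq)
  where
    ring : ∀ s t p q m → s ℚ.* (p ℚ.+ m) ℚ.+ t ℚ.* (q ℚ.+ m)
      ≡ (s ℚ.* p ℚ.+ (t ℚ.* q ℚ.+ 0ℚ)) ℚ.+ (s ℚ.+ (t ℚ.+ 0ℚ)) ℚ.* m
    ring = RingSolver.solve-∀ ℚ-ring
    lem : ∀ p q m → s ℚ.* (p ℚ.+ m) ℚ.+ t ℚ.* (q ℚ.+ m) ≡ (s ℚ.* p ℚ.+ (t ℚ.* q ℚ.+ 0ℚ)) ℚ.+ m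
    lem p q m = trans (ring s t p q m)
      (cong ((s ℚ.* p ℚ.+ (t ℚ.* q ℚ.+ 0ℚ)) ℚ.+_) (trans (cong (ℚ._* m) st) (ℚ.*-identityˡ m)))

segment : ℤ³ → ℤ³ → LatticePolytope
segment u v = lpoly 1 (u ∷ v ∷ [])

segment-posDim : ∀ {u v} → u ≢ v → PosDim (segment u v)
segment-posDim u≢v = zero , suc zero , u≢v

+³-assoc : ∀ u v w → (u +³ v) +³ w ≡ u +³ (v +³ w)
+³-assoc (a , b , c) (d , e , f) (g , h , i) = ×³-≡ (ℚ.+-assoc a d g) (ℚ.+-assoc b e h) (ℚ.+-assoc c f i)

+³-comm : ∀ u v → u +³ v ≡ v +³ u
+³-comm (a , b , c) (d , e , f) = ×³-≡ (ℚ.+-comm a d) (ℚ.+-comm b e) (ℚ.+-comm c f)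

+³-identityʳ : ∀ u → u +³ 0³ ≡ u
+³-identityʳ (a , b , c) = ×³-≡ (ℚ.+-identityʳ a) (ℚ.+-identityʳ b) (ℚ.+-identityʳ c)

+ᵥ-cancel : ∀ x {a} → x ≡ x +ᵥ a → a ≡ e₀
+ᵥ-cancel (x₁ , x₂ , x₃) {a₁ , a₂ , a₃} eq =
  ×³-≡ (lem x₁ a₁ (cong proj₁ eq)) (lem x₂ a₂ (cong (λ v → proj₁ (proj₂ v)) eq)) (lem x₃ a₃ (cong (λ v → proj₂ (proj₂ v)) eq))
  where
    ring : ∀ x a → a ≡ (x ℤ.+ a) ℤ.- x
    ring = solve-∀
    lem : ∀ x a → x ≡ x ℤ.+ a → a ≡ ℤ.0ℤ
    lem x a e = trans (ring x a) (trans (cong (ℤ._- x) (sym e)) (ℤ.+-inverseʳ x))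

-- The corners carry a trilinear interpolation of the whole Minkowski sum.
triple-contains : ∀ {m n} {P : Vec ℤ³ m} {Q : Vec ℤ³ n} → Triple (_∈ P) (_∈ Q) → ContainsSumOf (conv P ⊕ conv Q) 3
triple-contains {P = P} {Q} (triple x a b c a≢0 b≢0 c≢0 corner) =
  (segment x (x +ᵥ a) ∷ segment e₀ b ∷ segment e₀ c ∷ []) ,
  (segment-posDim (λ e → a≢0 (+ᵥ-cancel x e)) ∷ segment-posDim (λ e → b≢0 (sym e)) ∷
   segment-posDim (λ e → c≢0 (sym e)) ∷ []) ,
  contains
  where
    R = conv P ⊕ conv Q
    R-convex : Convex R
    R-convex = ⊕-convex (conv-convex P) (conv-convex Q)
    corner' : ∀ i j k → R ((ι (x +ᵥ bit i a) +³ ι (bit j b)) +³ ι (bit k c))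
    corner' i j k = subst R (trans (ι-+ (x +ᵥ bit i a +ᵥ bit j b) (bit k c)) (cong (_+³ ι (bit k c)) (ι-+ (x +ᵥ bit i a) (bit j b))))
      (inSum-⊕ (corner i j k))
    x+0 : x +ᵥ e₀ ≡ x
    x+0 = ×³-≡ (ℤ.+-identityʳ _) (ℤ.+-identityʳ _) (ℤ.+-identityʳ _)
    contains : MinkSum (map ⟦_⟧ (segment x (x +ᵥ a) ∷ segment e₀ b ∷ segment e₀ c ∷ [])) ⊆R R
    contains _ (_ , _ , (s₁ ∷ t₁ ∷ [] , p₁ ∷ q₁ ∷ [] , st₁ , refl) ,
               (_ , _ , (s₂ ∷ t₂ ∷ [] , p₂ ∷ q₂ ∷ [] , st₂ , refl) ,
               (_ , _ , (s₃ ∷ t₃ ∷ [] , p₃ ∷ q₃ ∷ [] , st₃ , refl) , refl , refl) , refl) , refl) =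
      subst (λ y → R (A +³ (B +³ y))) (sym (+³-identityʳ C))
        (segment-mix {R} R-convex (ι x) (ι (x +ᵥ a)) (B +³ C) p₁ q₁ st₁
          (subst (λ y → R (ι y +³ (B +³ C))) x+0 (face false)) (face true))
      where
        A = (s₁ ·³ ι x) +³ ((t₁ ·³ ι (x +ᵥ a)) +³ 0³)
        B = (s₂ ·³ ι e₀) +³ ((t₂ ·³ ι b) +³ 0³)
        C = (s₃ ·³ ι e₀) +³ ((t₃ ·³ ι c) +³ 0³)
        edge : ∀ i j → R (C +³ (ι (x +ᵥ bit i a) +³ ι (bit j b)))
        edge i j = segment-mix {R} R-convex (ι e₀) (ι c) m p₃ q₃ st₃
          (subst R (+³-comm m (ι e₀)) (corner' i j false)) (subst R (+³-comm m (ι c)) (corner' i j true))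
          where m = ι (x +ᵥ bit i a) +³ ι (bit j b)
        shuffle : ∀ u v w → u +³ (v +³ w) ≡ w +³ (u +³ v)
        shuffle u v w = trans (sym (+³-assoc u v w)) (+³-comm (u +³ v) w)
        shuffle' : ∀ u v w → u +³ (v +³ w) ≡ v +³ (w +³ u)
        shuffle' u v w = trans (+³-comm u (v +³ w)) (+³-assoc v w u)
        face : ∀ i → R (ι (x +ᵥ bit i a) +³ (B +³ C))
        face i = subst R (sym (shuffle' m B C))
          (segment-mix {R} R-convex (ι e₀) (ι b) (C +³ m) p₂ q₂ st₂
            (subst R (shuffle C m (ι e₀)) (edge i false)) (subst R (shuffle C m (ι b)) (edge i true)))
          where m = ι (x +ᵥ bit i a)

triple-length : ∀ {m n} {P : Vec ℤ³ m} {Q : Vec ℤ³ n} → MinkowskiLength≡ (conv P ⊕ conv Q) 2 → ¬ Triple (_∈ P) (_∈ Q)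
triple-length (_ , maximal) t with maximal 3 (triple-contains t)
... | ℕ.s≤s (ℕ.s≤s ())

-- Lattice bases and the normal form of an empty tetrahedron

⟨_,_⟩ : ℤ³ → ℤ³ → ℤ
⟨ (a , b , c) , (d , e , f) ⟩ = a * d + (b * e + c * f)

π₁ π₂ π₃ : ℤ³ → ℤ
π₁ (a , _ , _) = a
π₂ (_ , b , _) = b
π₃ (_ , _ , c) = c

lin₃ : ℤ³ → ℤ³ → ℤ³ → ℤ³ → ℤ³
lin₃ (a , b , c) u v w = a *ᵥ u +ᵥ (b *ᵥ v +ᵥ c *ᵥ w)

Indep : ℤ³ → ℤ³ → ℤ³ → Set
Indep u v w = ∀ c → lin₃ c u v w ≡ e₀ → c ≡ e₀

-- Pairing the vanishing combination with the cross product of `v` and `w` removes `y` and `z` and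
-- leaves `x` times the determinant.
cramer : ∀ x y z u v w → lin₃ (x , y , z) u v w ≡ e₀ → det3 u v w ≢ 0ℤ → x ≡ 0ℤ
cramer x y z u@(a , b , c) v@(d , e , f) w@(g , h , i) eq det≢0 =
  [ id , (λ det≡0 → ⊥-elim (det≢0 det≡0)) ]′ (ℤ.i*j≡0⇒i≡0∨j≡0 x product≡0)
  where
    ring : ∀ x y z a b c d e f g h i →
      x * (a * (e * i - f * h) - b * (d * i - f * g) + c * (d * h - e * g)) ≡
      (x * a + (y * d + z * g)) * (e * i - f * h) - (x * b + (y * e + z * h)) * (d * i - f * g)
        + (x * c + (y * f + z * i)) * (d * h - e * g)
    ring = solve-∀
    zero-row : ∀ l m n → 0ℤ * l - 0ℤ * m + 0ℤ * n ≡ 0ℤ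
    zero-row = solve-∀
    product≡0 : x * det3 u v w ≡ 0ℤ
    product≡0 = trans (ring x y z a b c d e f g h i)
      (trans (cong (λ t → det3 t v w) eq) (zero-row (e * i - f * h) (d * i - f * g) (d * h - e * g)))

det3-cycle : ∀ u v w → det3 v w u ≡ det3 u v w
det3-cycle (a , b , c) (d , e , f) (g , h , i) = ring a b c d e f g h i
  where
    ring : ∀ a b c d e f g h i →
      d * (h * c - i * b) - e * (g * c - i * a) + f * (g * b - h * a) ≡
      a * (e * i - f * h) - b * (d * i - f * g) + c * (d * h - e * g)
    ring = solve-∀

lin₃-cycle : ∀ x y z u v w → lin₃ (y , z , x) v w u ≡ lin₃ (x , y , z) u v w
lin₃-cycle x y z (a , b , c) (d , e , f) (g , h , i) = ×³-≡
  (ring (x * a) (y * d) (z * g)) (ring (x * b) (y * e) (z * h)) (ring (x * c) (y * f) (z * i))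
  where
    ring : ∀ p q r → q + (r + p) ≡ p + (q + r)
    ring = solve-∀

det≢0⇒indep : ∀ {u v w} → det3 u v w ≢ 0ℤ → Indep u v w
det≢0⇒indep {u} {v} {w} det≢0 (x , y , z) eq = ×³-≡
  (cramer x y z u v w eq det≢0)
  (cramer y z x v w u eq′ det≢0′)
  (cramer z x y w u v (trans (lin₃-cycle y z x v w u) eq′) (λ e → det≢0′ (trans (sym (det3-cycle v w u)) e)))
  where
    eq′ = trans (lin₃-cycle x y z u v w) eq
    det≢0′ : det3 v w u ≢ 0ℤ
    det≢0′ e = det≢0 (trans (sym (det3-cycle u v w)) e)

-- Unimodular frames: a basis f of ℤ³ together with its dual basis r.
record Frame : Set where
  constructor frame
  field
    f₁ f₂ f₃ r₁ r₂ r₃ : ℤ³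
  coords : ℤ³ → ℤ³
  coords v = ⟨ r₁ , v ⟩ , ⟨ r₂ , v ⟩ , ⟨ r₃ , v ⟩
  point : ℤ³ → ℤ³
  point c = lin₃ c f₁ f₂ f₃
  field
    point-coords : ∀ v → point (coords v) ≡ v
    coords-point : ∀ c → coords (point c) ≡ c
    unimodular : det3 r₁ r₂ r₃ ≡ 1ℤ ⊎ det3 r₁ r₂ r₃ ≡ -1ℤ

lin₃-standard : ∀ c → lin₃ c e₁ e₂ e₃ ≡ c
lin₃-standard (a , b , c) = ×³-≡ (x-ring a b c) (y-ring a b c) (z-ring a b c)
  where
    x-ring : ∀ a b c → a * 1ℤ + (b * 0ℤ + c * 0ℤ) ≡ a
    x-ring = solve-∀
    y-ring : ∀ a b c → a * 0ℤ + (b * 1ℤ + c * 0ℤ) ≡ b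
    y-ring = solve-∀
    z-ring : ∀ a b c → a * 0ℤ + (b * 0ℤ + c * 1ℤ) ≡ c
    z-ring = solve-∀

standard : Frame
standard = record
  { f₁ = e₁ ; f₂ = e₂ ; f₃ = e₃ ; r₁ = e₁ ; r₂ = e₂ ; r₃ = e₃
  ; point-coords = λ (a , b , c) → trans (lin₃-standard _) (lem′ a b c)
  ; coords-point = λ (a , b , c) → trans (cong (λ v → ⟨ e₁ , v ⟩ , ⟨ e₂ , v ⟩ , ⟨ e₃ , v ⟩) (lin₃-standard (a , b , c))) (lem′ a b c)
  ; unimodular = inj₁ refl }
  where
    x-ring′ : ∀ a b c → 1ℤ * a + (0ℤ * b + 0ℤ * c) ≡ a
    x-ring′ = solve-∀
    y-ring′ : ∀ a b c → 0ℤ * a + (1ℤ * b + 0ℤ * c) ≡ b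
    y-ring′ = solve-∀
    z-ring′ : ∀ a b c → 0ℤ * a + (0ℤ * b + 1ℤ * c) ≡ c
    z-ring′ = solve-∀
    lem′ : ∀ a b c → (⟨ e₁ , (a , b , c) ⟩ , ⟨ e₂ , (a , b , c) ⟩ , ⟨ e₃ , (a , b , c) ⟩) ≡ (a , b , c)
    lem′ a b c = ×³-≡ (x-ring′ a b c) (y-ring′ a b c) (z-ring′ a b c)

cycle : Frame → Frame
cycle F = record
  { f₁ = f₂ ; f₂ = f₃ ; f₃ = f₁ ; r₁ = r₂ ; r₂ = r₃ ; r₃ = r₁
  ; point-coords = λ v → trans (lin₃-cycle ⟨ r₁ , v ⟩ ⟨ r₂ , v ⟩ ⟨ r₃ , v ⟩ f₁ f₂ f₃) (point-coords v)
  ; coords-point = λ (b , c , a) → let e = trans (cong coords (lin₃-cycle a b c f₁ f₂ f₃)) (coords-point (a , b , c)) in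
      ×³-≡ (cong π₂ e) (cong π₃ e) (cong π₁ e)
  ; unimodular = subst (λ d → d ≡ 1ℤ ⊎ d ≡ -1ℤ) (sym (det3-cycle r₁ r₂ r₃)) unimodular }
  where open Frame F

⟨⟩-comb : ∀ x y u v w → ⟨ x *ᵥ u +ᵥ y *ᵥ v , w ⟩ ≡ x * ⟨ u , w ⟩ + y * ⟨ v , w ⟩
⟨⟩-comb x y (a , b , c) (d , e , f) (g , h , i) = ring x y a b c d e f g h i
  where
    ring : ∀ x y a b c d e f g h i → (x * a + y * d) * g + ((x * b + y * e) * h + (x * c + y * f) * i)
      ≡ x * (a * g + (b * h + c * i)) + y * (d * g + (e * h + f * i))
    ring = solve-∀

det3-comb : ∀ p q s t r v w → det3 r (p *ᵥ v +ᵥ q *ᵥ w) (s *ᵥ v +ᵥ t *ᵥ w) ≡ (p * t - q * s) * det3 r v w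
det3-comb p q s t (a , b , c) (d , e , f) (g , h , i) = trans
  (cong₂ _+_ (cong₂ _-_ (cong (a *_) (minor e f h i)) (cong (b *_) (minor d f g i))) (cong (c *_) (minor d e g h)))
  (collect (p * t - q * s) a b c (e * i - f * h) (d * i - f * g) (d * h - e * g))
  where
    minor : ∀ e f h i → (p * e + q * h) * (s * f + t * i) - (p * f + q * i) * (s * e + t * h) ≡ (p * t - q * s) * (e * i - f * h)
    minor = ring p q s t
      where
        ring : ∀ p q s t e f h i → (p * e + q * h) * (s * f + t * i) - (p * f + q * i) * (s * e + t * h) ≡ (p * t - q * s) * (e * i - f * h)
        ring = solve-∀
    collect : ∀ k a b c x y z → a * (k * x) - b * (k * y) + c * (k * z) ≡ k * (a * x - b * y + c * z)
    collect = solve-∀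

lin₃-rotate : ∀ α β y z a b c u v w →
  lin₃ (a , b , c) u (y *ᵥ v +ᵥ z *ᵥ w) ((- β) *ᵥ v +ᵥ α *ᵥ w) ≡ lin₃ (a , y * b - β * c , z * b + α * c) u v w
lin₃-rotate α β y z a b c (u₁ , u₂ , u₃) (v₁ , v₂ , v₃) (w₁ , w₂ , w₃) =
  ×³-≡ (ring α β y z a b c u₁ v₁ w₁) (ring α β y z a b c u₂ v₂ w₂) (ring α β y z a b c u₃ v₃ w₃)
  where
    ring : ∀ α β y z a b c u v w → a * u + (b * (y * v + z * w) + c * (- β * v + α * w))
      ≡ a * u + ((y * b - β * c) * v + (z * b + α * c) * w)
    ring = solve-∀

-- The dual basis is transformed by the inverse transpose of (y z ; -β α).
rotate : ∀ (F : Frame) α β y z → α * y + β * z ≡ 1ℤ → Frame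
rotate F α β y z one = record
  { f₁ = f₁ ; f₂ = y *ᵥ f₂ +ᵥ z *ᵥ f₃ ; f₃ = (- β) *ᵥ f₂ +ᵥ α *ᵥ f₃
  ; r₁ = r₁ ; r₂ = r₂′ ; r₃ = r₃′
  ; point-coords = λ v → trans (cong (λ (p , q) → lin₃ (⟨ r₁ , v ⟩ , p , q) f₁ (y *ᵥ f₂ +ᵥ z *ᵥ f₃) ((- β) *ᵥ f₂ +ᵥ α *ᵥ f₃))
        (cong₂ _,_ (⟨⟩-comb α β r₂ r₃ v) (⟨⟩-comb (- z) y r₂ r₃ v)))
      (trans (rot-point ⟨ r₁ , v ⟩ (α * ⟨ r₂ , v ⟩ + β * ⟨ r₃ , v ⟩) (- z * ⟨ r₂ , v ⟩ + y * ⟨ r₃ , v ⟩))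
        (trans (cong (λ (p , q) → point (⟨ r₁ , v ⟩ , p , q)) (cong₂ _,_ (inv₁ ⟨ r₂ , v ⟩ ⟨ r₃ , v ⟩) (inv₂ ⟨ r₂ , v ⟩ ⟨ r₃ , v ⟩)))
          (point-coords v)))
  ; coords-point = λ (a , b , c) →
      let e = trans (cong coords (rot-point a b c)) (coords-point (a , y * b - β * c , z * b + α * c))
          p = lin₃ (a , b , c) f₁ (y *ᵥ f₂ +ᵥ z *ᵥ f₃) ((- β) *ᵥ f₂ +ᵥ α *ᵥ f₃) in
      ×³-≡ (cong π₁ e)
        (trans (⟨⟩-comb α β r₂ r₃ p) (trans (cong₂ (λ s t → α * s + β * t) (cong π₂ e) (cong π₃ e)) (inv₃ b c)))
        (trans (⟨⟩-comb (- z) y r₂ r₃ p) (trans (cong₂ (λ s t → - z * s + y * t) (cong π₂ e) (cong π₃ e)) (inv₄ b c)))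
  ; unimodular = subst (λ d → d ≡ 1ℤ ⊎ d ≡ -1ℤ)
      (sym (trans (det3-comb α β (- z) y r₁ r₂ r₃) (trans (cong (_* det3 r₁ r₂ r₃) (trans (swap α β y z) one)) (ℤ.*-identityˡ _)))) unimodular }
  where
    open Frame F
    r₂′ = α *ᵥ r₂ +ᵥ β *ᵥ r₃
    r₃′ = (- z) *ᵥ r₂ +ᵥ y *ᵥ r₃
    swap : ∀ α β y z → α * y - β * (- z) ≡ α * y + β * z
    swap = solve-∀
    rot-point : ∀ a b c → lin₃ (a , b , c) f₁ (y *ᵥ f₂ +ᵥ z *ᵥ f₃) ((- β) *ᵥ f₂ +ᵥ α *ᵥ f₃) ≡ point (a , y * b - β * c , z * b + α * c)
    rot-point a b c = lin₃-rotate α β y z a b c f₁ f₂ f₃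
    unit : ∀ p → (α * y + β * z) * p ≡ p
    unit p = trans (cong (_* p) one) (ℤ.*-identityˡ p)
    inv₁ : ∀ p q → y * (α * p + β * q) - β * (- z * p + y * q) ≡ p
    inv₁ p q = trans (ring α β y z p q) (unit p)
      where
        ring : ∀ α β y z p q → y * (α * p + β * q) - β * (- z * p + y * q) ≡ (α * y + β * z) * p
        ring = solve-∀
    inv₂ : ∀ p q → z * (α * p + β * q) + α * (- z * p + y * q) ≡ q
    inv₂ p q = trans (ring α β y z p q) (unit q)
      where
        ring : ∀ α β y z p q → z * (α * p + β * q) + α * (- z * p + y * q) ≡ (α * y + β * z) * q
        ring = solve-∀
    inv₃ : ∀ b c → α * (y * b - β * c) + β * (z * b + α * c) ≡ b
    inv₃ b c = trans (ring α β y z b c) (unit b)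
      where
        ring : ∀ α β y z b c → α * (y * b - β * c) + β * (z * b + α * c) ≡ (α * y + β * z) * b
        ring = solve-∀
    inv₄ : ∀ b c → - z * (y * b - β * c) + y * (z * b + α * c) ≡ c
    inv₄ b c = trans (ring α β y z b c) (unit c)
      where
        ring : ∀ α β y z b c → - z * (y * b - β * c) + y * (z * b + α * c) ≡ (α * y + β * z) * c
        ring = solve-∀

-- The reduced pair is kept with its own cofactors instead of a relation for `d`, so that it defines
-- a basis change even when y = z = 0, where `d` is 0.
record Bézout (y z : ℤ) : Set where
  constructor bézout
  field
    {d α β y′ z′} : ℤ
    y≡ : y ≡ d * y′
    z≡ : z ≡ d * z′
    0≤d : 0ℤ ≤ d
    one : α * y′ + β * z′ ≡ 1ℤ

bézout-identity : ∀ y z → Bézout y z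
bézout-identity y z = <-rec (λ n → ∀ y z → ∣ z ∣ ≡ n → Bézout y z) step ∣ z ∣ y z refl
  where
    zero-second : ∀ y → Bézout y 0ℤ
    zero-second y@(+ _) = bézout {d = y} {1ℤ} {0ℤ} {1ℤ} {0ℤ} (sym (ℤ.*-identityʳ y)) (sym (ℤ.*-zeroʳ y)) (ℤ.+≤+ ℕ.z≤n) refl
    zero-second y@(-[1+ n ]) = bézout {d = - y} { -1ℤ } {0ℤ} { -1ℤ } {0ℤ} (neg-neg y) (sym (ℤ.*-zeroʳ (- y))) (ℤ.+≤+ ℕ.z≤n) refl
      where
        neg-neg : ∀ y → y ≡ - y * -1ℤ
        neg-neg = solve-∀
    step : ∀ n → (∀ {m} → m ℕ.< n → ∀ y z → ∣ z ∣ ≡ m → Bézout y z) → ∀ y z → ∣ z ∣ ≡ n → Bézout y z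
    step n rec y z ∣z∣≡n with z ℤ.≟ 0ℤ
    ... | yes refl = zero-second y
    ... | no z≢0 with rec {y ℤ.% z} (subst (y ℤ.% z ℕ.<_) ∣z∣≡n (ℤ.n%d<d y z)) z (+ (y ℤ.% z)) refl
      where instance _ = ℤ.≢-nonZero z≢0
    ...   | bézout {d} {α} {β} {z′} {r′} z≡ r≡ 0≤d one =
      bézout {d = d} {β} {α - q * β} {r′ + q * z′} {z′}
        (trans (ℤ.a≡a%n+[a/n]*n y z) (trans (cong₂ (λ r z → r + q * z) r≡ z≡) (ring₁ d q r′ z′)))
        z≡ 0≤d (trans (ring₂ α β q r′ z′) one)
      where
        instance _ = ℤ.≢-nonZero z≢0
        q = y ℤ./ z
        ring₁ : ∀ d q r z → d * r + q * (d * z) ≡ d * (r + q * z)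
        ring₁ = solve-∀
        ring₂ : ∀ α β q r z → β * (r + q * z) + (α - q * β) * z ≡ α * z + β * r
        ring₂ = solve-∀

-- One column operation of the Hermite form: the last two basis vectors are rotated until y f₂ + z
-- f₃ is a multiple of one of them. Keeping `f₁` preserves what has been achieved for earlier
-- vectors.
clear : ∀ (F : Frame) x y z → Σ Frame λ G → Frame.f₁ G ≡ Frame.f₁ F ×
  (∃ λ d → 0ℤ ≤ d × Frame.point F (x , y , z) ≡ Frame.point G (x , d , 0ℤ))
clear F x y z = build (bézout-identity y z)
  where
    open Frame F
    ring : ∀ x d α β y z u v w → x * u + (d * y * v + d * z * w) ≡ x * u + (d * (y * v + z * w) + 0ℤ * (- β * v + α * w))
    ring = solve-∀
    vec : ∀ d α β y z u v w → lin₃ (x , d * y , d * z) u v w ≡ lin₃ (x , d , 0ℤ) u (y *ᵥ v +ᵥ z *ᵥ w) ((- β) *ᵥ v +ᵥ α *ᵥ w)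
    vec d α β y z (u₁ , u₂ , u₃) (v₁ , v₂ , v₃) (w₁ , w₂ , w₃) =
      ×³-≡ (ring x d α β y z u₁ v₁ w₁) (ring x d α β y z u₂ v₂ w₂) (ring x d α β y z u₃ v₃ w₃)
    build : Bézout y z → _
    build (bézout {d} {α} {β} {y′} {z′} y≡ z≡ 0≤d one) = rotate F α β y′ z′ one , refl , d , 0≤d ,
      trans (cong₂ (λ s t → point (x , s , t)) y≡ z≡) (vec d α β y′ z′ f₁ f₂ f₃)

lin₃-zero : ∀ a u v w → lin₃ (a , 0ℤ , 0ℤ) u v w ≡ a *ᵥ u
lin₃-zero a (u₁ , u₂ , u₃) (v₁ , v₂ , v₃) (w₁ , w₂ , w₃) = ×³-≡ (ring a u₁ v₁ w₁) (ring a u₂ v₂ w₂) (ring a u₃ v₃ w₃)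
  where
    ring : ∀ a u v w → a * u + (0ℤ * v + 0ℤ * w) ≡ a * u
    ring = solve-∀

flip : Frame → Frame
flip F = record
  { f₁ = f₁ ; f₂ = f₂ ; f₃ = -1ℤ *ᵥ f₃ ; r₁ = r₁ ; r₂ = r₂ ; r₃ = -1ℤ *ᵥ r₃
  ; point-coords = λ v → trans (cong (λ t → lin₃ (⟨ r₁ , v ⟩ , ⟨ r₂ , v ⟩ , t) f₁ f₂ (-1ℤ *ᵥ f₃)) (⟨⟩-neg r₃ v))
      (trans (lin₃-neg ⟨ r₁ , v ⟩ ⟨ r₂ , v ⟩ (- ⟨ r₃ , v ⟩) f₁ f₂ f₃)
        (trans (cong (λ t → point (⟨ r₁ , v ⟩ , ⟨ r₂ , v ⟩ , t)) (ℤ.neg-involutive ⟨ r₃ , v ⟩)) (point-coords v)))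
  ; coords-point = λ (a , b , c) →
      let e = trans (cong coords (lin₃-neg a b c f₁ f₂ f₃)) (coords-point (a , b , - c)) in
      ×³-≡ (cong π₁ e) (cong π₂ e)
        (trans (⟨⟩-neg r₃ (lin₃ (a , b , c) f₁ f₂ (-1ℤ *ᵥ f₃))) (trans (cong -_ (cong π₃ e)) (ℤ.neg-involutive c)))
  ; unimodular = subst (λ d → d ≡ 1ℤ ⊎ d ≡ -1ℤ) (sym (det3-neg r₁ r₂ r₃)) (negate unimodular) }
  where
    open Frame F
    ⟨⟩-neg : ∀ u v → ⟨ -1ℤ *ᵥ u , v ⟩ ≡ - ⟨ u , v ⟩
    ⟨⟩-neg (a , b , c) (d , e , f) = ring a b c d e f
      where
        ring : ∀ a b c d e f → (-1ℤ * a) * d + ((-1ℤ * b) * e + (-1ℤ * c) * f) ≡ - (a * d + (b * e + c * f))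
        ring = solve-∀
    lin₃-neg : ∀ a b c u v w → lin₃ (a , b , c) u v (-1ℤ *ᵥ w) ≡ lin₃ (a , b , - c) u v w
    lin₃-neg a b c (u₁ , u₂ , u₃) (v₁ , v₂ , v₃) (w₁ , w₂ , w₃) =
      ×³-≡ (ring a b c u₁ v₁ w₁) (ring a b c u₂ v₂ w₂) (ring a b c u₃ v₃ w₃)
      where
        ring : ∀ a b c u v w → a * u + (b * v + c * (-1ℤ * w)) ≡ a * u + (b * v + - c * w)
        ring = solve-∀
    det3-neg : ∀ u v w → det3 u v (-1ℤ *ᵥ w) ≡ - det3 u v w
    det3-neg (a , b , c) (d , e , f) (g , h , i) = ring a b c d e f g h i
      where
        ring : ∀ a b c d e f g h i → a * (e * (-1ℤ * i) - f * (-1ℤ * h)) - b * (d * (-1ℤ * i) - f * (-1ℤ * g)) + c * (d * (-1ℤ * h) - e * (-1ℤ * g))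
          ≡ - (a * (e * i - f * h) - b * (d * i - f * g) + c * (d * h - e * g))
        ring = solve-∀
    negate : ∀ {d} → d ≡ 1ℤ ⊎ d ≡ -1ℤ → - d ≡ 1ℤ ⊎ - d ≡ -1ℤ
    negate (inj₁ refl) = inj₂ refl
    negate (inj₂ refl) = inj₁ refl

record Hermite (u₁ u₂ u₃ : ℤ³) : Set where
  constructor hermite
  field
    {F} : Frame
    {d₁ x d₂ a b d₃} : ℤ
  open Frame F public
  field
    0≤d₁ : 0ℤ ≤ d₁
    0≤d₂ : 0ℤ ≤ d₂
    u₁≡ : u₁ ≡ d₁ *ᵥ f₁
    u₂≡ : u₂ ≡ lin₃ (x , d₂ , 0ℤ) f₁ f₂ f₃
    u₃≡ : u₃ ≡ lin₃ (a , b , d₃) f₁ f₂ f₃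

-- Two uses of `clear`, on cyclically shifted frames, make `u₁` a multiple of one basis vector. That
-- vector is then moved to the first place, where the third use of `clear`, for `u₂`, leaves it
-- fixed; `u₃` is only expanded.
hermite-form : ∀ u₁ u₂ u₃ → Hermite u₁ u₂ u₃
hermite-form u₁@(p , q , r) u₂ u₃ = first (clear standard p q r)
  where
    third : ∀ {K d₁} → 0ℤ ≤ d₁ → u₁ ≡ d₁ *ᵥ Frame.f₁ K →
      (Σ Frame λ G → Frame.f₁ G ≡ Frame.f₁ K × ∃ λ d → 0ℤ ≤ d × Frame.point K (Frame.coords K u₂) ≡ Frame.point G (⟨ Frame.r₁ K , u₂ ⟩ , d , 0ℤ)) →
      Hermite u₁ u₂ u₃
    third {K} {d₁} 0≤d₁ u₁≡ (G , f₁≡ , d₂ , 0≤d₂ , eq) = hermite {F = G} {d₁} {⟨ Frame.r₁ K , u₂ ⟩} {d₂} {⟨ Frame.r₁ G , u₃ ⟩} {⟨ Frame.r₂ G , u₃ ⟩} {⟨ Frame.r₃ G , u₃ ⟩} 0≤d₁ 0≤d₂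
      (trans u₁≡ (cong (d₁ *ᵥ_) (sym f₁≡))) (trans (sym (Frame.point-coords K u₂)) eq) (sym (Frame.point-coords G u₃))
    second : ∀ {G a d} → u₁ ≡ Frame.point G (a , d , 0ℤ) →
      (Σ Frame λ H → Frame.f₁ H ≡ Frame.f₃ G × ∃ λ e → 0ℤ ≤ e × Frame.point (cycle (cycle G)) (0ℤ , a , d) ≡ Frame.point H (0ℤ , e , 0ℤ)) →
      Hermite u₁ u₂ u₃
    second {G} {a} {d} u₁≡ (H , _ , e , 0≤e , eq) = third {K = cycle H} {e} 0≤e
      (trans u₁≡ (trans (lin₃-cycle 0ℤ a d (Frame.f₃ G) (Frame.f₁ G) (Frame.f₂ G)) (trans eq
        (trans (sym (lin₃-cycle 0ℤ e 0ℤ (Frame.f₁ H) (Frame.f₂ H) (Frame.f₃ H)))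
          (lin₃-zero e (Frame.f₂ H) (Frame.f₃ H) (Frame.f₁ H))))))
      (let (x , y , z) = Frame.coords (cycle H) u₂ in clear (cycle H) x y z)
    first : (Σ Frame λ G → Frame.f₁ G ≡ e₁ × ∃ λ d → 0ℤ ≤ d × Frame.point standard (p , q , r) ≡ Frame.point G (p , d , 0ℤ)) →
      Hermite u₁ u₂ u₃
    first (G , _ , d , _ , eq) = second {G} {p} {d} (trans (sym (lin₃-standard u₁)) eq) (clear (cycle (cycle G)) 0ℤ p d)

indep-zero : ∀ {u v w} a b c → Indep u v w → lin₃ (a , b , c) u v w ≡ e₀ → (a ≢ 0ℤ ⊎ b ≢ 0ℤ ⊎ c ≢ 0ℤ) → ⊥
indep-zero a b c ind eq nz = contra nz (ind (a , b , c) eq)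
  where
    contra : a ≢ 0ℤ ⊎ b ≢ 0ℤ ⊎ c ≢ 0ℤ → (a , b , c) ≡ e₀ → ⊥
    contra (inj₁ a≢0) e = a≢0 (cong π₁ e)
    contra (inj₂ (inj₁ b≢0)) e = b≢0 (cong π₂ e)
    contra (inj₂ (inj₂ c≢0)) e = c≢0 (cong π₃ e)

-- Emptiness in barycentric numerators over a denominator `N`, with one vertex at the origin. The
-- conclusion is about the numerators rather than `z`, so that a single numerator strictly between 0
-- and `N` is already a contradiction.
EmptySimplex : ℤ³ → ℤ³ → ℤ³ → Set
EmptySimplex u₁ u₂ u₃ = ∀ N a b c z → 0ℤ < N → 0ℤ ≤ a → 0ℤ ≤ b → 0ℤ ≤ c → a + (b + c) ≤ N →
  N *ᵥ z ≡ lin₃ (a , b , c) u₁ u₂ u₃ →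
  (a , b , c) ≡ e₀ ⊎ (a , b , c) ≡ (N , 0ℤ , 0ℤ) ⊎ (a , b , c) ≡ (0ℤ , N , 0ℤ) ⊎ (a , b , c) ≡ (0ℤ , 0ℤ , N)

module _ {v₀ v₁ v₂ v₃ : ℤ³} (tet : EmptyTetrahedron (v₀ ∷ v₁ ∷ v₂ ∷ v₃ ∷ [])) where
  private
    u₁ = v₁ -ℤ³ v₀
    u₂ = v₂ -ℤ³ v₀
    u₃ = v₃ -ℤ³ v₀
    vs : Vec ℤ³ 4
    vs = v₀ ∷ v₁ ∷ v₂ ∷ v₃ ∷ []

  edges-indep : Indep u₁ u₂ u₃
  edges-indep = det≢0⇒indep (proj₁ tet)

  private
    cancel : ∀ v z w → v +ᵥ z ≡ w → z ≡ w -ℤ³ v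
    cancel (a , b , c) (d , e , f) w refl = ×³-≡ (ring a d) (ring b e) (ring c f)
      where
        ring : ∀ a d → d ≡ (a + d) - a
        ring = solve-∀

    cone : ∀ N a b c z → 0ℤ ≤ a → 0ℤ ≤ b → 0ℤ ≤ c → a + (b + c) ≤ N →
      N *ᵥ z ≡ lin₃ (a , b , c) u₁ u₂ u₃ → Cone (_∈ vs) N (N *ᵥ (v₀ +ᵥ z))
    cone N a b c z 0≤a 0≤b 0≤c Σ≤N eq = subst₂ (Cone (_∈ vs)) (total N a b c) (trans (vec v₀ v₁ v₂ v₃) (vec′ v₀ z eq))
      (add (here refl) (N - (a + (b + c))) (ℤ.i≤j⇒0≤j-i Σ≤N) (add (there (here refl)) a 0≤a
        (add (there (there (here refl))) b 0≤b (add (there (there (there (here refl)))) c 0≤c nil))))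
      where
        total : ∀ N a b c → N - (a + (b + c)) + (a + (b + (c + 0ℤ))) ≡ N
        total = solve-∀
        ring : ∀ N a b c p q r s → (N - (a + (b + c))) * p + (a * q + (b * r + (c * s + 0ℤ)))
          ≡ N * p + (a * (q - p) + (b * (r - p) + c * (s - p)))
        ring = solve-∀
        vec : ∀ v₀ v₁ v₂ v₃ → (N - (a + (b + c))) *ᵥ v₀ +ᵥ (a *ᵥ v₁ +ᵥ (b *ᵥ v₂ +ᵥ (c *ᵥ v₃ +ᵥ e₀)))
          ≡ N *ᵥ v₀ +ᵥ lin₃ (a , b , c) (v₁ -ℤ³ v₀) (v₂ -ℤ³ v₀) (v₃ -ℤ³ v₀)
        vec (p , p′ , p″) (q , q′ , q″) (r , r′ , r″) (s , s′ , s″) =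
          ×³-≡ (ring N a b c p q r s) (ring N a b c p′ q′ r′ s′) (ring N a b c p″ q″ r″ s″)
        vec′ : ∀ v z {w} → N *ᵥ z ≡ w → N *ᵥ v +ᵥ w ≡ N *ᵥ (v +ᵥ z)
        vec′ (p , p′ , p″) (q , q′ , q″) refl =
          ×³-≡ (sym (ℤ.*-distribˡ-+ N p q)) (sym (ℤ.*-distribˡ-+ N p′ q′)) (sym (ℤ.*-distribˡ-+ N p″ q″))

    subtract₁ : ∀ N a b c u v w → N *ᵥ u ≡ lin₃ (a , b , c) u v w → lin₃ (a - N , b , c) u v w ≡ e₀
    subtract₁ N a b c (u , u′ , u″) (v , v′ , v″) (w , w′ , w″) eq =
      ×³-≡ (scalar u v w (cong π₁ eq)) (scalar u′ v′ w′ (cong π₂ eq)) (scalar u″ v″ w″ (cong π₃ eq))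
      where
        ring : ∀ N a b c u v w → (a - N) * u + (b * v + c * w) ≡ (a * u + (b * v + c * w)) - N * u
        ring = solve-∀
        scalar : ∀ u v w → N * u ≡ a * u + (b * v + c * w) → (a - N) * u + (b * v + c * w) ≡ 0ℤ
        scalar u v w e = trans (ring N a b c u v w) (ℤ.i≡j⇒i-j≡0 (sym e))

    cycle-indep : ∀ {u v w} → Indep u v w → Indep v w u
    cycle-indep {u} {v} {w} ind (y , z , x) eq =
      let e = ind (x , y , z) (trans (sym (lin₃-cycle x y z u v w)) eq) in ×³-≡ (cong π₂ e) (cong π₃ e) (cong π₁ e)

    first-vertex : ∀ {u v w} N a b c → Indep u v w → N *ᵥ u ≡ lin₃ (a , b , c) u v w → (a , b , c) ≡ (N , 0ℤ , 0ℤ)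
    first-vertex {u} {v} {w} N a b c ind eq =
      let e = ind (a - N , b , c) (subtract₁ N a b c u v w eq) in
      ×³-≡ (ℤ.i-j≡0⇒i≡j a N (cong π₁ e)) (cong π₂ e) (cong π₃ e)

  empty-simplex : EmptySimplex u₁ u₂ u₃
  empty-simplex N a b c z 0<N 0≤a 0≤b 0≤c Σ≤N eq =
    locate (proj₂ tet (v₀ +ᵥ z) (cone-conv {vs = vs} {N} {v₀ +ᵥ z} 0<N (cone N a b c z 0≤a 0≤b 0≤c Σ≤N eq)))
    where
      at : ∀ {w} → v₀ +ᵥ z ≡ w → N *ᵥ (w -ℤ³ v₀) ≡ lin₃ (a , b , c) u₁ u₂ u₃
      at {w} e = trans (cong (N *ᵥ_) (sym (cancel v₀ z w e))) eq
      origin : ∀ v → N *ᵥ (v -ℤ³ v) ≡ e₀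
      origin (p , q , r) = ×³-≡ (ring N p) (ring N q) (ring N r)
        where
          ring : ∀ N p → N * (p - p) ≡ 0ℤ
          ring = solve-∀
      locate : v₀ +ᵥ z ∈ vs → _
      locate (here e) = inj₁ (edges-indep (a , b , c) (trans (sym (at e)) (origin v₀)))
      locate (there (here e)) = inj₂ (inj₁ (first-vertex N a b c edges-indep (at e)))
      locate (there (there (here e))) =
        let f = first-vertex N b c a (cycle-indep edges-indep) (trans (at e) (sym (lin₃-cycle a b c u₁ u₂ u₃))) in
        inj₂ (inj₂ (inj₁ (×³-≡ (cong π₃ f) (cong π₁ f) (cong π₂ f))))
      locate (there (there (there (here e)))) =
        let f = first-vertex N c a b (cycle-indep (cycle-indep edges-indep))
                  (trans (at e) (sym (trans (lin₃-cycle b c a u₂ u₃ u₁) (lin₃-cycle a b c u₁ u₂ u₃)))) in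
        inj₂ (inj₂ (inj₂ (×³-≡ (cong π₂ f) (cong π₃ f) (cong π₁ f))))

-- Up to a unimodular map the tetrahedron is 0, e₁, e₂, (a, b, q), and `q` is its normalized volume.
record Normal (u₁ u₂ u₃ : ℤ³) : Set where
  constructor normal
  field
    {F} : Frame
    {a b q} : ℤ
  open Frame F public
  field
    0<q : 0ℤ < q
    u₁≡ : u₁ ≡ f₁
    u₂≡ : u₂ ≡ f₂
    u₃≡ : u₃ ≡ lin₃ (a , b , q) f₁ f₂ f₃

1≢0 : 1ℤ ≢ 0ℤ
1≢0 ()

≢0⇒0< : ∀ {d} → 0ℤ ≤ d → d ≢ 0ℤ → 0ℤ < d
≢0⇒0< 0≤d d≢0 = ℤ.≤∧≢⇒< 0≤d (λ e → d≢0 (sym e))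

lin₃-unit₁ : ∀ u v w → lin₃ (1ℤ , 0ℤ , 0ℤ) u v w ≡ u
lin₃-unit₁ u v w = trans (lin₃-zero 1ℤ u v w) (unit u)
  where
    unit : ∀ u → 1ℤ *ᵥ u ≡ u
    unit (a , b , c) = ×³-≡ (ℤ.*-identityˡ a) (ℤ.*-identityˡ b) (ℤ.*-identityˡ c)

-- The lattice point `f` lies on the edge at parameter 1 / d, hence must be its endpoint.
first-primitive : ∀ {u₁ u₂ u₃ f d} → EmptySimplex u₁ u₂ u₃ → Indep u₁ u₂ u₃ → 0ℤ ≤ d → u₁ ≡ d *ᵥ f → d ≡ 1ℤ
first-primitive {u₁} {u₂} {u₃} {f} {d} empty ind 0≤d u₁≡ =
  conclude (empty d 1ℤ 0ℤ 0ℤ f 0<d (ℤ.+≤+ ℕ.z≤n) ℤ.≤-refl ℤ.≤-refl (ℤ.i<j⇒suc[i]≤j 0<d)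
    (trans (sym u₁≡) (sym (lin₃-unit₁ u₁ u₂ u₃))))
  where
    0<d = ≢0⇒0< 0≤d λ d≡0 → indep-zero 1ℤ 0ℤ 0ℤ ind (trans (lin₃-unit₁ u₁ u₂ u₃) (trans u₁≡ (cong (_*ᵥ f) d≡0))) (inj₁ 1≢0)
    conclude : _ → d ≡ 1ℤ
    conclude (inj₁ e) = ⊥-elim (1≢0 (cong π₁ e))
    conclude (inj₂ (inj₁ e)) = sym (cong π₁ e)
    conclude (inj₂ (inj₂ (inj₁ e))) = ⊥-elim (1≢0 (cong π₁ e))
    conclude (inj₂ (inj₂ (inj₂ e))) = ⊥-elim (1≢0 (cong π₁ e))

-- An empty triangle 0, f, x f + d g has d = 1: otherwise it contains ((x mod d) > 0) f + g, up to a shear.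
second-primitive : ∀ {u₁ u₂ u₃ g h x d} → EmptySimplex u₁ u₂ u₃ → Indep u₁ u₂ u₃ → 0ℤ ≤ d →
  u₂ ≡ lin₃ (x , d , 0ℤ) u₁ g h → d ≡ 1ℤ
second-primitive {u₁} {u₂} {u₃} {g} {h} {x} {d} empty ind 0≤d u₂≡ = by-remainder r refl
  where
    ring₀ : ∀ x d u g h w → - x * u + (1ℤ * (x * u + (d * g + 0ℤ * h)) + 0ℤ * w) ≡ d * g
    ring₀ = solve-∀
    relation : ∀ u g h w → lin₃ (- x , 1ℤ , 0ℤ) u (lin₃ (x , d , 0ℤ) u g h) w ≡ d *ᵥ g
    relation (u , u′ , u″) (g , g′ , g″) (h , h′ , h″) (w , w′ , w″) =
      ×³-≡ (ring₀ x d u g h w) (ring₀ x d u′ g′ h′ w′) (ring₀ x d u″ g″ h″ w″)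
    d≢0 : d ≢ 0ℤ
    d≢0 d≡0 = indep-zero (- x) 1ℤ 0ℤ ind
      (trans (cong (λ t → lin₃ (- x , 1ℤ , 0ℤ) u₁ t u₃) u₂≡) (trans (relation u₁ g h u₃) (cong (_*ᵥ g) d≡0))) (inj₂ (inj₁ 1≢0))
    0<d = ≢0⇒0< 0≤d d≢0
    instance _ = ℤ.≢-nonZero d≢0
    e = x ℤ./ d
    r = x ℤ.% d
    division : x ≡ + r + e * d
    division = ℤ.a≡a%n+[a/n]*n x d
    r<d : + r < d
    r<d = subst (+ r <_) (ℤ.0≤i⇒+∣i∣≡i 0≤d) (ℤ.+<+ (ℤ.n%d<d x d))
    by-remainder : ∀ n → r ≡ n → d ≡ 1ℤ
    by-remainder zero r≡0 =
      conclude (empty d 0ℤ 1ℤ 0ℤ (e *ᵥ u₁ +ᵥ g) 0<d ℤ.≤-refl (ℤ.+≤+ ℕ.z≤n) ℤ.≤-refl (ℤ.i<j⇒suc[i]≤j 0<d)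
        (trans (vec u₁ g h u₃) (cong (λ t → lin₃ (0ℤ , 1ℤ , 0ℤ) u₁ t u₃) (sym u₂≡))))
      where
        x≡ : x ≡ e * d
        x≡ = trans division (trans (cong (λ n → + n + e * d) r≡0) (ℤ.+-identityˡ (e * d)))
        ring : ∀ e d u g h w → d * (e * u + g) ≡ 0ℤ * u + (1ℤ * (e * d * u + (d * g + 0ℤ * h)) + 0ℤ * w)
        ring = solve-∀
        vec : ∀ u g h w → d *ᵥ (e *ᵥ u +ᵥ g) ≡ lin₃ (0ℤ , 1ℤ , 0ℤ) u (lin₃ (x , d , 0ℤ) u g h) w
        vec u@(p , p′ , p″) g@(s , s′ , s″) h@(t , t′ , t″) w@(v , v′ , v″) =
          trans (×³-≡ (ring e d p s t v) (ring e d p′ s′ t′ v′) (ring e d p″ s″ t″ v″))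
            (cong (λ y → lin₃ (0ℤ , 1ℤ , 0ℤ) u (lin₃ (y , d , 0ℤ) u g h) w) (sym x≡))
        conclude : _ → d ≡ 1ℤ
        conclude (inj₁ e) = ⊥-elim (1≢0 (cong π₂ e))
        conclude (inj₂ (inj₁ e)) = ⊥-elim (1≢0 (cong π₂ e))
        conclude (inj₂ (inj₂ (inj₁ e))) = sym (cong π₂ e)
        conclude (inj₂ (inj₂ (inj₂ e))) = ⊥-elim (1≢0 (cong π₂ e))
    by-remainder (suc m) r≡ =
      ⊥-elim (conclude (empty d (d - + r) 1ℤ 0ℤ ((1ℤ + e) *ᵥ u₁ +ᵥ g) 0<d (ℤ.i≤j⇒0≤j-i (ℤ.<⇒≤ r<d)) (ℤ.+≤+ ℕ.z≤n) ℤ.≤-refl sum≤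
        (trans (vec u₁ g h u₃) (cong (λ t → lin₃ (d - + r , 1ℤ , 0ℤ) u₁ t u₃) (sym u₂≡)))))
      where
        1≤r : 1ℤ ≤ + r
        1≤r = subst (λ n → 1ℤ ≤ + n) (sym r≡) (ℤ.+≤+ (ℕ.s≤s ℕ.z≤n))
        sum-ring : ∀ d r → d - r + (1ℤ + 0ℤ) ≡ d - (r - 1ℤ)
        sum-ring = solve-∀
        sum≤ : d - + r + (1ℤ + 0ℤ) ≤ d
        sum≤ = subst (_≤ d) (sym (sum-ring d (+ r)))
          (subst (d - (+ r - 1ℤ) ≤_) (ℤ.+-identityʳ d) (ℤ.+-monoʳ-≤ d (ℤ.neg-mono-≤ (ℤ.i≤j⇒0≤j-i 1≤r))))
        ring : ∀ e r d u g h w → d * ((1ℤ + e) * u + g) ≡ (d - r) * u + (1ℤ * ((r + e * d) * u + (d * g + 0ℤ * h)) + 0ℤ * w)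
        ring = solve-∀
        vec : ∀ u g h w → d *ᵥ ((1ℤ + e) *ᵥ u +ᵥ g) ≡ lin₃ (d - + r , 1ℤ , 0ℤ) u (lin₃ (x , d , 0ℤ) u g h) w
        vec u@(p , p′ , p″) g@(s , s′ , s″) h@(t , t′ , t″) w@(v , v′ , v″) =
          trans (×³-≡ (ring e (+ r) d p s t v) (ring e (+ r) d p′ s′ t′ v′) (ring e (+ r) d p″ s″ t″ v″))
            (cong (λ y → lin₃ (d - + r , 1ℤ , 0ℤ) u (lin₃ (y , d , 0ℤ) u g h) w) (sym division))
        conclude : _ → ⊥
        conclude (inj₁ e) = 1≢0 (cong π₂ e)
        conclude (inj₂ (inj₁ e)) = 1≢0 (cong π₂ e)
        conclude (inj₂ (inj₂ (inj₁ e))) = ℤ.<-irrefl (sym (ℤ.i-j≡0⇒i≡j d (+ r) (cong π₁ e))) r<d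
        conclude (inj₂ (inj₂ (inj₂ e))) = 1≢0 (cong π₂ e)

normal-form : ∀ {u₁ u₂ u₃} → EmptySimplex u₁ u₂ u₃ → Indep u₁ u₂ u₃ → Normal u₁ u₂ u₃
normal-form {u₁} {u₂} {u₃} empty ind = from (hermite-form u₁ u₂ u₃)
  where
    from : Hermite u₁ u₂ u₃ → Normal u₁ u₂ u₃
    from (hermite {F} {d₁} {x} {d₂} 0≤d₁ 0≤d₂ u₁≡ u₂≡ _) = orient (ℤ.<-cmp 0ℤ d)
      where
        open Frame F using (f₁; f₂; f₃)
        unit : ∀ u → 1ℤ *ᵥ u ≡ u
        unit (a , b , c) = ×³-≡ (ℤ.*-identityˡ a) (ℤ.*-identityˡ b) (ℤ.*-identityˡ c)
        u₁≡f₁ : u₁ ≡ f₁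
        u₁≡f₁ = trans u₁≡ (trans (cong (_*ᵥ f₁) (first-primitive {f = f₁} empty ind 0≤d₁ u₁≡)) (unit f₁))
        u₂≡′ : u₂ ≡ lin₃ (x , d₂ , 0ℤ) u₁ f₂ f₃
        u₂≡′ = trans u₂≡ (cong (λ t → lin₃ (x , d₂ , 0ℤ) t f₂ f₃) (sym u₁≡f₁))
        d₂≡1 : d₂ ≡ 1ℤ
        d₂≡1 = second-primitive {g = f₂} {f₃} {x} {d₂} empty ind 0≤d₂ u₂≡′
        one : ∀ x → 1ℤ * 1ℤ + (- x) * 0ℤ ≡ 1ℤ
        one = solve-∀
        -- The shear that replaces f₂ by x f₁ + f₂ = u₂. The cyclic shifts bring f₁ and f₂ to the
        -- last two places, where `rotate` acts, and back.
        G : Frame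
        G = cycle (rotate (cycle (cycle F)) 1ℤ (- x) 1ℤ 0ℤ (one x))
        g₁≡ : ∀ u v → u ≡ 1ℤ *ᵥ u +ᵥ 0ℤ *ᵥ v
        g₁≡ (a , b , c) (d , e , f) = ×³-≡ (ring a d) (ring b e) (ring c f)
          where
            ring : ∀ a d → a ≡ 1ℤ * a + 0ℤ * d
            ring = solve-∀
        g₂≡ : ∀ u v w → lin₃ (x , 1ℤ , 0ℤ) u v w ≡ (- (- x)) *ᵥ u +ᵥ 1ℤ *ᵥ v
        g₂≡ (a , b , c) (d , e , f) (g , h , i) = ×³-≡ (ring x a d g) (ring x b e h) (ring x c f i)
          where
            ring : ∀ x a d g → x * a + (1ℤ * d + 0ℤ * g) ≡ (- (- x)) * a + 1ℤ * d
            ring = solve-∀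
        u₁≡g₁ : u₁ ≡ Frame.f₁ G
        u₁≡g₁ = trans u₁≡f₁ (g₁≡ f₁ f₂)
        u₂≡g₂ : u₂ ≡ Frame.f₂ G
        u₂≡g₂ = trans u₂≡ (trans (cong (λ t → lin₃ (x , t , 0ℤ) f₁ f₂ f₃) d₂≡1) (g₂≡ f₁ f₂ f₃))
        a = ⟨ Frame.r₁ G , u₃ ⟩
        b = ⟨ Frame.r₂ G , u₃ ⟩
        d = ⟨ Frame.r₃ G , u₃ ⟩
        u₃≡ : u₃ ≡ lin₃ (a , b , d) (Frame.f₁ G) (Frame.f₂ G) (Frame.f₃ G)
        u₃≡ = sym (Frame.point-coords G u₃)
        flat : ∀ a b u v w → lin₃ (- a , - b , 1ℤ) u v (lin₃ (a , b , 0ℤ) u v w) ≡ e₀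
        flat a b (u , u′ , u″) (v , v′ , v″) (w , w′ , w″) = ×³-≡ (ring a b u v w) (ring a b u′ v′ w′) (ring a b u″ v″ w″)
          where
            ring : ∀ a b u v w → - a * u + (- b * v + 1ℤ * (a * u + (b * v + 0ℤ * w))) ≡ 0ℤ
            ring = solve-∀
        neg : ∀ a b c u v w → lin₃ (a , b , c) u v w ≡ lin₃ (a , b , - c) u v (-1ℤ *ᵥ w)
        neg a b c (u , u′ , u″) (v , v′ , v″) (w , w′ , w″) = ×³-≡ (ring a b c u v w) (ring a b c u′ v′ w′) (ring a b c u″ v″ w″)
          where
            ring : ∀ a b c u v w → a * u + (b * v + c * w) ≡ a * u + (b * v + - c * (-1ℤ * w))
            ring = solve-∀
        orient : _ → Normal u₁ u₂ u₃
        orient (tri< 0<d _ _) = normal {F = G} {a} {b} {d} 0<d u₁≡g₁ u₂≡g₂ u₃≡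
        orient (tri≈ _ 0≡d _) = ⊥-elim (indep-zero (- a) (- b) 1ℤ ind
          (trans (cong (lin₃ (- a , - b , 1ℤ) u₁ u₂) (trans u₃≡ (trans (cong (λ t → lin₃ (a , b , t) (Frame.f₁ G) (Frame.f₂ G) (Frame.f₃ G)) (sym 0≡d))
              (cong₂ (λ s t → lin₃ (a , b , 0ℤ) s t (Frame.f₃ G)) (sym u₁≡g₁) (sym u₂≡g₂)))))
            (flat a b u₁ u₂ (Frame.f₃ G))) (inj₂ (inj₂ 1≢0)))
        orient (tri> _ _ d<0) = normal {F = flip G} {a} {b} { - d} (ℤ.neg-mono-< d<0) u₁≡g₁ u₂≡g₂
          (trans u₃≡ (neg a b d (Frame.f₁ G) (Frame.f₂ G) (Frame.f₃ G)))

-- Emptiness as a condition on residues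

≤-by : ∀ {x y e} → 0ℤ ≤ e → y - x ≡ e → x ≤ y
≤-by 0≤e eq = ℤ.0≤i-j⇒j≤i (subst (0ℤ ≤_) (sym eq) 0≤e)

0≤+ : ∀ n → 0ℤ ≤ + n
0≤+ n = ℤ.+≤+ ℕ.z≤n

0≤i+j : ∀ {i j} → 0ℤ ≤ i → 0ℤ ≤ j → 0ℤ ≤ i + j
0≤i+j = ℤ.+-mono-≤

0≤i*j : ∀ {i j} → 0ℤ ≤ i → 0ℤ ≤ j → 0ℤ ≤ i * j
0≤i*j {+ m} {+ n} _ _ = subst (0ℤ ≤_) (ℤ.pos-* m n) (0≤+ (m ℕ.* n))

residue-eq : ∀ q .{{_ : ℕ.NonZero q}} k α → let a = α ℤ.%ℕ q in
  ∃ λ t → + k * α ≡ + (k ℕ.* a ℕ.% q) + + q * t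
residue-eq q k α = + k * A + + B , (begin
  + k * α                                  ≡⟨ cong (+ k *_) (ℤ.a≡a%ℕn+[a/ℕn]*n α q) ⟩
  + k * (+ a + A * + q)                    ≡⟨ ring₁ (+ k) (+ a) A (+ q) ⟩
  + k * + a + + q * (+ k * A)              ≡⟨ cong (_+ + q * (+ k * A)) (trans (sym (ℤ.pos-* k a)) (cong +_ (ℕ.m≡m%n+[m/n]*n (k ℕ.* a) q))) ⟩
  + (r ℕ.+ B ℕ.* q) + + q * (+ k * A)      ≡⟨ cong (λ x → + r + x + + q * (+ k * A)) (ℤ.pos-* B q) ⟩
  + r + + B * + q + + q * (+ k * A)        ≡⟨ ring₂ (+ r) (+ B) (+ q) (+ k * A) ⟩
  + r + + q * (+ k * A + + B)              ∎)
  where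
    open ≡-Reasoning
    a = α ℤ.%ℕ q
    A = α ℤ./ℕ q
    r = k ℕ.* a ℕ.% q
    B = k ℕ.* a ℕ./ q
    ring₁ : ∀ k a A q → k * (a + A * q) ≡ k * a + q * (k * A)
    ring₁ = solve-∀
    ring₂ : ∀ r B q x → r + B * q + q * x ≡ r + q * (x + B)
    ring₂ = solve-∀

module _ {u₁ u₂ u₃ : ℤ³} {q′ : ℕ} {a b : ℤ} {f₁ f₂ f₃ : ℤ³} (empty : EmptySimplex u₁ u₂ u₃)
  (u₁≡ : u₁ ≡ f₁) (u₂≡ : u₂ ≡ f₂) (u₃≡ : u₃ ≡ lin₃ (a , b , + suc q′) f₁ f₂ f₃) where
  private
    q = suc q′
    Q = + q

  -- The three hypotheses on signs are those for the barycentric numerators, over the denominator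
  -- `Q`, of the lattice point s f₁ + t f₂ + k f₃. Its numerator `k` at the last vertex lies
  -- strictly between 0 and `Q`, so the point is no vertex.
  no-interior-point : ∀ s t k → 0ℤ < k → k < Q → 0ℤ ≤ Q * s - a * k → 0ℤ ≤ Q * t - b * k →
    (Q * s - a * k) + ((Q * t - b * k) + k) ≤ Q → ⊥
  no-interior-point s t k 0<k k<q 0≤w₁ 0≤w₂ Σ≤ =
    contra (empty Q (Q * s - a * k) (Q * t - b * k) k (lin₃ (s , t , k) f₁ f₂ f₃) (ℤ.+<+ (ℕ.s≤s ℕ.z≤n)) 0≤w₁ 0≤w₂ (ℤ.<⇒≤ 0<k) Σ≤
      (trans (vec f₁ f₂ f₃) (trans (cong₂ (λ u v → lin₃ (Q * s - a * k , Q * t - b * k , k) u v (lin₃ (a , b , Q) f₁ f₂ f₃)) (sym u₁≡) (sym u₂≡))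
        (cong (lin₃ (Q * s - a * k , Q * t - b * k , k) u₁ u₂) (sym u₃≡)))))
    where
      ring : ∀ q s t k a b u v w → q * (s * u + (t * v + k * w)) ≡
        (q * s - a * k) * u + ((q * t - b * k) * v + k * (a * u + (b * v + q * w)))
      ring = solve-∀
      vec : ∀ u v w → Q *ᵥ lin₃ (s , t , k) u v w ≡ lin₃ (Q * s - a * k , Q * t - b * k , k) u v (lin₃ (a , b , Q) u v w)
      vec (u , u′ , u″) (v , v′ , v″) (w , w′ , w″) =
        ×³-≡ (ring Q s t k a b u v w) (ring Q s t k a b u′ v′ w′) (ring Q s t k a b u″ v″ w″)
      k≢0 : k ≢ 0ℤ
      k≢0 e = ℤ.<-irrefl (sym e) 0<k
      contra : _ → ⊥
      contra (inj₁ e) = k≢0 (cong π₃ e)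
      contra (inj₂ (inj₁ e)) = k≢0 (cong π₃ e)
      contra (inj₂ (inj₂ (inj₁ e))) = k≢0 (cong π₃ e)
      contra (inj₂ (inj₂ (inj₂ e))) = ℤ.<-irrefl (cong π₃ e) k<q

  module _ (k : ℕ) (0<k : 0 ℕ.< k) (k<q : k ℕ.< q) where
    private
      K = + k
      -- The weight of the base vertex: modulo integers, -f₃ has the barycentric coordinates (c, a,
      -- b, -1) / q.
      c = 1ℤ - a - b
      R₀ = k ℕ.* (c ℤ.%ℕ q) ℕ.% q
      R₁ = k ℕ.* (a ℤ.%ℕ q) ℕ.% q
      R₂ = k ℕ.* (b ℤ.%ℕ q) ℕ.% q
      t₀ = proj₁ (residue-eq q k c)
      t₁ = proj₁ (residue-eq q k a)
      t₂ = proj₁ (residue-eq q k b)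
      eq₀ : K * c ≡ + R₀ + Q * t₀
      eq₀ = proj₂ (residue-eq q k c)
      eq₁ : K * a ≡ + R₁ + Q * t₁
      eq₁ = proj₂ (residue-eq q k a)
      eq₂ : K * b ≡ + R₂ + Q * t₂
      eq₂ = proj₂ (residue-eq q k b)
      m = - (t₀ + (t₁ + t₂))
      total : + R₀ + (+ R₁ + + R₂) ≡ K + Q * m
      total = trans (ring₁ (+ R₀) (+ R₁) (+ R₂) Q t₀ t₁ t₂)
        (trans (cong (_+ Q * m) (trans (cong₂ _+_ (sym eq₀) (cong₂ _+_ (sym eq₁) (sym eq₂))) (ring₂ K a b))) refl)
        where
          ring₁ : ∀ r₀ r₁ r₂ q t₀ t₁ t₂ → r₀ + (r₁ + r₂) ≡
            ((r₀ + q * t₀) + ((r₁ + q * t₁) + (r₂ + q * t₂))) + q * (- (t₀ + (t₁ + t₂)))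
          ring₁ = solve-∀
          ring₂ : ∀ k a b → k * (1ℤ - a - b) + (k * a + k * b) ≡ k
          ring₂ = solve-∀
      0<K : 0ℤ < K
      0<K = ℤ.+<+ 0<k
      K<Q : K < Q
      K<Q = ℤ.+<+ k<q
      R₀<q : + R₀ ≤ Q
      R₀<q = ℤ.+≤+ (ℕ.<⇒≤ (ℕ.m%n<n (k ℕ.* (c ℤ.%ℕ q)) q))
      R₁<q : + R₁ ≤ Q
      R₁<q = ℤ.+≤+ (ℕ.<⇒≤ (ℕ.m%n<n (k ℕ.* (a ℤ.%ℕ q)) q))
      R₂<q : + R₂ ≤ Q
      R₂<q = ℤ.+≤+ (ℕ.<⇒≤ (ℕ.m%n<n (k ℕ.* (b ℤ.%ℕ q)) q))

      upper : ∀ {R α t} → K * α ≡ + R + Q * t → Q * (α - t) - α * (Q - K) ≡ + R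
      upper {R} {α} {t} e = trans (ring Q α t K) (trans (cong (_- Q * t) e) (ring′ (+ R) (Q * t)))
        where
          ring : ∀ q α t k → q * (α - t) - α * (q - k) ≡ k * α - q * t
          ring = solve-∀
          ring′ : ∀ r x → r + x - x ≡ r
          ring′ = solve-∀
      lower : ∀ {R α t} → K * α ≡ + R + Q * t → Q * (1ℤ + t) - α * K ≡ Q - + R
      lower {R} {α} {t} e = trans (ring Q α t K) (trans (cong (λ x → Q * (1ℤ + t) - x) e) (ring′ (+ R) Q t))
        where
          ring : ∀ q α t k → q * (1ℤ + t) - α * k ≡ q * (1ℤ + t) - k * α
          ring = solve-∀
          ring′ : ∀ r q t → q * (1ℤ + t) - (r + q * t) ≡ q - r
          ring′ = solve-∀
      zero-weight : ∀ {R α t} → R ≡ 0 → K * α ≡ + R + Q * t → Q * t - α * K ≡ 0ℤ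
      zero-weight {R} {α} {t} refl e = trans (cong (λ x → Q * t - x) (trans (ℤ.*-comm α K) e)) (ring Q t)
        where
          ring : ∀ q t → q * t - (0ℤ + q * t) ≡ 0ℤ
          ring = solve-∀

      -- The four barycentric residues of -k f₃ would add up to q.
      sum-q : 0ℤ ≤ - m → ⊥
      sum-q 0≤-m = no-interior-point (a - t₁) (b - t₂) (Q - K) (subst (_< Q - K) (ℤ.+-inverseʳ K) (ℤ.+-monoˡ-< (- K) K<Q))
        (subst (Q - K <_) (ℤ.+-identityʳ Q) (ℤ.+-monoʳ-< Q (ℤ.neg-mono-< 0<K)))
        (subst (0ℤ ≤_) (sym (upper {R₁} {a} {t₁} eq₁)) (0≤+ R₁)) (subst (0ℤ ≤_) (sym (upper {R₂} {b} {t₂} eq₂)) (0≤+ R₂))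
        (≤-by (0≤i+j (0≤+ R₀) (0≤i*j (0≤+ q) 0≤-m))
          (trans (cong₂ (λ x y → Q - (x + (y + (Q - K)))) (upper {R₁} {a} {t₁} eq₁) (upper {R₂} {b} {t₂} eq₂))
            (trans (ring Q (+ R₀) (+ R₁) (+ R₂) K) (trans (cong (λ x → + R₀ + (K - x)) total) (ring′ (+ R₀) K Q m)))))
        where
          ring : ∀ q r₀ r₁ r₂ k → q - (r₁ + (r₂ + (q - k))) ≡ r₀ + (k - (r₀ + (r₁ + r₂)))
          ring = solve-∀
          ring′ : ∀ r₀ k q m → r₀ + (k - (k + q * m)) ≡ r₀ + q * (- m)
          ring′ = solve-∀

      -- The complementary numerators q - R₁ and q - R₂, with k at the last vertex, leave (m - 1) q
      -- - R₀ for the base vertex. For m = 1 and R₀ = 0 this is 0, which also yields `residue₀-pos`.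
      sum-3q : 0ℤ ≤ (m - 1ℤ) * Q - + R₀ → ⊥
      sum-3q 0≤ = no-interior-point (1ℤ + t₁) (1ℤ + t₂) K 0<K K<Q
        (subst (0ℤ ≤_) (sym (lower {R₁} {a} {t₁} eq₁)) (ℤ.i≤j⇒0≤j-i R₁<q)) (subst (0ℤ ≤_) (sym (lower {R₂} {b} {t₂} eq₂)) (ℤ.i≤j⇒0≤j-i R₂<q))
        (≤-by 0≤
          (trans (cong₂ (λ x y → Q - (x + (y + K))) (lower {R₁} {a} {t₁} eq₁) (lower {R₂} {b} {t₂} eq₂))
            (trans (ring Q (+ R₀) (+ R₁) (+ R₂) K) (trans (cong (λ x → x - + R₀ - K - Q) total) (ring′ (+ R₀) K Q m)))))
        where
          ring : ∀ q r₀ r₁ r₂ k → q - ((q - r₁) + ((q - r₂) + k)) ≡ (r₀ + (r₁ + r₂)) - r₀ - k - q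
          ring = solve-∀
          ring′ : ∀ r₀ k q m → (k + q * m) - r₀ - k - q ≡ (m - 1ℤ) * q - r₀
          ring′ = solve-∀

    -- A value m ≤ 0 gives a lattice point at height q - k, and m ≥ 2 gives one at height k.
    multiplier : m ≡ 1ℤ
    multiplier = by-cases m refl
      where
        by-cases : ∀ n → m ≡ n → m ≡ 1ℤ
        by-cases (+ 0) e = ⊥-elim (sum-q (subst (λ x → 0ℤ ≤ - x) (sym e) ℤ.≤-refl))
        by-cases (+ 1) e = e
        by-cases (+ suc (suc n)) e = ⊥-elim (sum-3q (subst (λ x → 0ℤ ≤ (x - 1ℤ) * Q - + R₀) (sym e)
          (ℤ.i≤j⇒0≤j-i (ℤ.≤-trans R₀<q (subst (Q ≤_) (ℤ.pos-* (suc n) q) (ℤ.+≤+ (ℕ.m≤m+n q (n ℕ.* q))))))))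
        by-cases -[1+ n ] e = ⊥-elim (sum-q (subst (λ x → 0ℤ ≤ - x) (sym e) (0≤+ (suc n))))

    residues-sum : R₀ ℕ.+ (R₁ ℕ.+ R₂) ≡ q ℕ.+ k
    residues-sum = ℤ.+-injective (trans total (trans (cong (λ x → K + Q * x) multiplier) (ring K Q)))
      where
        ring : ∀ k q → k + q * 1ℤ ≡ q + k
        ring = solve-∀

    private
      Σ≡ : + R₀ + (+ R₁ + + R₂) ≡ Q + K
      Σ≡ = cong +_ residues-sum

    residue₀-pos : 0 ℕ.< R₀
    residue₀-pos = ℕ.n≢0⇒n>0 λ R₀≡0 → sum-3q (subst (λ x → 0ℤ ≤ (x - 1ℤ) * Q - + R₀) (sym multiplier)
      (subst (λ x → 0ℤ ≤ (1ℤ - 1ℤ) * Q - + x) (sym R₀≡0) ℤ.≤-refl))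

    -- A vanishing residue would put a lattice point into the facet opposite to the endpoint of
    -- `u₁`, with numerators q - R₀, 0, q - R₂ and k.
    residue₁-pos : 0 ℕ.< R₁
    residue₁-pos = ℕ.n≢0⇒n>0 λ R₁≡0 → no-interior-point t₁ (1ℤ + t₂) K 0<K K<Q
      (subst (0ℤ ≤_) (sym (zero-weight {R₁} {a} {t₁} R₁≡0 eq₁)) ℤ.≤-refl)
      (subst (0ℤ ≤_) (sym (lower {R₂} {b} {t₂} eq₂)) (ℤ.i≤j⇒0≤j-i R₂<q))
      (≤-by (ℤ.i≤j⇒0≤j-i R₀<q) (trans (cong₂ (λ x y → Q - (x + (y + K))) (zero-weight {R₁} {a} {t₁} R₁≡0 eq₁) (lower {R₂} {b} {t₂} eq₂))
        (trans (ring Q (+ R₀) (+ R₂) K) (trans (cong (λ x → Q - + R₀ + (x - (Q + K))) (trans (cong (λ n → + R₀ + (+ n + + R₂)) (sym R₁≡0)) Σ≡)) (ring′ (Q - + R₀) (Q + K))))))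
      where
        ring : ∀ q r₀ r₂ k → q - (0ℤ + ((q - r₂) + k)) ≡ q - r₀ + ((r₀ + (0ℤ + r₂)) - (q + k))
        ring = solve-∀
        ring′ : ∀ x y → x + (y - y) ≡ x
        ring′ = solve-∀

    residue₂-pos : 0 ℕ.< R₂
    residue₂-pos = ℕ.n≢0⇒n>0 λ R₂≡0 → no-interior-point (1ℤ + t₁) t₂ K 0<K K<Q
      (subst (0ℤ ≤_) (sym (lower {R₁} {a} {t₁} eq₁)) (ℤ.i≤j⇒0≤j-i R₁<q))
      (subst (0ℤ ≤_) (sym (zero-weight {R₂} {b} {t₂} R₂≡0 eq₂)) ℤ.≤-refl)
      (≤-by (ℤ.i≤j⇒0≤j-i R₀<q) (trans (cong₂ (λ x y → Q - (x + (y + K))) (lower {R₁} {a} {t₁} eq₁) (zero-weight {R₂} {b} {t₂} R₂≡0 eq₂))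
        (trans (ring Q (+ R₀) (+ R₁) K) (trans (cong (λ x → Q - + R₀ + (x - (Q + K))) (trans (cong (λ n → + R₀ + (+ R₁ + + n)) (sym R₂≡0)) Σ≡)) (ring′ (Q - + R₀) (Q + K))))))
      where
        ring : ∀ q r₀ r₁ k → q - ((q - r₁) + (0ℤ + k)) ≡ q - r₀ + ((r₀ + (r₁ + 0ℤ)) - (q + k))
        ring = solve-∀
        ring′ : ∀ x y → x + (y - y) ≡ x
        ring′ = solve-∀

  -- The weights describe the class of -f₃ modulo the lattice spanned by the edge vectors; in this
  -- form White's theorem applies.
  empty-terminal : Terminal q ((1ℤ - a - b) ℤ.%ℕ q) (a ℤ.%ℕ q) (b ℤ.%ℕ q)
  empty-terminal = terminal residues-sum residue₀-pos residue₁-pos residue₂-pos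

-- Equivalence with S₁ and S₂ in volumes 1 and 2

linearℤ : Mat3 → ℤ³ → ℤ³
linearℤ (r , s , t) v = ⟨ r , v ⟩ , ⟨ s , v ⟩ , ⟨ t , v ⟩

linearℚ : Mat3 → ℚ³ → ℚ³
linearℚ (r , s , t) x = dotℚ r x , dotℚ s x , dotℚ t x

dotℚ-ι : ∀ r v → dotℚ r (ι v) ≡ ⟨ r , v ⟩ / 1
dotℚ-ι (a , b , c) (d , e , f) = sym (trans (/1-+ (a * d) (b * e + c * f)) (trans
  (cong₂ ℚ._+_ (/1-* a d) (trans (/1-+ (b * e) (c * f)) (cong₂ ℚ._+_ (/1-* b e) (/1-* c f))))
  (sym (ℚ.+-assoc ((a / 1) ℚ.* (d / 1)) ((b / 1) ℚ.* (e / 1)) ((c / 1) ℚ.* (f / 1))))))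

dotℚ-lin : ∀ r t x y → dotℚ r ((t ·³ x) +³ y) ≡ t ℚ.* dotℚ r x ℚ.+ dotℚ r y
dotℚ-lin (a , b , c) t (d , e , f) (g , h , i) = ring (a / 1) (b / 1) (c / 1) t d e f g h i
  where
    ring : ∀ a b c t d e f g h i → a ℚ.* (t ℚ.* d ℚ.+ g) ℚ.+ b ℚ.* (t ℚ.* e ℚ.+ h) ℚ.+ c ℚ.* (t ℚ.* f ℚ.+ i)
      ≡ t ℚ.* (a ℚ.* d ℚ.+ b ℚ.* e ℚ.+ c ℚ.* f) ℚ.+ (a ℚ.* g ℚ.+ b ℚ.* h ℚ.+ c ℚ.* i)
    ring = RingSolver.solve-∀ ℚ-ring

dotℚ-zero : ∀ r → dotℚ r 0³ ≡ 0ℚ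
dotℚ-zero (a , b , c) = ring (a / 1) (b / 1) (c / 1)
  where
    ring : ∀ a b c → a ℚ.* 0ℚ ℚ.+ b ℚ.* 0ℚ ℚ.+ c ℚ.* 0ℚ ≡ 0ℚ
    ring = RingSolver.solve-∀ ℚ-ring

combo-affine : ∀ {n} U d (w : Vec ℚ n) vs →
  combo w (map (λ v → linearℤ U v +ᵥ d) vs) ≡ linearℚ U (combo w vs) +³ (sumℚ w ·³ ι d)
combo-affine (r , s , t) d@(d₁ , d₂ , d₃) [] [] = sym (×³-≡ (origin r d₁) (origin s d₂) (origin t d₃))
  where
    origin : ∀ r d → dotℚ r 0³ ℚ.+ 0ℚ ℚ.* (d / 1) ≡ 0ℚ
    origin r d = trans (cong₂ ℚ._+_ (dotℚ-zero r) (ℚ.*-zeroˡ (d / 1))) (ℚ.+-identityʳ 0ℚ)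
combo-affine U@(r , s , t) d@(d₁ , d₂ , d₃) (w ∷ ws) (v ∷ vs) =
  trans (cong ((w ·³ ι (linearℤ U v +ᵥ d)) +³_) (combo-affine U d ws vs)) (×³-≡ (row r d₁) (row s d₂) (row t d₃))
  where
    x = combo ws vs
    σ = sumℚ ws
    ring : ∀ w d σ p q → w ℚ.* (p ℚ.+ d) ℚ.+ (q ℚ.+ σ ℚ.* d) ≡ (w ℚ.* p ℚ.+ q) ℚ.+ (w ℚ.+ σ) ℚ.* d
    ring = RingSolver.solve-∀ ℚ-ring
    row : ∀ r d → w ℚ.* ((⟨ r , v ⟩ + d) / 1) ℚ.+ (dotℚ r x ℚ.+ σ ℚ.* (d / 1)) ≡
      dotℚ r ((w ·³ ι v) +³ x) ℚ.+ (w ℚ.+ σ) ℚ.* (d / 1)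
    row r d = trans (cong (λ p → w ℚ.* p ℚ.+ (dotℚ r x ℚ.+ σ ℚ.* (d / 1)))
        (trans (/1-+ ⟨ r , v ⟩ d) (cong (ℚ._+ (d / 1)) (sym (dotℚ-ι r v)))))
      (trans (ring w (d / 1) σ (dotℚ r (ι v)) (dotℚ r x))
        (cong (ℚ._+ (w ℚ.+ σ) ℚ.* (d / 1)) (sym (dotℚ-lin r w (ι v) x))))

-- An affine map commutes with combinations of total weight 1, so the same weights serve in both
-- directions.
vertices⇒equivalent : ∀ {n} U d {vs ws : Vec ℤ³ n} → InGL3Z U → map (λ v → linearℤ U v +ᵥ d) vs ≡ ws →
  Equivalent (conv vs) (conv ws)
vertices⇒equivalent U@(_ , _ , _) d {vs} gl refl = U , gl , d , λ y → mk⇔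
  (λ { (_ , (w , w≥0 , Σw , refl) , refl) → w , w≥0 , Σw , sym (image w Σw) })
  (λ { (w , w≥0 , Σw , refl) → combo w vs , (w , w≥0 , Σw , refl) , image w Σw })
  where
    unit : ∀ x → 1ℚ ·³ x ≡ x
    unit (a , b , c) = ×³-≡ (ℚ.*-identityˡ a) (ℚ.*-identityˡ b) (ℚ.*-identityˡ c)
    image : ∀ w → sumℚ w ≡ 1ℚ → combo w (map (λ v → linearℤ U v +ᵥ d) vs) ≡ affine U d (combo w vs)
    image w Σw = trans (combo-affine U d w vs) (cong (linearℚ U (combo w vs) +³_)
      (trans (cong (_·³ ι d) Σw) (unit (ι d))))

⟨⟩-lin₃ : ∀ c r s t v → ⟨ lin₃ c r s t , v ⟩ ≡ ⟨ c , (⟨ r , v ⟩ , ⟨ s , v ⟩ , ⟨ t , v ⟩) ⟩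
⟨⟩-lin₃ (x , y , z) r@(_ , _ , _) s@(_ , _ , _) t@(_ , _ , _) v = trans (unfold x r (y *ᵥ s +ᵥ z *ᵥ t) v) (cong (λ w → x * ⟨ r , v ⟩ + w) (⟨⟩-comb y z s t v))
  where
    unfold : ∀ x u w v → ⟨ x *ᵥ u +ᵥ w , v ⟩ ≡ x * ⟨ u , v ⟩ + ⟨ w , v ⟩
    unfold x (a , b , c) (d , e , f) (g , h , i) = ring x a b c d e f g h i
      where
        ring : ∀ x a b c d e f g h i → (x * a + d) * g + ((x * b + e) * h + (x * c + f) * i)
          ≡ x * (a * g + (b * h + c * i)) + (d * g + (e * h + f * i))
        ring = solve-∀

-- The factor is the determinant of the coefficient rows (x, y, z), (1, 0, c), (0, 1, d). The maps
-- for both volumes have this shape, up to a cyclic shift of the rows.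
det3-rows : ∀ x y z c d r s t →
  det3 (lin₃ (x , y , z) r s t) (r +ᵥ c *ᵥ t) (s +ᵥ d *ᵥ t) ≡ (z - x * c - y * d) * det3 r s t
det3-rows x y z c d (r , r′ , r″) (s , s′ , s″) (t , t′ , t″) = ring x y z c d r r′ r″ s s′ s″ t t′ t″
  where
    ring : ∀ x y z c d r r′ r″ s s′ s″ t t′ t″ →
      (x * r + (y * s + z * t)) * ((r′ + c * t′) * (s″ + d * t″) - (r″ + c * t″) * (s′ + d * t′))
      - (x * r′ + (y * s′ + z * t′)) * ((r + c * t) * (s″ + d * t″) - (r″ + c * t″) * (s + d * t))
      + (x * r″ + (y * s″ + z * t″)) * ((r + c * t) * (s′ + d * t′) - (r′ + c * t′) * (s + d * t))
      ≡ (z - x * c - y * d) * (r * (s′ * t″ - s″ * t′) - r′ * (s * t″ - s″ * t) + r″ * (s * t′ - s′ * t))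
    ring = solve-∀

lin₃-row₁ : ∀ c r s t → lin₃ (1ℤ , 0ℤ , c) r s t ≡ r +ᵥ c *ᵥ t
lin₃-row₁ c (r , r′ , r″) (s , s′ , s″) (t , t′ , t″) = ×³-≡ (ring c r s t) (ring c r′ s′ t′) (ring c r″ s″ t″)
  where
    ring : ∀ c r s t → 1ℤ * r + (0ℤ * s + c * t) ≡ r + c * t
    ring = solve-∀

lin₃-row₂ : ∀ c r s t → lin₃ (0ℤ , 1ℤ , c) r s t ≡ s +ᵥ c *ᵥ t
lin₃-row₂ c (r , r′ , r″) (s , s′ , s″) (t , t′ , t″) = ×³-≡ (ring c r s t) (ring c r′ s′ t′) (ring c r″ s″ t″)
  where
    ring : ∀ c r s t → 0ℤ * r + (1ℤ * s + c * t) ≡ s + c * t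
    ring = solve-∀

det3-lin₃ : ∀ x y z c d r s t → z - x * c - y * d ≡ 1ℤ →
  det3 (lin₃ (x , y , z) r s t) (lin₃ (1ℤ , 0ℤ , c) r s t) (lin₃ (0ℤ , 1ℤ , d) r s t) ≡ det3 r s t
det3-lin₃ x y z c d r s t one = trans (cong₂ (det3 (lin₃ (x , y , z) r s t)) (lin₃-row₁ c r s t) (lin₃-row₂ d r s t))
  (trans (det3-rows x y z c d r s t) (trans (cong (_* det3 r s t) one) (ℤ.*-identityˡ (det3 r s t))))

linearℤ-diff : ∀ U v w t → linearℤ U v +ᵥ (t -ℤ³ linearℤ U w) ≡ linearℤ U (v -ℤ³ w) +ᵥ t
linearℤ-diff (r , r′ , r″) v w (t , t′ , t″) = ×³-≡ (move r v w t) (move r′ v w t′) (move r″ v w t″)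
  where
    move : ∀ r v w x → ⟨ r , v ⟩ + (x - ⟨ r , w ⟩) ≡ ⟨ r , v -ℤ³ w ⟩ + x
    move (a , b , c) (d , e , f) (g , h , i) x = ring a b c d e f g h i x
      where
        ring : ∀ a b c d e f g h i x → (a * d + (b * e + c * f)) + (x - (a * g + (b * h + c * i)))
          ≡ (a * (d - g) + (b * (e - h) + c * (f - i))) + x
        ring = solve-∀

linearℤ-rows : ∀ m n p r s t v → linearℤ (lin₃ m r s t , lin₃ n r s t , lin₃ p r s t) v ≡
  linearℤ (m , n , p) (⟨ r , v ⟩ , ⟨ s , v ⟩ , ⟨ t , v ⟩)
linearℤ-rows m n p r s t v = ×³-≡ (⟨⟩-lin₃ m r s t v) (⟨⟩-lin₃ n r s t v) (⟨⟩-lin₃ p r s t v)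

+ᵥ-base : ∀ u t → u +ᵥ (t -ℤ³ u) ≡ t
+ᵥ-base (a , b , c) (d , e , f) = ×³-≡ (ring a d) (ring b e) (ring c f)
  where
    ring : ∀ a d → a + (d - a) ≡ d
    ring = solve-∀

module _ {v₀ v₁ v₂ v₃ : ℤ³} (N : Normal (v₁ -ℤ³ v₀) (v₂ -ℤ³ v₀) (v₃ -ℤ³ v₀)) where
  open Normal N
  private
    c₁ : coords (v₁ -ℤ³ v₀) ≡ (1ℤ , 0ℤ , 0ℤ)
    c₁ = trans (cong coords (trans u₁≡ (sym (lin₃-unit₁ f₁ f₂ f₃)))) (coords-point (1ℤ , 0ℤ , 0ℤ))
    c₂ : coords (v₂ -ℤ³ v₀) ≡ (0ℤ , 1ℤ , 0ℤ)
    c₂ = trans (cong coords (trans u₂≡ (trans (sym (lin₃-unit₁ f₂ f₃ f₁)) (lin₃-cycle 0ℤ 1ℤ 0ℤ f₁ f₂ f₃)))) (coords-point (0ℤ , 1ℤ , 0ℤ))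
    c₃ : coords (v₃ -ℤ³ v₀) ≡ (a , b , q)
    c₃ = trans (cong coords u₃≡) (coords-point (a , b , q))

  -- Rows of the transformation are given in terms of the dual basis.
  rows⇒equivalent : ∀ m n p t → let U = lin₃ m r₁ r₂ r₃ , lin₃ n r₁ r₂ r₃ , lin₃ p r₁ r₂ r₃ in InGL3Z U →
    Equivalent (conv (v₀ ∷ v₁ ∷ v₂ ∷ v₃ ∷ []))
      (conv (t ∷ linearℤ (m , n , p) (1ℤ , 0ℤ , 0ℤ) +ᵥ t ∷ linearℤ (m , n , p) (0ℤ , 1ℤ , 0ℤ) +ᵥ t ∷ linearℤ (m , n , p) (a , b , q) +ᵥ t ∷ []))
  rows⇒equivalent m n p t gl = vertices⇒equivalent U (t -ℤ³ linearℤ U v₀) gl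
    (cong₂ _∷_ (+ᵥ-base (linearℤ U v₀) t) (cong₂ _∷_ (vertex v₁ c₁) (cong₂ _∷_ (vertex v₂ c₂) (cong₂ _∷_ (vertex v₃ c₃) refl))))
    where
      U : Mat3
      U = lin₃ m r₁ r₂ r₃ , lin₃ n r₁ r₂ r₃ , lin₃ p r₁ r₂ r₃
      vertex : ∀ v {c} → coords (v -ℤ³ v₀) ≡ c → linearℤ U v +ᵥ (t -ℤ³ linearℤ U v₀) ≡ linearℤ (m , n , p) c +ᵥ t
      vertex v eq = trans (linearℤ-diff U v v₀ t) (cong (_+ᵥ t)
        (trans (linearℤ-rows m n p r₁ r₂ r₃ (v -ℤ³ v₀)) (cong (linearℤ (m , n , p)) eq)))

  volume-1 : q ≡ 1ℤ → Equivalent (conv (v₀ ∷ v₁ ∷ v₂ ∷ v₃ ∷ [])) S₁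
  volume-1 q≡1 = subst (λ vs → Equivalent (conv (v₀ ∷ v₁ ∷ v₂ ∷ v₃ ∷ [])) (conv vs))
    (cong₂ _∷_ refl (cong₂ _∷_ image₁ (cong₂ _∷_ image₂ (cong₂ _∷_ image₃ refl))))
    (rows⇒equivalent (1ℤ , 0ℤ , - a) (0ℤ , 1ℤ , - b) (0ℤ , 0ℤ , 1ℤ) e₀
      (subst (λ d → d ≡ 1ℤ ⊎ d ≡ -1ℤ) (sym (det r₁ r₂ r₃)) unimodular))
    where
      one : ∀ a b → 1ℤ - 0ℤ * a - 0ℤ * b ≡ 1ℤ
      one = solve-∀
      det : ∀ r s t → det3 (lin₃ (1ℤ , 0ℤ , - a) r s t) (lin₃ (0ℤ , 1ℤ , - b) r s t) (lin₃ (0ℤ , 0ℤ , 1ℤ) r s t) ≡ det3 r s t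
      det r s t = trans (det3-cycle (lin₃ (0ℤ , 0ℤ , 1ℤ) r s t) (lin₃ (1ℤ , 0ℤ , - a) r s t) (lin₃ (0ℤ , 1ℤ , - b) r s t))
        (det3-lin₃ 0ℤ 0ℤ 1ℤ (- a) (- b) r s t (one (- a) (- b)))
      image₁ : linearℤ ((1ℤ , 0ℤ , - a) , (0ℤ , 1ℤ , - b) , (0ℤ , 0ℤ , 1ℤ)) (1ℤ , 0ℤ , 0ℤ) +ᵥ e₀ ≡ e₁
      image₁ = ×³-≡ (ring a) (ring′ b) refl
        where
          ring : ∀ a → 1ℤ * 1ℤ + (0ℤ * 0ℤ + - a * 0ℤ) + 0ℤ ≡ 1ℤ
          ring = solve-∀
          ring′ : ∀ a → 0ℤ * 1ℤ + (1ℤ * 0ℤ + - a * 0ℤ) + 0ℤ ≡ 0ℤ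
          ring′ = solve-∀
      image₂ : linearℤ ((1ℤ , 0ℤ , - a) , (0ℤ , 1ℤ , - b) , (0ℤ , 0ℤ , 1ℤ)) (0ℤ , 1ℤ , 0ℤ) +ᵥ e₀ ≡ e₂
      image₂ = ×³-≡ (ring a) (ring′ b) refl
        where
          ring : ∀ a → 1ℤ * 0ℤ + (0ℤ * 1ℤ + - a * 0ℤ) + 0ℤ ≡ 0ℤ
          ring = solve-∀
          ring′ : ∀ a → 0ℤ * 0ℤ + (1ℤ * 1ℤ + - a * 0ℤ) + 0ℤ ≡ 1ℤ
          ring′ = solve-∀
      image₃ : linearℤ ((1ℤ , 0ℤ , - a) , (0ℤ , 1ℤ , - b) , (0ℤ , 0ℤ , 1ℤ)) (a , b , q) +ᵥ e₀ ≡ e₃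
      image₃ = trans (cong (λ x → linearℤ ((1ℤ , 0ℤ , - a) , (0ℤ , 1ℤ , - b) , (0ℤ , 0ℤ , 1ℤ)) (a , b , x) +ᵥ e₀) q≡1)
        (×³-≡ (ring a b) (ring′ a b) (ring″ a b))
        where
          ring : ∀ a b → 1ℤ * a + (0ℤ * b + - a * 1ℤ) + 0ℤ ≡ 0ℤ
          ring = solve-∀
          ring′ : ∀ a b → 0ℤ * a + (1ℤ * b + - b * 1ℤ) + 0ℤ ≡ 0ℤ
          ring′ = solve-∀
          ring″ : ∀ a b → 0ℤ * a + (0ℤ * b + 1ℤ * 1ℤ) + 0ℤ ≡ 1ℤ
          ring″ = solve-∀

  -- With a = 1 + 2 A and b = 1 + 2 B the coordinates (a , b , 2) are sheared to (1 , 1 , 2).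
  volume-2 : ∀ A B → a ≡ 1ℤ + A * + 2 → b ≡ 1ℤ + B * + 2 → q ≡ + 2 → Equivalent (conv (v₀ ∷ v₁ ∷ v₂ ∷ v₃ ∷ [])) S₂
  volume-2 A B a≡ b≡ q≡2 = subst (λ vs → Equivalent (conv (v₀ ∷ v₁ ∷ v₂ ∷ v₃ ∷ [])) (conv vs))
    (cong₂ _∷_ refl (cong₂ _∷_ image₁ (cong₂ _∷_ image₂ (cong₂ _∷_ image₃ refl))))
    (rows⇒equivalent m n p e₁ (subst (λ d → d ≡ 1ℤ ⊎ d ≡ -1ℤ) (sym (det r₁ r₂ r₃)) unimodular))
    where
      -- In the sheared coordinates x - A z, y - B z, z the map is (x, y, z) ↦ (1 - x - y + z, x,
      -- y), where the 1 is the translation by `e₁`. It sends 0, e₁, e₂, (1, 1, 2) to e₁, e₂, e₃,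
      -- (1, 1, 1).
      m = -1ℤ , -1ℤ , 1ℤ + (A + B)
      n = 1ℤ , 0ℤ , - A
      p = 0ℤ , 1ℤ , - B
      one : ∀ A B → 1ℤ + (A + B) - -1ℤ * (- A) - -1ℤ * (- B) ≡ 1ℤ
      one = solve-∀
      det : ∀ r s t → det3 (lin₃ m r s t) (lin₃ n r s t) (lin₃ p r s t) ≡ det3 r s t
      det r s t = det3-lin₃ -1ℤ -1ℤ (1ℤ + (A + B)) (- A) (- B) r s t (one A B)
      image₁ : linearℤ (m , n , p) (1ℤ , 0ℤ , 0ℤ) +ᵥ e₁ ≡ e₂
      image₁ = ×³-≡ (ring A B) (ring′ A) (ring″ B)
        where
          ring : ∀ A B → -1ℤ * 1ℤ + (-1ℤ * 0ℤ + (1ℤ + (A + B)) * 0ℤ) + 1ℤ ≡ 0ℤ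
          ring = solve-∀
          ring′ : ∀ A → 1ℤ * 1ℤ + (0ℤ * 0ℤ + - A * 0ℤ) + 0ℤ ≡ 1ℤ
          ring′ = solve-∀
          ring″ : ∀ B → 0ℤ * 1ℤ + (1ℤ * 0ℤ + - B * 0ℤ) + 0ℤ ≡ 0ℤ
          ring″ = solve-∀
      image₂ : linearℤ (m , n , p) (0ℤ , 1ℤ , 0ℤ) +ᵥ e₁ ≡ e₃
      image₂ = ×³-≡ (ring A B) (ring′ A) (ring″ B)
        where
          ring : ∀ A B → -1ℤ * 0ℤ + (-1ℤ * 1ℤ + (1ℤ + (A + B)) * 0ℤ) + 1ℤ ≡ 0ℤ
          ring = solve-∀
          ring′ : ∀ A → 1ℤ * 0ℤ + (0ℤ * 1ℤ + - A * 0ℤ) + 0ℤ ≡ 0ℤ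
          ring′ = solve-∀
          ring″ : ∀ B → 0ℤ * 0ℤ + (1ℤ * 1ℤ + - B * 0ℤ) + 0ℤ ≡ 1ℤ
          ring″ = solve-∀
      image₃ : linearℤ (m , n , p) (a , b , q) +ᵥ e₁ ≡ e₁₂₃
      image₃ = trans (cong₂ (λ x (y , z) → linearℤ (m , n , p) (x , y , z) +ᵥ e₁) a≡ (cong₂ _,_ b≡ q≡2))
        (×³-≡ (ring A B) (ring′ A B) (ring″ A B))
        where
          ring : ∀ A B → -1ℤ * (1ℤ + A * + 2) + (-1ℤ * (1ℤ + B * + 2) + (1ℤ + (A + B)) * + 2) + 1ℤ ≡ 1ℤ
          ring = solve-∀
          ring′ : ∀ A B → 1ℤ * (1ℤ + A * + 2) + (0ℤ * (1ℤ + B * + 2) + - A * + 2) + 0ℤ ≡ 1ℤ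
          ring′ = solve-∀
          ring″ : ∀ A B → 0ℤ * (1ℤ + A * + 2) + (1ℤ * (1ℤ + B * + 2) + - B * + 2) + 0ℤ ≡ 1ℤ
          ring″ = solve-∀

-- Transport of triples along lattice automorphisms

+ᵥ-assoc : ∀ u v w → u +ᵥ v +ᵥ w ≡ u +ᵥ (v +ᵥ w)
+ᵥ-assoc (a , b , c) (d , e , f) (g , h , i) = ×³-≡ (ℤ.+-assoc a d g) (ℤ.+-assoc b e h) (ℤ.+-assoc c f i)

+ᵥ-comm : ∀ u v → u +ᵥ v ≡ v +ᵥ u
+ᵥ-comm (a , b , c) (d , e , f) = ×³-≡ (ℤ.+-comm a d) (ℤ.+-comm b e) (ℤ.+-comm c f)

+ᵥ-identityʳ : ∀ u → u +ᵥ e₀ ≡ u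
+ᵥ-identityʳ (a , b , c) = ×³-≡ (ℤ.+-identityʳ a) (ℤ.+-identityʳ b) (ℤ.+-identityʳ c)

+ᵥ-identityˡ : ∀ u → e₀ +ᵥ u ≡ u
+ᵥ-identityˡ (a , b , c) = ×³-≡ (ℤ.+-identityˡ a) (ℤ.+-identityˡ b) (ℤ.+-identityˡ c)

*ᵥ-distrib : ∀ k u v → k *ᵥ (u +ᵥ v) ≡ k *ᵥ u +ᵥ k *ᵥ v
*ᵥ-distrib k (a , b , c) (d , e , f) = ×³-≡ (ℤ.*-distribˡ-+ k a d) (ℤ.*-distribˡ-+ k b e) (ℤ.*-distribˡ-+ k c f)

record Chart : Set where
  constructor chart
  field
    to from : ℤ³ → ℤ³
    to-from : ∀ v → to (from v) ≡ v
    from-to : ∀ v → from (to v) ≡ v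
    to-+    : ∀ u v → to (u +ᵥ v) ≡ to u +ᵥ to v
    to-*    : ∀ k v → to (k *ᵥ v) ≡ k *ᵥ to v

  to-e₀ : to e₀ ≡ e₀
  to-e₀ = to-* 0ℤ e₀

  to-injective : ∀ {a} → to a ≡ e₀ → a ≡ e₀
  to-injective {a} eq = trans (sym (from-to a)) (trans (cong from (trans eq (sym to-e₀))) (from-to e₀))

module _ (φ : Chart) where
  open Chart φ

  cone-transport : ∀ {S S′ : ℤ³ → Set} {n y} o → (∀ {v} → S′ v → S (o +ᵥ to v)) → Cone S′ n y → Cone S n (n *ᵥ o +ᵥ to y)
  cone-transport {S} o@(_ , _ , _) f nil = subst (Cone S 0ℤ) (sym (trans (+ᵥ-identityˡ (to e₀)) to-e₀)) nil
  cone-transport {S} o f (add {v} {n} {y} s a 0≤a c) =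
    subst (Cone S (a + n)) (trans (regroup o (to v) (to y)) (cong ((a + n) *ᵥ o +ᵥ_) (sym (trans (to-+ (a *ᵥ v) y) (cong (_+ᵥ to y) (to-* a v))))))
      (add (f s) a 0≤a (cone-transport o f c))
    where
      ring : ∀ a n o v y → a * (o + v) + (n * o + y) ≡ (a + n) * o + (a * v + y)
      ring = solve-∀
      regroup : ∀ o v y → a *ᵥ (o +ᵥ v) +ᵥ (n *ᵥ o +ᵥ y) ≡ (a + n) *ᵥ o +ᵥ (a *ᵥ v +ᵥ y)
      regroup (o , o′ , o″) (v , v′ , v″) (y , y′ , y″) = ×³-≡ (ring a n o v y) (ring a n o′ v′ y′) (ring a n o″ v″ y″)

  module _ {S S′ T T′ : ℤ³ → Set} {o o′ : ℤ³} (f : ∀ {v} → S′ v → S (o +ᵥ to v)) (g : ∀ {v} → T′ v → T (o′ +ᵥ to v)) where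

    -- The linear part has to be common to both summands, while their offsets are independent and
    -- add up in the sum. This is why a chart is linear and the translations are kept apart.
    inSum-transport : ∀ {z} → InSum S′ T′ z → InSum S T (o +ᵥ o′ +ᵥ to z)
    inSum-transport {z} (inSum {N} {y₁} {y₂} 0<N c₁ c₂ eq) =
      inSum 0<N (cone-transport o f c₁) (cone-transport o′ g c₂)
        (trans (expand o o′ (to z))
          (trans (cong (λ w → N *ᵥ (o +ᵥ o′) +ᵥ w) (trans (sym (to-* N z)) (trans (cong to eq) (to-+ y₁ y₂))))
            (regroup o o′ (to y₁) (to y₂))))
      where
        expand : ∀ o o′ z → N *ᵥ (o +ᵥ o′ +ᵥ z) ≡ N *ᵥ (o +ᵥ o′) +ᵥ N *ᵥ z
        expand o o′ z = *ᵥ-distrib N (o +ᵥ o′) z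
        ring : ∀ n o p y z → n * (o + p) + (y + z) ≡ (n * o + y) + (n * p + z)
        ring = solve-∀
        regroup : ∀ o p y z → N *ᵥ (o +ᵥ p) +ᵥ (y +ᵥ z) ≡ (N *ᵥ o +ᵥ y) +ᵥ (N *ᵥ p +ᵥ z)
        regroup (o , o′ , o″) (p , p′ , p″) (y , y′ , y″) (z , z′ , z″) =
          ×³-≡ (ring N o p y z) (ring N o′ p′ y′ z′) (ring N o″ p″ y″ z″)

    triple-transport : Triple S′ T′ → Triple S T
    triple-transport (triple x a b c a≢0 b≢0 c≢0 corner) = triple (o +ᵥ o′ +ᵥ to x) (to a) (to b) (to c)
      (λ e → a≢0 (to-injective e)) (λ e → b≢0 (to-injective e)) (λ e → c≢0 (to-injective e))
      (λ i j k → subst (InSum S T) (image i j k) (inSum-transport (corner i j k)))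
      where
        to-bit : ∀ i v → to (bit i v) ≡ bit i (to v)
        to-bit false v = to-e₀
        to-bit true v = refl
        image : ∀ i j k → o +ᵥ o′ +ᵥ to (x +ᵥ bit i a +ᵥ bit j b +ᵥ bit k c) ≡
          o +ᵥ o′ +ᵥ to x +ᵥ bit i (to a) +ᵥ bit j (to b) +ᵥ bit k (to c)
        image i j k = trans (push (x +ᵥ bit i a +ᵥ bit j b) (bit k c)) (cong₂ _+ᵥ_ (trans (push (x +ᵥ bit i a) (bit j b)) (cong₂ _+ᵥ_ (trans (push x (bit i a))
            (cong (o +ᵥ o′ +ᵥ to x +ᵥ_) (to-bit i a))) (to-bit j b))) (to-bit k c))
          where
            push : ∀ u v → o +ᵥ o′ +ᵥ to (u +ᵥ v) ≡ o +ᵥ o′ +ᵥ to u +ᵥ to v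
            push u v = trans (cong (o +ᵥ o′ +ᵥ_) (to-+ u v)) (sym (+ᵥ-assoc (o +ᵥ o′) (to u) (to v)))

-- Triples from an edge of one polytope and a facet of the other

count : Bool → ℤ
count false = 0ℤ
count true = 1ℤ

bit-count : ∀ i v → bit i v ≡ count i *ᵥ v
bit-count false (a , b , c) = refl
bit-count true (a , b , c) = ×³-≡ (sym (ℤ.*-identityˡ a)) (sym (ℤ.*-identityˡ b)) (sym (ℤ.*-identityˡ c))

0≤count : ∀ i → 0ℤ ≤ count i
0≤count false = 0≤+ 0
0≤count true = 0≤+ 1

count≤1 : ∀ i → count i ≤ 1ℤ
count≤1 false = ℤ.+≤+ ℕ.z≤n
count≤1 true = ℤ.≤-refl

module _ {S T : ℤ³ → Set} where

  -- A lattice segment of length three starting at p₀ + s.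
  segment-triple : ∀ {p₀ p₁ p₂ s s′ d} K j x₀ x₁ x₂ → S p₀ → S p₁ → S p₂ → T s → T s′ →
    K *ᵥ d ≡ j *ᵥ (s′ -ℤ³ s) +ᵥ (x₀ *ᵥ p₀ +ᵥ (x₁ *ᵥ p₁ +ᵥ x₂ *ᵥ p₂)) → x₀ + (x₁ + x₂) ≡ 0ℤ →
    0ℤ ≤ x₁ → 0ℤ ≤ x₂ → 0ℤ ≤ K + + 3 * x₀ → 0ℤ ≤ j → + 3 * j ≤ K → 0ℤ < K → d ≢ e₀ → Triple S T
  segment-triple {p₀} {p₁} {p₂} {s} {s′} {d} K j x₀ x₁ x₂ Sp₀ Sp₁ Sp₂ Ts Ts′ Kd Σx 0≤x₁ 0≤x₂ 0≤K+3x₀ 0≤j 3j≤K 0<K d≢0 =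
    triple (p₀ +ᵥ s) d d d d≢0 d≢0 d≢0 λ i i′ i″ → subst (InSum S T) (sum i i′ i″)
      (along (count i + (count i′ + count i″))
        (0≤i+j (0≤count i) (0≤i+j (0≤count i′) (0≤count i″)))
        (ℤ.+-mono-≤ (count≤1 i) (ℤ.+-mono-≤ (count≤1 i′) (count≤1 i″))))
    where
      sum : ∀ i i′ i″ → p₀ +ᵥ s +ᵥ (count i + (count i′ + count i″)) *ᵥ d ≡ p₀ +ᵥ s +ᵥ bit i d +ᵥ bit i′ d +ᵥ bit i″ d
      sum i i′ i″ = trans (regroup (p₀ +ᵥ s) d (count i) (count i′) (count i″))
        (cong₂ _+ᵥ_ (cong₂ _+ᵥ_ (cong (p₀ +ᵥ s +ᵥ_) (sym (bit-count i d))) (sym (bit-count i′ d))) (sym (bit-count i″ d)))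
        where
          ring : ∀ p d a b c → p + (a + (b + c)) * d ≡ p + a * d + b * d + c * d
          ring = solve-∀
          regroup : ∀ p d a b c → p +ᵥ (a + (b + c)) *ᵥ d ≡ p +ᵥ a *ᵥ d +ᵥ b *ᵥ d +ᵥ c *ᵥ d
          regroup (p , p′ , p″) (d , d′ , d″) a b c = ×³-≡ (ring p d a b c) (ring p′ d′ a b c) (ring p″ d″ a b c)
      0≤-x₀ : 0ℤ ≤ - x₀
      0≤-x₀ = subst (0ℤ ≤_) (trans (ring x₀ (x₁ + x₂)) (trans (cong (_- x₀) Σx) (ℤ.+-identityˡ (- x₀)))) (0≤i+j 0≤x₁ 0≤x₂)
        where
          ring : ∀ x y → y ≡ (x + y) - x
          ring = solve-∀
      along : ∀ m → 0ℤ ≤ m → m ≤ + 3 → InSum S T (p₀ +ᵥ s +ᵥ m *ᵥ d)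
      -- The step m d shifts weight m j along the edge of T and m xᵢ among the points of S. All
      -- weights are affine in `m` and nonnegative at the two ends 0 and 3.
      along m 0≤m m≤3 = inSum {N = K} 0<K
        (subst (λ n → Cone S n y₁) N₁ (add Sp₀ (K + m * x₀) 0≤α₀ (add Sp₁ (m * x₁) (0≤i*j 0≤m 0≤x₁) (add Sp₂ (m * x₂) (0≤i*j 0≤m 0≤x₂) nil))))
        (subst (λ n → Cone T n y₂) (N₂ K m j) (add Ts (K - m * j) 0≤β (add Ts′ (m * j) (0≤i*j 0≤m 0≤j) nil)))
        (trans (expand p₀ s d) (trans (cong (λ w → K *ᵥ (p₀ +ᵥ s) +ᵥ m *ᵥ w) Kd) (regroup p₀ p₁ p₂ s s′)))
        where
          y₁ = (K + m * x₀) *ᵥ p₀ +ᵥ ((m * x₁) *ᵥ p₁ +ᵥ ((m * x₂) *ᵥ p₂ +ᵥ e₀))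
          y₂ = (K - m * j) *ᵥ s +ᵥ ((m * j) *ᵥ s′ +ᵥ e₀)
          N₁ : K + m * x₀ + (m * x₁ + (m * x₂ + 0ℤ)) ≡ K
          N₁ = trans (ring K m x₀ x₁ x₂) (trans (cong (λ x → K + m * x) Σx) (ring′ K m))
            where
              ring : ∀ k m x y z → k + m * x + (m * y + (m * z + 0ℤ)) ≡ k + m * (x + (y + z))
              ring = solve-∀
              ring′ : ∀ k m → k + m * 0ℤ ≡ k
              ring′ = solve-∀
          N₂ : ∀ k m j → k - m * j + (m * j + 0ℤ) ≡ k
          N₂ = solve-∀
          0≤α₀ : 0ℤ ≤ K + m * x₀
          0≤α₀ = subst (0ℤ ≤_) (ring K m x₀) (0≤i+j 0≤K+3x₀ (0≤i*j (ℤ.i≤j⇒0≤j-i m≤3) 0≤-x₀))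
            where
              ring : ∀ k m x → k + + 3 * x + (+ 3 - m) * (- x) ≡ k + m * x
              ring = solve-∀
          0≤β : 0ℤ ≤ K - m * j
          0≤β = subst (0ℤ ≤_) (ring K m j) (0≤i+j (ℤ.i≤j⇒0≤j-i 3j≤K) (0≤i*j (ℤ.i≤j⇒0≤j-i m≤3) 0≤j))
            where
              ring : ∀ k m j → k - + 3 * j + (+ 3 - m) * j ≡ k - m * j
              ring = solve-∀
          ring-expand : ∀ k m p s d → k * (p + s + m * d) ≡ k * (p + s) + m * (k * d)
          ring-expand = solve-∀
          expand : ∀ p s d → K *ᵥ (p +ᵥ s +ᵥ m *ᵥ d) ≡ K *ᵥ (p +ᵥ s) +ᵥ m *ᵥ (K *ᵥ d)
          expand (p , p′ , p″) (s , s′ , s″) (d , d′ , d″) =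
            ×³-≡ (ring-expand K m p s d) (ring-expand K m p′ s′ d′) (ring-expand K m p″ s″ d″)
          ring : ∀ k m j x₀ x₁ x₂ p₀ p₁ p₂ s s′ → k * (p₀ + s) + m * (j * (s′ - s) + (x₀ * p₀ + (x₁ * p₁ + x₂ * p₂))) ≡
            ((k + m * x₀) * p₀ + ((m * x₁) * p₁ + ((m * x₂) * p₂ + 0ℤ))) + ((k - m * j) * s + ((m * j) * s′ + 0ℤ))
          ring = solve-∀
          regroup : ∀ p₀ p₁ p₂ s s′ → K *ᵥ (p₀ +ᵥ s) +ᵥ m *ᵥ (j *ᵥ (s′ -ℤ³ s) +ᵥ (x₀ *ᵥ p₀ +ᵥ (x₁ *ᵥ p₁ +ᵥ x₂ *ᵥ p₂))) ≡
            ((K + m * x₀) *ᵥ p₀ +ᵥ ((m * x₁) *ᵥ p₁ +ᵥ ((m * x₂) *ᵥ p₂ +ᵥ e₀))) +ᵥ ((K - m * j) *ᵥ s +ᵥ ((m * j) *ᵥ s′ +ᵥ e₀))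
          regroup (a , a′ , a″) (b , b′ , b″) (c , c′ , c″) (t , t′ , t″) (u , u′ , u″) =
            ×³-≡ (ring K m j x₀ x₁ x₂ a b c t u) (ring K m j x₀ x₁ x₂ a′ b′ c′ t′ u′) (ring K m j x₀ x₁ x₂ a″ b″ c″ t″ u″)

  -- A non-primitive edge of T has room for two steps `v`, and an edge of S supplies the third
  -- segment.
  multiple-triple : ∀ {p p′ s s′ v} k → S p → S p′ → T s → T s′ → s′ ≡ s +ᵥ k *ᵥ v → + 2 ≤ k → v ≢ e₀ → p ≢ p′ → Triple S T
  multiple-triple {p} {p′} {s} {_} {v} k Sp Sp′ Ts Ts′ refl 2≤k v≢0 p≢p′ =
    triple (p +ᵥ s) v v (p′ -ℤ³ p) v≢0 v≢0 (λ e → p≢p′ (difference p p′ e)) λ i j l →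
      subst (InSum S T) (sym (sum i j l)) (at (count i) (count j) (count l) (0≤count i) (0≤count j) (0≤count l)
        (count≤1 i) (count≤1 j) (count≤1 l))
    where
      0≤k = ℤ.≤-trans (0≤+ 2) 2≤k
      difference : ∀ p p′ → p′ -ℤ³ p ≡ e₀ → p ≡ p′
      difference (a , b , c) (d , e , f) eq =
        ×³-≡ (sym (ℤ.i-j≡0⇒i≡j d a (cong π₁ eq))) (sym (ℤ.i-j≡0⇒i≡j e b (cong π₂ eq))) (sym (ℤ.i-j≡0⇒i≡j f c (cong π₃ eq)))
      sum : ∀ i j l → p +ᵥ s +ᵥ bit i v +ᵥ bit j v +ᵥ bit l (p′ -ℤ³ p) ≡
        p +ᵥ s +ᵥ count i *ᵥ v +ᵥ count j *ᵥ v +ᵥ count l *ᵥ (p′ -ℤ³ p)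
      sum i j l = cong₂ _+ᵥ_ (cong₂ _+ᵥ_ (cong (p +ᵥ s +ᵥ_) (bit-count i v)) (bit-count j v)) (bit-count l (p′ -ℤ³ p))
      at : ∀ i j l → 0ℤ ≤ i → 0ℤ ≤ j → 0ℤ ≤ l → i ≤ 1ℤ → j ≤ 1ℤ → l ≤ 1ℤ →
        InSum S T (p +ᵥ s +ᵥ i *ᵥ v +ᵥ j *ᵥ v +ᵥ l *ᵥ (p′ -ℤ³ p))
      at i j l 0≤i 0≤j 0≤l i≤1 j≤1 l≤1 = inSum {N = k} (ℤ.<-≤-trans (ℤ.+<+ (ℕ.s≤s ℕ.z≤n)) 2≤k)
        (subst (λ n → Cone S n ((k * (1ℤ - l)) *ᵥ p +ᵥ ((k * l) *ᵥ p′ +ᵥ e₀))) (ring₁ k l)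
          (add Sp (k * (1ℤ - l)) (0≤i*j 0≤k (ℤ.i≤j⇒0≤j-i l≤1)) (add Sp′ (k * l) (0≤i*j 0≤k 0≤l) nil)))
        (subst (λ n → Cone T n ((k - (i + j)) *ᵥ s +ᵥ ((i + j) *ᵥ (s +ᵥ k *ᵥ v) +ᵥ e₀))) (ring₂ k (i + j))
          (add Ts (k - (i + j)) (ℤ.i≤j⇒0≤j-i (ℤ.≤-trans (ℤ.+-mono-≤ i≤1 j≤1) 2≤k)) (add Ts′ (i + j) (0≤i+j 0≤i 0≤j) nil)))
        (regroup p p′ s v)
        where
          ring₁ : ∀ k l → k * (1ℤ - l) + (k * l + 0ℤ) ≡ k
          ring₁ = solve-∀
          ring₂ : ∀ k m → k - m + (m + 0ℤ) ≡ k
          ring₂ = solve-∀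
          ring : ∀ k i j l p p′ s v → k * (p + s + i * v + j * v + l * (p′ - p)) ≡
            (k * (1ℤ - l) * p + (k * l * p′ + 0ℤ)) + ((k - (i + j)) * s + ((i + j) * (s + k * v) + 0ℤ))
          ring = solve-∀
          regroup : ∀ p p′ s v → k *ᵥ (p +ᵥ s +ᵥ i *ᵥ v +ᵥ j *ᵥ v +ᵥ l *ᵥ (p′ -ℤ³ p)) ≡
            ((k * (1ℤ - l)) *ᵥ p +ᵥ ((k * l) *ᵥ p′ +ᵥ e₀)) +ᵥ ((k - (i + j)) *ᵥ s +ᵥ ((i + j) *ᵥ (s +ᵥ k *ᵥ v) +ᵥ e₀))
          regroup (a , a′ , a″) (b , b′ , b″) (c , c′ , c″) (d , d′ , d″) =
            ×³-≡ (ring k i j l a b c d) (ring k i j l a′ b′ c′ d′) (ring k i j l a″ b″ c″ d″)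

-- A multiple j of (c₁ , c₂) / K, with 0 < j ≤ K / 3, whose distance to the lattice point (m , n) is at most 1/3
-- in the hexagonal norm.
record Short (K c₁ c₂ : ℤ) : Set where
  constructor short
  field
    {j X Y m n} : ℤ
    0<j   : 0ℤ < j
    3j≤K  : + 3 * j ≤ K
    Km    : K * m ≡ j * c₁ + X
    Kn    : K * n ≡ j * c₂ + Y
    0≤K+X : 0ℤ ≤ K + + 3 * X
    0≤K-X : 0ℤ ≤ K + + 3 * (- X)
    0≤K+Y : 0ℤ ≤ K + + 3 * Y
    0≤K-Y : 0ℤ ≤ K + + 3 * (- Y)
    0≤K+Z : 0ℤ ≤ K + + 3 * (X + Y)
    0≤K-Z : 0ℤ ≤ K + + 3 * (- (X + Y))

module _ {S T : ℤ³ → Set} (S₀ : S e₀) (S₁ : S e₁) (S₂ : S e₂) where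

  -- The part j / K of the edge becomes the lattice vector (m, n, j) after adding (X, Y, 0) / K,
  -- which has coefficients -(X + Y), X, Y at the points e₀, e₁, e₂. As they sum to 0, only one of
  -- them is negative up to a common sign, and that point serves as the start in `segment-triple`.
  -- The sign is changed by running through the edge backwards.
  short-triple : ∀ {s K c₁ c₂} → T s → T (s +ᵥ (c₁ , c₂ , K)) → 0ℤ < K → Short K c₁ c₂ → Triple S T
  short-triple {s} {K} {c₁} {c₂} Ts Ts′ 0<K (short {j} {X} {Y} {m} {n} 0<j 3j≤K Km Kn +X -X +Y -Y +Z -Z) =
    by-signs (ℤ.≤-total 0ℤ X) (ℤ.≤-total 0ℤ Y) (ℤ.≤-total 0ℤ (X + Y))
    where
      s′ = s +ᵥ (c₁ , c₂ , K)
      d = m , n , j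
      0≤j = ℤ.<⇒≤ 0<j
      d≢0 : d ≢ e₀
      d≢0 e = ℤ.<-irrefl (sym (cong π₃ e)) 0<j
      -d≢0 : -1ℤ *ᵥ d ≢ e₀
      -d≢0 e = ℤ.<-irrefl (trans (sym (cong -_ (cong π₃ e))) (neg-neg j)) 0<j
        where
          neg-neg : ∀ j → - (-1ℤ * j) ≡ j
          neg-neg = solve-∀
      diff : ∀ s w → (s +ᵥ w) -ℤ³ s ≡ w
      diff (a , b , c) (d , e , f) = ×³-≡ (ring a d) (ring b e) (ring c f)
        where
          ring : ∀ a d → a + d - a ≡ d
          ring = solve-∀
      diff′ : ∀ s w → s -ℤ³ (s +ᵥ w) ≡ -1ℤ *ᵥ w
      diff′ (a , b , c) (d , e , f) = ×³-≡ (ring a d) (ring b e) (ring c f)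
        where
          ring : ∀ a d → a - (a + d) ≡ -1ℤ * d
          ring = solve-∀
      forward : ∀ {u} → j *ᵥ (c₁ , c₂ , K) +ᵥ u ≡ j *ᵥ (c₁ , c₂ , K) +ᵥ (X , Y , 0ℤ) →
        K *ᵥ d ≡ j *ᵥ (s′ -ℤ³ s) +ᵥ u
      forward {u} eq = trans (×³-≡ Km Kn (ring K j)) (trans (sym eq) (cong (λ w → j *ᵥ w +ᵥ u) (sym (diff s (c₁ , c₂ , K)))))
        where
          ring : ∀ k j → k * j ≡ j * k + 0ℤ
          ring = solve-∀
      backward : ∀ {u} → j *ᵥ (-1ℤ *ᵥ (c₁ , c₂ , K)) +ᵥ u ≡ -1ℤ *ᵥ (j *ᵥ (c₁ , c₂ , K) +ᵥ (X , Y , 0ℤ)) →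
        K *ᵥ (-1ℤ *ᵥ d) ≡ j *ᵥ (s -ℤ³ s′) +ᵥ u
      backward {u} eq = trans (×³-≡ (trans (swap K m) (cong (-1ℤ *_) Km)) (trans (swap K n) (cong (-1ℤ *_) Kn)) (ring K j))
          (trans (sym eq) (cong (λ w → j *ᵥ w +ᵥ u) (sym (diff′ s (c₁ , c₂ , K)))))
        where
          swap : ∀ k m → k * (-1ℤ * m) ≡ -1ℤ * (k * m)
          swap = solve-∀
          ring : ∀ k j → k * (-1ℤ * j) ≡ -1ℤ * (j * k + 0ℤ)
          ring = solve-∀
      Σ₀ : ∀ x y → - (x + y) + (x + y) ≡ 0ℤ
      Σ₀ = solve-∀
      Σ₀′ : ∀ x y → x + y + (- x + - y) ≡ 0ℤ
      Σ₀′ = solve-∀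
      Σ₁ : ∀ x y → x + (- (x + y) + y) ≡ 0ℤ
      Σ₁ = solve-∀
      Σ₁′ : ∀ x y → - x + (x + y + - y) ≡ 0ℤ
      Σ₁′ = solve-∀
      Σ₂ : ∀ x y → y + (- (x + y) + x) ≡ 0ℤ
      Σ₂ = solve-∀
      Σ₂′ : ∀ x y → - y + (x + y + - x) ≡ 0ℤ
      Σ₂′ = solve-∀
      neg : ∀ {i} → i ≤ 0ℤ → 0ℤ ≤ - i
      neg = ℤ.neg-mono-≤
      x-row : ∀ j c x y → j * c + (- (x + y) * 0ℤ + (x * 1ℤ + y * 0ℤ)) ≡ j * c + x
      x-row = solve-∀
      y-row : ∀ j c x y → j * c + (- (x + y) * 0ℤ + (x * 0ℤ + y * 1ℤ)) ≡ j * c + y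
      y-row = solve-∀
      z-row : ∀ j c x y → j * c + (- (x + y) * 0ℤ + (x * 0ℤ + y * 0ℤ)) ≡ j * c + 0ℤ
      z-row = solve-∀
      at₀ : j *ᵥ (c₁ , c₂ , K) +ᵥ (- (X + Y) *ᵥ e₀ +ᵥ (X *ᵥ e₁ +ᵥ Y *ᵥ e₂)) ≡ j *ᵥ (c₁ , c₂ , K) +ᵥ (X , Y , 0ℤ)
      at₀ = ×³-≡ (x-row j c₁ X Y) (y-row j c₂ X Y) (z-row j K X Y)
      reorder₁ : ∀ w x y u v → w +ᵥ (- (x + y) *ᵥ e₀ +ᵥ (x *ᵥ u +ᵥ y *ᵥ v)) ≡ w +ᵥ (x *ᵥ u +ᵥ (- (x + y) *ᵥ e₀ +ᵥ y *ᵥ v))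
      reorder₁ w x y u v = cong (w +ᵥ_) (trans (sym (+ᵥ-assoc a b c)) (trans (cong (_+ᵥ c) (+ᵥ-comm a b)) (+ᵥ-assoc b a c)))
        where
          a = - (x + y) *ᵥ e₀
          b = x *ᵥ u
          c = y *ᵥ v
      reorder₂ : ∀ w x y u v → w +ᵥ (- (x + y) *ᵥ e₀ +ᵥ (x *ᵥ u +ᵥ y *ᵥ v)) ≡ w +ᵥ (y *ᵥ v +ᵥ (- (x + y) *ᵥ e₀ +ᵥ x *ᵥ u))
      reorder₂ w x y u v = cong (w +ᵥ_) (trans (sym (+ᵥ-assoc a b c)) (+ᵥ-comm (a +ᵥ b) c))
        where
          a = - (x + y) *ᵥ e₀
          b = x *ᵥ u
          c = y *ᵥ v
      x-row′ : ∀ j c x y → j * (-1ℤ * c) + ((x + y) * 0ℤ + (- x * 1ℤ + - y * 0ℤ)) ≡ -1ℤ * (j * c + x)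
      x-row′ = solve-∀
      y-row′ : ∀ j c x y → j * (-1ℤ * c) + ((x + y) * 0ℤ + (- x * 0ℤ + - y * 1ℤ)) ≡ -1ℤ * (j * c + y)
      y-row′ = solve-∀
      z-row′ : ∀ j c x y → j * (-1ℤ * c) + ((x + y) * 0ℤ + (- x * 0ℤ + - y * 0ℤ)) ≡ -1ℤ * (j * c + 0ℤ)
      z-row′ = solve-∀
      at₀′ : j *ᵥ (-1ℤ *ᵥ (c₁ , c₂ , K)) +ᵥ ((X + Y) *ᵥ e₀ +ᵥ (- X *ᵥ e₁ +ᵥ - Y *ᵥ e₂)) ≡ -1ℤ *ᵥ (j *ᵥ (c₁ , c₂ , K) +ᵥ (X , Y , 0ℤ))
      at₀′ = ×³-≡ (x-row′ j c₁ X Y) (y-row′ j c₂ X Y) (z-row′ j K X Y)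
      reorder₁′ : ∀ w x y u v → w +ᵥ ((x + y) *ᵥ e₀ +ᵥ (- x *ᵥ u +ᵥ - y *ᵥ v)) ≡ w +ᵥ (- x *ᵥ u +ᵥ ((x + y) *ᵥ e₀ +ᵥ - y *ᵥ v))
      reorder₁′ w x y u v = cong (w +ᵥ_) (trans (sym (+ᵥ-assoc a b c)) (trans (cong (_+ᵥ c) (+ᵥ-comm a b)) (+ᵥ-assoc b a c)))
        where
          a = (x + y) *ᵥ e₀
          b = - x *ᵥ u
          c = - y *ᵥ v
      reorder₂′ : ∀ w x y u v → w +ᵥ ((x + y) *ᵥ e₀ +ᵥ (- x *ᵥ u +ᵥ - y *ᵥ v)) ≡ w +ᵥ (- y *ᵥ v +ᵥ ((x + y) *ᵥ e₀ +ᵥ - x *ᵥ u))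
      reorder₂′ w x y u v = cong (w +ᵥ_) (trans (sym (+ᵥ-assoc a b c)) (+ᵥ-comm (a +ᵥ b) c))
        where
          a = (x + y) *ᵥ e₀
          b = - x *ᵥ u
          c = - y *ᵥ v
      w₀ = j *ᵥ (c₁ , c₂ , K)
      w₀′ = j *ᵥ (-1ℤ *ᵥ (c₁ , c₂ , K))
      by-signs : _ → _ → _ → Triple S T
      by-signs (inj₁ 0≤X) (inj₁ 0≤Y) _ =
        segment-triple {d = d} K j (- (X + Y)) X Y S₀ S₁ S₂ Ts Ts′ (forward at₀) (Σ₀ X Y) 0≤X 0≤Y -Z 0≤j 3j≤K 0<K d≢0
      by-signs (inj₂ X≤0) (inj₂ Y≤0) _ =
        segment-triple {d = -1ℤ *ᵥ d} K j (X + Y) (- X) (- Y) S₀ S₁ S₂ Ts′ Ts (backward at₀′) (Σ₀′ X Y) (neg X≤0) (neg Y≤0) +Z 0≤j 3j≤K 0<K -d≢0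
      by-signs (inj₁ 0≤X) (inj₂ Y≤0) (inj₁ 0≤Z) =
        segment-triple {d = -1ℤ *ᵥ d} K j (- X) (X + Y) (- Y) S₁ S₀ S₂ Ts′ Ts (backward (trans (sym (reorder₁′ w₀′ X Y e₁ e₂)) at₀′)) (Σ₁′ X Y) 0≤Z (neg Y≤0) -X 0≤j 3j≤K 0<K -d≢0
      by-signs (inj₁ 0≤X) (inj₂ Y≤0) (inj₂ Z≤0) =
        segment-triple {d = d} K j Y (- (X + Y)) X S₂ S₀ S₁ Ts Ts′ (forward (trans (sym (reorder₂ w₀ X Y e₁ e₂)) at₀)) (Σ₂ X Y) (neg Z≤0) 0≤X +Y 0≤j 3j≤K 0<K d≢0
      by-signs (inj₂ X≤0) (inj₁ 0≤Y) (inj₁ 0≤Z) =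
        segment-triple {d = -1ℤ *ᵥ d} K j (- Y) (X + Y) (- X) S₂ S₀ S₁ Ts′ Ts (backward (trans (sym (reorder₂′ w₀′ X Y e₁ e₂)) at₀′)) (Σ₂′ X Y) 0≤Z (neg X≤0) -Y 0≤j 3j≤K 0<K -d≢0
      by-signs (inj₂ X≤0) (inj₁ 0≤Y) (inj₂ Z≤0) =
        segment-triple {d = d} K j X (- (X + Y)) Y S₁ S₀ S₂ Ts Ts′ (forward (trans (sym (reorder₁ w₀ X Y e₁ e₂)) at₀)) (Σ₁ X Y) (neg Z≤0) 0≤Y +X 0≤j 3j≤K 0<K d≢0

-- Simultaneous approximation in the hexagonal norm

close : ℕ → ℕ → ℕ → Bool
-- The four corners (0, 0), (0, 1), (1, 0), (1, 1) of the unit square are tried as nearest lattice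
-- points of (r, s) / K. The hexagonal norm is the sum of the absolute values when the signs agree
-- and their maximum when they differ.
close K r s = (3 ℕ.* (r ℕ.+ s) ≤ᵇ K) ∨ ((3 ℕ.* r ≤ᵇ K) ∧ (3 ℕ.* (K ℕ.∸ s) ≤ᵇ K)) ∨
  ((3 ℕ.* (K ℕ.∸ r) ≤ᵇ K) ∧ (3 ℕ.* s ≤ᵇ K)) ∨ (3 ℕ.* ((K ℕ.∸ r) ℕ.+ (K ℕ.∸ s)) ≤ᵇ K)

some : ℕ → (ℕ → Bool) → Bool
some zero p = false
some (suc n) p = p (suc n) ∨ some n p

every : ℕ → (ℕ → Bool) → Bool
every zero p = true
every (suc n) p = p n ∧ every n p

hit : ∀ K .{{_ : ℕ.NonZero K}} → ℕ → ℕ → Bool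
hit K x y = some (K ℕ./ 3) λ j → close K (j ℕ.* x ℕ.% K) (j ℕ.* y ℕ.% K)

∧-sound : ∀ {x y} → T (x ∧ y) → T x × T y
∧-sound = Equivalence.to T-∧

∨-sound : ∀ {x y} → T (x ∨ y) → T x ⊎ T y
∨-sound = Equivalence.to T-∨

some-sound : ∀ n {p} → T (some n p) → ∃ λ j → 0 ℕ.< j × j ℕ.≤ n × T (p j)
some-sound (suc n) {p} t = [ (λ h → suc n , ℕ.s≤s ℕ.z≤n , ℕ.≤-refl , h) ,
  (λ h → let (j , 0<j , j≤n , pj) = some-sound n {p} h in j , 0<j , ℕ.m≤n⇒m≤1+n j≤n , pj) ]′ (∨-sound {p (suc n)} t)

every-sound : ∀ n p → T (every n p) → ∀ {k} → k ℕ.< n → T (p k)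
every-sound (suc n) p t {k} k<1+n = [ (λ k<n → every-sound n p (proj₂ (∧-sound {p n} t)) k<n) ,
  (λ k≡n → subst (λ k → T (p k)) (sym k≡n) (proj₁ (∧-sound {p n} t))) ]′ (ℕ.m<1+n⇒m<n∨m≡n k<1+n)

-- The hexagon is the difference body of the standard triangle, scaled by K / 3: the absolute values
-- of X, Y and X + Y are at most K / 3.
record Hex (K X Y : ℤ) : Set where
  constructor hex
  field
    0≤K+X : 0ℤ ≤ K + + 3 * X
    0≤K-X : 0ℤ ≤ K + + 3 * (- X)
    0≤K+Y : 0ℤ ≤ K + + 3 * Y
    0≤K-Y : 0ℤ ≤ K + + 3 * (- Y)
    0≤K+Z : 0ℤ ≤ K + + 3 * (X + Y)
    0≤K-Z : 0ℤ ≤ K + + 3 * (- (X + Y))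

private
  by : ∀ {e x} → e ≡ x → 0ℤ ≤ e → 0ℤ ≤ x
  by = subst (0ℤ ≤_)

  0≤3* : ∀ {x} → 0ℤ ≤ x → 0ℤ ≤ + 3 * x
  0≤3* = 0≤i*j (0≤+ 3)

hex-pos : ∀ {K X Y} → 0ℤ ≤ X → 0ℤ ≤ Y → 0ℤ ≤ K → 0ℤ ≤ K - + 3 * (X + Y) → Hex K X Y
hex-pos {K} {X} {Y} 0≤X 0≤Y 0≤K h = hex (0≤i+j 0≤K (0≤3* 0≤X)) (by (ring₁ K X Y) (0≤i+j h (0≤3* 0≤Y)))
  (0≤i+j 0≤K (0≤3* 0≤Y)) (by (ring₂ K X Y) (0≤i+j h (0≤3* 0≤X))) (0≤i+j 0≤K (0≤3* (0≤i+j 0≤X 0≤Y))) (by (ring₃ K X Y) h)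
  where
    ring₁ : ∀ k x y → k - + 3 * (x + y) + + 3 * y ≡ k + + 3 * (- x)
    ring₁ = solve-∀
    ring₂ : ∀ k x y → k - + 3 * (x + y) + + 3 * x ≡ k + + 3 * (- y)
    ring₂ = solve-∀
    ring₃ : ∀ k x y → k - + 3 * (x + y) ≡ k + + 3 * (- (x + y))
    ring₃ = solve-∀

hex-neg : ∀ {K X Y} → Hex K X Y → Hex K (- X) (- Y)
hex-neg {K} {X} {Y} (hex a b c d e f) = hex b (by (ring K X) a) d (by (ring K Y) c) (by (ring₁ K X Y) f) (by (ring₂ K X Y) e)
  where
    ring : ∀ k x → k + + 3 * x ≡ k + + 3 * (- (- x))
    ring = solve-∀
    ring₁ : ∀ k x y → k + + 3 * (- (x + y)) ≡ k + + 3 * (- x + - y)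
    ring₁ = solve-∀
    ring₂ : ∀ k x y → k + + 3 * (x + y) ≡ k + + 3 * (- (- x + - y))
    ring₂ = solve-∀

hex-mixed : ∀ {K X Y} → 0ℤ ≤ X → 0ℤ ≤ Y → 0ℤ ≤ K → 0ℤ ≤ K - + 3 * X → 0ℤ ≤ K - + 3 * Y → Hex K (- X) Y
hex-mixed {K} {X} {Y} 0≤X 0≤Y 0≤K hX hY = hex (by (ring₀ K X) hX) (by (ring K X) (0≤i+j 0≤K (0≤3* 0≤X)))
  (0≤i+j 0≤K (0≤3* 0≤Y)) (by (ring₀ K Y) hY) (by (ring₁ K X Y) (0≤i+j hX (0≤3* 0≤Y))) (by (ring₂ K X Y) (0≤i+j hY (0≤3* 0≤X)))
  where
    ring₀ : ∀ k x → k - + 3 * x ≡ k + + 3 * (- x)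
    ring₀ = solve-∀
    ring : ∀ k x → k + + 3 * x ≡ k + + 3 * (- (- x))
    ring = solve-∀
    ring₁ : ∀ k x y → k - + 3 * x + + 3 * y ≡ k + + 3 * (- x + y)
    ring₁ = solve-∀
    ring₂ : ∀ k x y → k - + 3 * y + + 3 * x ≡ k + + 3 * (- (- x + y))
    ring₂ = solve-∀

close-sound : ∀ K r s → r ℕ.≤ K → s ℕ.≤ K → T (close K r s) →
  ∃₂ λ δ ε → Hex (+ K) (δ * + K - + r) (ε * + K - + s)
close-sound K r s r≤K s≤K t = cases (∨-sound {3 ℕ.* (r ℕ.+ s) ≤ᵇ K} t)
  where
    r′ = K ℕ.∸ r
    s′ = K ℕ.∸ s
    bound : ∀ n → T (3 ℕ.* n ≤ᵇ K) → 0ℤ ≤ + K - + 3 * + n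
    bound n h = subst (λ x → 0ℤ ≤ + K - x) (ℤ.pos-* 3 n) (ℤ.i≤j⇒0≤j-i (ℤ.+≤+ (ℕ.≤ᵇ⇒≤ (3 ℕ.* n) K h)))
    zero-times : ∀ K r → - r ≡ 0ℤ * K - r
    zero-times = solve-∀
    complement : ∀ {r} → r ℕ.≤ K → + (K ℕ.∸ r) ≡ 1ℤ * + K - + r
    complement {r} r≤K = trans (sym (trans (ℤ.m-n≡m⊖n K r) (ℤ.⊖-≥ r≤K))) (cong (_- + r) (sym (ℤ.*-identityˡ (+ K))))
    cases : _ → ∃₂ λ δ ε → Hex (+ K) (δ * + K - + r) (ε * + K - + s)
    cases (inj₁ h) = 0ℤ , 0ℤ , subst₂ (Hex (+ K)) (zero-times (+ K) (+ r)) (zero-times (+ K) (+ s))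
      (hex-neg (hex-pos (0≤+ r) (0≤+ s) (0≤+ K) (bound (r ℕ.+ s) h)))
    cases (inj₂ h) = cases′ (∨-sound {(3 ℕ.* r ≤ᵇ K) ∧ (3 ℕ.* s′ ≤ᵇ K)} h)
      where
        cases″ : _ → _
        cases″ (inj₁ h) = let (p , q) = ∧-sound {3 ℕ.* r′ ≤ᵇ K} h in 1ℤ , 0ℤ ,
          subst₂ (Hex (+ K)) (trans (ℤ.neg-involutive (+ r′)) (complement r≤K)) (zero-times (+ K) (+ s))
            (hex-neg (hex-mixed (0≤+ r′) (0≤+ s) (0≤+ K) (bound r′ p) (bound s q)))
        cases″ (inj₂ h) = 1ℤ , 1ℤ , subst₂ (Hex (+ K)) (complement r≤K) (complement s≤K)
          (hex-pos (0≤+ r′) (0≤+ s′) (0≤+ K) (bound (r′ ℕ.+ s′) h))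
        cases′ : _ → _
        cases′ (inj₁ h) = let (p , q) = ∧-sound {3 ℕ.* r ≤ᵇ K} h in 0ℤ , 1ℤ ,
          subst₂ (Hex (+ K)) (zero-times (+ K) (+ r)) (complement s≤K) (hex-mixed (0≤+ r) (0≤+ s′) (0≤+ K) (bound r p) (bound s′ q))
        cases′ (inj₂ h) = cases″ (∨-sound {(3 ℕ.* r′ ≤ᵇ K) ∧ (3 ℕ.* s ≤ᵇ K)} h)

hex⇒short : ∀ {K c₁ c₂ j X Y m n} → 0ℤ < j → + 3 * j ≤ K → K * m ≡ j * c₁ + X → K * n ≡ j * c₂ + Y → Hex K X Y → Short K c₁ c₂
hex⇒short {K} {c₁} {c₂} {j} {X} {Y} {m} {n} 0<j 3j≤K Km Kn (hex a b c d e f) =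
  short {j = j} {X} {Y} {m} {n} 0<j 3j≤K Km Kn a b c d e f

-- The numerator of j x modulo K, as an identity in ℤ.
multiple : ∀ K .{{_ : ℕ.NonZero K}} j x u → + j * (+ x + u * + K) ≡ + (j ℕ.* x ℕ.% K) + (+ (j ℕ.* x ℕ./ K) + + j * u) * + K
multiple K j x u = trans (ring₁ (+ j) (+ x) u (+ K)) (trans
  (cong (_+ + j * u * + K) (trans (sym (ℤ.pos-* j x)) (trans (cong +_ (ℕ.m≡m%n+[m/n]*n (j ℕ.* x) K)) (cong (λ w → + r + w) (ℤ.pos-* e K)))))
  (ring₂ (+ r) (+ e) (+ j * u) (+ K)))
  where
    r = j ℕ.* x ℕ.% K
    e = j ℕ.* x ℕ./ K
    ring₁ : ∀ j x u k → j * (x + u * k) ≡ j * x + j * u * k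
    ring₁ = solve-∀
    ring₂ : ∀ r e w k → r + e * k + w * k ≡ r + (e + w) * k
    ring₂ = solve-∀

hit-short : ∀ K .{{_ : ℕ.NonZero K}} x y u v → T (hit K x y) → Short (+ K) (+ x + u * + K) (+ y + v * + K)
hit-short K x y u v t =
  let (j , 0<j , j≤ , h) = some-sound (K ℕ./ 3) t in
  from j 0<j j≤ (close-sound K (j ℕ.* x ℕ.% K) (j ℕ.* y ℕ.% K) (ℕ.<⇒≤ (ℕ.m%n<n (j ℕ.* x) K)) (ℕ.<⇒≤ (ℕ.m%n<n (j ℕ.* y) K)) h)
  where
    ring : ∀ k e δ r → k * (e + δ) ≡ r + e * k + (δ * k - r)
    ring = solve-∀
    reduce : ∀ j c e δ r → + j * c ≡ + r + e * + K → + K * (e + δ) ≡ + j * c + (δ * + K - + r)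
    reduce j c e δ r eq = trans (ring (+ K) e δ (+ r)) (cong (_+ (δ * + K - + r)) (sym eq))
    from : ∀ j → 0 ℕ.< j → j ℕ.≤ K ℕ./ 3 →
      (∃₂ λ δ ε → Hex (+ K) (δ * + K - + (j ℕ.* x ℕ.% K)) (ε * + K - + (j ℕ.* y ℕ.% K))) → Short (+ K) (+ x + u * + K) (+ y + v * + K)
    from j 0<j j≤ (δ , ε , hx) = hex⇒short {j = + j} {m = E + δ} {F + ε} (ℤ.+<+ 0<j)
      (subst (_≤ + K) (ℤ.pos-* 3 j) (ℤ.+≤+ (ℕ.≤-trans (ℕ.*-monoʳ-≤ 3 j≤) (subst (ℕ._≤ K) (ℕ.*-comm (K ℕ./ 3) 3) (ℕ.m/n*n≤m K 3)))))
      (reduce j (+ x + u * + K) E δ (j ℕ.* x ℕ.% K) (multiple K j x u))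
      (reduce j (+ y + v * + K) F ε (j ℕ.* y ℕ.% K) (multiple K j y v)) hx
      where
        E = + (j ℕ.* x ℕ./ K) + + j * u
        F = + (j ℕ.* y ℕ./ K) + + j * v

all-hit : ℕ → Bool
all-hit k = every (18 ℕ.+ k) λ x → every (18 ℕ.+ k) λ y → hit (18 ℕ.+ k) x y

-- Evaluates all pairs of residues for the heights 18 to 53, where the pigeonhole bound 54 = 3 · 18
-- is not reached yet.
all-hit-middle : T (every 36 all-hit)
all-hit-middle = tt

module _ (K : ℕ) .{{_ : ℕ.NonZero K}} where
  private
    third : ℕ → Fin 3
    third r = fromℕ< (third< r)
      where
        third< : ∀ r → 3 ℕ.* (r ℕ.% K) ℕ./ K ℕ.< 3
        third< r = ℕ.m<n*o⇒m/o<n {3 ℕ.* (r ℕ.% K)} {3} {K} (ℕ.*-monoʳ-< 3 (ℕ.m%n<n r K))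

    rest : ℕ → ℕ
    rest r = 3 ℕ.* (r ℕ.% K) ℕ.% K

    side : ℕ → Fin 2
    side t with t ℕ.<? K
    ... | yes _ = zero
    ... | no _ = suc zero

    side-≡ : ∀ t t′ → side t ≡ side t′ → (t ℕ.< K × t′ ℕ.< K) ⊎ (K ℕ.≤ t × K ℕ.≤ t′)
    side-≡ t t′ eq with t ℕ.<? K | t′ ℕ.<? K
    ... | yes p | yes p′ = inj₁ (p , p′)
    ... | no p  | no p′ = inj₂ (ℕ.≮⇒≥ p , ℕ.≮⇒≥ p′)
    side-≡ t t′ () | yes _ | no _
    side-≡ t t′ () | no _ | yes _

    rest-sum≤ : ∀ r s → + (rest r ℕ.+ rest s) ≤ + K + + K
    rest-sum≤ r s = ℤ.+≤+ (ℕ.+-mono-≤ (ℕ.<⇒≤ (ℕ.m%n<n (3 ℕ.* (r ℕ.% K)) K)) (ℕ.<⇒≤ (ℕ.m%n<n (3 ℕ.* (s ℕ.% K)) K)))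

  -- The torus is cut into 18 triangles, by thirds of the coordinates and by the diagonals.
  triangle : ℕ → ℕ → Fin 18
  triangle r s = combine (combine (third r) (third s)) (side (rest r ℕ.+ rest s))

  third-difference : ∀ r r′ → third r ≡ third r′ → + 3 * (+ (r ℕ.% K) - + (r′ ℕ.% K)) ≡ + rest r - + rest r′
  third-difference r r′ eq = trans (ring₁ (+ (r ℕ.% K)) (+ (r′ ℕ.% K))) (trans (cong₂ _-_ (split r) (split r′))
    (trans (cong (λ a → + rest r + + a * + K - (+ rest r′ + + (3 ℕ.* (r′ ℕ.% K) ℕ./ K) * + K)) same) (ring₂ (+ rest r) (+ rest r′) (+ (3 ℕ.* (r′ ℕ.% K) ℕ./ K) * + K))))
    where
      ring₁ : ∀ r r′ → + 3 * (r - r′) ≡ + 3 * r - + 3 * r′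
      ring₁ = solve-∀
      ring₂ : ∀ a b c → a + c - (b + c) ≡ a - b
      ring₂ = solve-∀
      split : ∀ r → + 3 * + (r ℕ.% K) ≡ + rest r + + (3 ℕ.* (r ℕ.% K) ℕ./ K) * + K
      split r = trans (sym (ℤ.pos-* 3 (r ℕ.% K))) (trans (cong +_ (ℕ.m≡m%n+[m/n]*n (3 ℕ.* (r ℕ.% K)) K))
        (cong (λ w → + rest r + w) (ℤ.pos-* (3 ℕ.* (r ℕ.% K) ℕ./ K) K)))
      same : 3 ℕ.* (r ℕ.% K) ℕ./ K ≡ 3 ℕ.* (r′ ℕ.% K) ℕ./ K
      same = trans (sym (Fin.toℕ-fromℕ< _)) (trans (cong toℕ eq) (Fin.toℕ-fromℕ< _))

  -- Within a cell of the grid of thirds, 3 X and 3 Y are differences of the offsets `rest`, which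
  -- lie between 0 and K. Their sum stays within K as well because both sums of offsets lie on the
  -- same side of the diagonal.
  triangle-hex : ∀ r s r′ s′ → triangle r s ≡ triangle r′ s′ → Hex (+ K) (+ (r ℕ.% K) - + (r′ ℕ.% K)) (+ (s ℕ.% K) - + (s′ ℕ.% K))
  triangle-hex r s r′ s′ eq = hex
    (by (cong (λ w → + K + w) (sym dX)) (spread r r′))
    (by (trans (reverse (+ K) (+ rest r′) (+ rest r)) (cong (λ w → + K - w) (sym dX) ⟨trans⟩ neg₃ (+ K) X)) (spread r′ r))
    (by (cong (λ w → + K + w) (sym dY)) (spread s s′))
    (by (trans (reverse (+ K) (+ rest s′) (+ rest s)) (cong (λ w → + K - w) (sym dY) ⟨trans⟩ neg₃ (+ K) Y)) (spread s′ s))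
    (by (sum (+ K)) lower)
    (by (sum′ (+ K)) upper)
    where
      _⟨trans⟩_ : ∀ {a b c : ℤ} → a ≡ b → b ≡ c → a ≡ c
      _⟨trans⟩_ = trans
      X = + (r ℕ.% K) - + (r′ ℕ.% K)
      Y = + (s ℕ.% K) - + (s′ ℕ.% K)
      parts = Fin.combine-injective (combine (third r) (third s)) (side (rest r ℕ.+ rest s)) (combine (third r′) (third s′)) (side (rest r′ ℕ.+ rest s′)) eq
      thirds = Fin.combine-injective (third r) (third s) (third r′) (third s′) (proj₁ parts)
      dX : + 3 * X ≡ + rest r - + rest r′
      dX = third-difference r r′ (proj₁ thirds)
      dY : + 3 * Y ≡ + rest s - + rest s′
      dY = third-difference s s′ (proj₂ thirds)
      reverse : ∀ k a b → k + (a - b) ≡ k - (b - a)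
      reverse = solve-∀
      neg₃ : ∀ k x → k - + 3 * x ≡ k + + 3 * (- x)
      neg₃ = solve-∀
      spread : ∀ r r′ → 0ℤ ≤ + K + (+ rest r - + rest r′)
      spread r r′ = by (ring (+ K) (+ rest r) (+ rest r′))
        (0≤i+j (0≤+ (rest r)) (ℤ.i≤j⇒0≤j-i (ℤ.+≤+ (ℕ.<⇒≤ (ℕ.m%n<n (3 ℕ.* (r′ ℕ.% K)) K)))))
        where
          ring : ∀ k a b → a + (k - b) ≡ k + (a - b)
          ring = solve-∀
      U = + (rest r ℕ.+ rest s)
      V = + (rest r′ ℕ.+ rest s′)
      total : + 3 * (X + Y) ≡ U - V
      total = trans (ring₁ X Y) (trans (cong₂ _+_ dX dY) (ring₂ (+ rest r) (+ rest r′) (+ rest s) (+ rest s′)))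
        where
          ring₁ : ∀ x y → + 3 * (x + y) ≡ + 3 * x + + 3 * y
          ring₁ = solve-∀
          ring₂ : ∀ a b c d → a - b + (c - d) ≡ a + c - (b + d)
          ring₂ = solve-∀
      sum : ∀ k → k + (U - V) ≡ k + + 3 * (X + Y)
      sum k = cong (λ w → k + w) (sym total)
      sum′ : ∀ k → k + (V - U) ≡ k + + 3 * (- (X + Y))
      sum′ k = trans (reverse k V U) (trans (cong (λ w → k - w) (sym total)) (neg₃ k (X + Y)))
      apart : ∀ {u v} → + u ≤ + K + + K → + K ≤ + v → 0ℤ ≤ + K + (+ v - + u)
      apart {u} {v} u≤ k≤v = by (ring (+ K) (+ u) (+ v)) (0≤i+j (ℤ.i≤j⇒0≤j-i u≤) (ℤ.i≤j⇒0≤j-i k≤v))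
        where
          ring : ∀ k u v → (k + k - u) + (v - k) ≡ k + (v - u)
          ring = solve-∀
      below : ∀ {u v} → u ℕ.< K → 0ℤ ≤ + K + (+ v - + u)
      below {u} {v} u<K = by (ring (+ K) (+ u) (+ v)) (0≤i+j (ℤ.i≤j⇒0≤j-i (ℤ.+≤+ (ℕ.<⇒≤ u<K))) (0≤+ v))
        where
          ring : ∀ k u v → k - u + v ≡ k + (v - u)
          ring = solve-∀
      sides = side-≡ (rest r ℕ.+ rest s) (rest r′ ℕ.+ rest s′) (proj₂ parts)
      lower : 0ℤ ≤ + K + (U - V)
      lower = [ (λ (_ , p) → below p) , (λ (p , _) → apart (rest-sum≤ r′ s′) (ℤ.+≤+ p)) ]′ sides
      upper : 0ℤ ≤ + K + (V - U)
      upper = [ (λ (p , _) → below p) , (λ (_ , p) → apart (rest-sum≤ r s) (ℤ.+≤+ p)) ]′ sides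

  -- Two of the 19 multiples 0, ..., 18 fall into the same of the 18 triangles. Their difference j
  -- is at most 18, and 3 j ≤ 54 ≤ K.
  dirichlet : ∀ x y u v → 54 ℕ.≤ K → Short (+ K) (+ x + u * + K) (+ y + v * + K)
  dirichlet x y u v 54≤K = from (Fin.pigeonhole (ℕ.≤-refl {19}) λ j → triangle (toℕ j ℕ.* x) (toℕ j ℕ.* y))
    where
      from : (∃₂ λ (i j : Fin 19) → i Fin.< j × triangle (toℕ i ℕ.* x) (toℕ i ℕ.* y) ≡ triangle (toℕ j ℕ.* x) (toℕ j ℕ.* y)) →
        Short (+ K) (+ x + u * + K) (+ y + v * + K)
      from (i , j , i<j , eq) = hex⇒short {j = gap} {m = M x u} {M y v}
        (subst (_< gap) (ℤ.+-inverseʳ (+ toℕ i)) (ℤ.+-monoˡ-< (- + toℕ i) (ℤ.+<+ i<j)))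
        (ℤ.≤-trans (ℤ.*-monoˡ-≤-nonNeg (+ 3) gap≤18) (ℤ.+≤+ 54≤K))
        (shifted x u) (shifted y v)
        (triangle-hex (toℕ i ℕ.* x) (toℕ i ℕ.* y) (toℕ j ℕ.* x) (toℕ j ℕ.* y) eq)
        where
          gap = + toℕ j - + toℕ i
          gap≤18 : gap ≤ + 18
          gap≤18 = ℤ.≤-trans (ℤ.+-mono-≤ (ℤ.+≤+ (ℕ.≤-pred (Fin.toℕ<n j))) (ℤ.neg-mono-≤ (0≤+ (toℕ i)))) ℤ.≤-refl
          E : Fin 19 → ℕ → ℤ → ℤ
          E k x u = + (toℕ k ℕ.* x ℕ./ K) + + toℕ k * u
          M : ℕ → ℤ → ℤ
          M x u = E j x u - E i x u
          ring : ∀ k r r′ e e′ → k * (e′ - e) ≡ (r′ + e′ * k) - (r + e * k) + (r - r′)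
          ring = solve-∀
          ring′ : ∀ a b c → a * c - b * c ≡ (a - b) * c
          ring′ = solve-∀
          shifted : ∀ x u → + K * M x u ≡ gap * (+ x + u * + K) + (+ (toℕ i ℕ.* x ℕ.% K) - + (toℕ j ℕ.* x ℕ.% K))
          shifted x u = trans (ring (+ K) (+ (toℕ i ℕ.* x ℕ.% K)) (+ (toℕ j ℕ.* x ℕ.% K)) (E i x u) (E j x u))
            (cong (_+ (+ (toℕ i ℕ.* x ℕ.% K) - + (toℕ j ℕ.* x ℕ.% K)))
              (trans (cong₂ _-_ (sym (multiple K (toℕ j) x u)) (sym (multiple K (toℕ i) x u))) (ring′ (+ toℕ j) (+ toℕ i) (+ x + u * + K))))

residue-form : ∀ K .{{_ : ℕ.NonZero K}} c → + (c ℤ.%ℕ K) + (c ℤ./ℕ K) * + K ≡ c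
residue-form K c = sym (ℤ.a≡a%ℕn+[a/ℕn]*n c K)

hit⇒short : ∀ K .{{_ : ℕ.NonZero K}} c₁ c₂ → T (hit K (c₁ ℤ.%ℕ K) (c₂ ℤ.%ℕ K)) → Short (+ K) c₁ c₂
hit⇒short K c₁ c₂ t = subst₂ (Short (+ K)) (residue-form K c₁) (residue-form K c₂)
  (hit-short K (c₁ ℤ.%ℕ K) (c₂ ℤ.%ℕ K) (c₁ ℤ./ℕ K) (c₂ ℤ./ℕ K) t)

tall-short : ∀ K c₁ c₂ → 18 ℕ.≤ K → Short (+ K) c₁ c₂
tall-short K c₁ c₂ 18≤K = by-size (K ℕ.<? 54)
  where
    instance _ = ℕ.>-nonZero (ℕ.≤-trans (ℕ.s≤s ℕ.z≤n) 18≤K)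
    by-size : _ → Short (+ K) c₁ c₂
    by-size (no K≮54) = subst₂ (Short (+ K)) (residue-form K c₁) (residue-form K c₂)
      (dirichlet K (c₁ ℤ.%ℕ K) (c₂ ℤ.%ℕ K) (c₁ ℤ./ℕ K) (c₂ ℤ./ℕ K) (ℕ.≮⇒≥ K≮54))
    by-size (yes K<54) = tabulated (ℕ.m+[n∸m]≡n 18≤K)
      where
        tabulated : ∀ {k} → 18 ℕ.+ k ≡ K → Short (+ K) c₁ c₂
        tabulated {k} refl = hit⇒short K′ c₁ c₂ (every-sound K′ (λ y → hit K′ (c₁ ℤ.%ℕ K′) y)
            (every-sound K′ (λ x → every K′ λ y → hit K′ x y)
              (every-sound 36 all-hit all-hit-middle (ℕ.+-cancelˡ-< 18 k 36 K<54)) (ℤ.n%ℕd<d c₁ K′)) (ℤ.n%ℕd<d c₂ K′))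
          where K′ = 18 ℕ.+ k

-- Heights of an edge over the four facets

data Facet : ℤ³ → Set where
  above : ∀ {c₁ c₂ k} → 0ℤ < k → Short k c₁ c₂ → Facet (c₁ , c₂ , k)
  below : ∀ {c₁ c₂ k} → k < 0ℤ → Short (- k) (- c₁) (- c₂) → Facet (c₁ , c₂ , k)

-- A difference of two points of T, read in a chart that maps the standard triangle to a triangle of S.
module _ {S T : ℤ³ → Set} (φ : Chart) (o : ℤ³) where
  open Chart φ

  facet-triple : S (o +ᵥ to e₀) → S (o +ᵥ to e₁) → S (o +ᵥ to e₂) → ∀ {s c} → T s → T (s +ᵥ c) → Facet (from c) → Triple S T
  facet-triple S₀ S₁ S₂ {s} {c} Ts Ts′ = go (from c) (to-from c)
    where
      up : ∀ {c₁ c₂ k} → to (c₁ , c₂ , k) ≡ c → 0ℤ < k → Short k c₁ c₂ → Triple S T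
      up {c₁} {c₂} {k} eq 0<k sh = triple-transport φ {S′ = λ v → S (o +ᵥ to v)} {T′ = λ v → T (s +ᵥ to v)} {o} {s} (λ x → x) (λ x → x)
        (short-triple S₀ S₁ S₂ {e₀} {k} (subst T (sym (trans (cong (s +ᵥ_) to-e₀) (+ᵥ-identityʳ s))) Ts)
          (subst T (cong (s +ᵥ_) (sym (trans (cong to (+ᵥ-identityˡ (c₁ , c₂ , k))) eq))) Ts′) 0<k sh)
      down : ∀ {c₁ c₂ k} → to (c₁ , c₂ , k) ≡ c → k < 0ℤ → Short (- k) (- c₁) (- c₂) → Triple S T
      down {c₁} {c₂} {k} eq k<0 sh = triple-transport φ {S′ = λ v → S (o +ᵥ to v)} {T′ = λ v → T (s +ᵥ to v)} {o} {s} (λ x → x) (λ x → x)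
        (short-triple S₀ S₁ S₂ {c₁ , c₂ , k} { - k} (subst T (cong (s +ᵥ_) (sym eq)) Ts′)
          (subst T (sym (trans (cong (s +ᵥ_) (trans (cong to (opposite c₁ c₂ k)) to-e₀)) (+ᵥ-identityʳ s))) Ts) (ℤ.neg-mono-< k<0) sh)
        where
          opposite : ∀ x y z → (x , y , z) +ᵥ (- x , - y , - z) ≡ e₀
          opposite x y z = ×³-≡ (ℤ.+-inverseʳ x) (ℤ.+-inverseʳ y) (ℤ.+-inverseʳ z)
      go : ∀ v → to v ≡ c → Facet v → Triple S T
      go _ eq (above 0<k sh) = up eq 0<k sh
      go _ eq (below k<0 sh) = down eq k<0 sh

-- From height 18 on a short multiple exists for all residues, so only smaller heights are
-- evaluated. At height 0 the edge is parallel to the facet and the test does not apply.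
facet-test : ℤ³ → Bool
facet-test (c₁ , c₂ , + zero) = false
facet-test (c₁ , c₂ , + suc k) = (18 ≤ᵇ suc k) ∨ hit (suc k) (c₁ ℤ.%ℕ suc k) (c₂ ℤ.%ℕ suc k)
facet-test (c₁ , c₂ , -[1+ k ]) = (18 ≤ᵇ suc k) ∨ hit (suc k) ((- c₁) ℤ.%ℕ suc k) ((- c₂) ℤ.%ℕ suc k)

facet-test-sound : ∀ c → T (facet-test c) → Facet c
facet-test-sound (c₁ , c₂ , + suc k) t = above (ℤ.+<+ (ℕ.s≤s ℕ.z≤n)) (short-height (∨-sound {18 ≤ᵇ suc k} t))
  where
    short-height : _ → _
    short-height (inj₁ h) = tall-short (suc k) c₁ c₂ (ℕ.≤ᵇ⇒≤ 18 (suc k) h)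
    short-height (inj₂ h) = hit⇒short (suc k) c₁ c₂ h
facet-test-sound (c₁ , c₂ , -[1+ k ]) t = below ℤ.-<+ (short-height (∨-sound {18 ≤ᵇ suc k} t))
  where
    short-height : _ → _
    short-height (inj₁ h) = tall-short (suc k) (- c₁) (- c₂) (ℕ.≤ᵇ⇒≤ 18 (suc k) h)
    short-height (inj₂ h) = hit⇒short (suc k) (- c₁) (- c₂) h

-- The origin of the bound 17, which makes the later search finite.
facet-test-height : ∀ c → ¬ T (facet-test c) → ∣ π₃ c ∣ ℕ.≤ 17
facet-test-height (_ , _ , + zero) _ = ℕ.z≤n
facet-test-height (_ , _ , + suc k) ¬t = ℕ.≤-pred (ℕ.≰⇒> λ 18≤ → ¬t (Equivalence.from T-∨ (inj₁ (ℕ.≤⇒≤ᵇ 18≤))))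
facet-test-height (_ , _ , -[1+ k ]) ¬t = ℕ.≤-pred (ℕ.≰⇒> λ 18≤ → ¬t (Equivalence.from T-∨ (inj₁ (ℕ.≤⇒≤ᵇ 18≤))))

data Vert (a b q : ℤ) : ℤ³ → Set where
  v₀ : Vert a b q e₀
  v₁ : Vert a b q e₁
  v₂ : Vert a b q e₂
  v₃ : Vert a b q (a , b , q)

identity-chart : Chart
identity-chart = chart (λ v → v) (λ v → v) (λ _ → refl) (λ _ → refl) (λ _ _ → refl) (λ _ _ → refl)

-- chartᵢ maps the standard triangle to the facet opposite to vᵢ.
chart₁ : ℤ → ℤ → Chart
chart₁ b q = chart (λ (x , y , z) → y , x + b * y , q * y + z) (λ (x , y , z) → y - b * x , x , z - q * x)
  (λ (x , y , z) → ×³-≡ refl (r₁ b x y) (r₂ q x z)) (λ (x , y , z) → ×³-≡ (r₃ b x y) refl (r₄ q y z))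
  (λ (x , y , z) (x′ , y′ , z′) → ×³-≡ refl (r₅ b x x′ y y′) (r₆ q y y′ z z′))
  (λ k (x , y , z) → ×³-≡ refl (r₇ k b x y) (r₈ k q y z))
  where
    r₁ : ∀ b x y → y - b * x + b * x ≡ y
    r₁ = solve-∀
    r₂ : ∀ q x z → q * x + (z - q * x) ≡ z
    r₂ = solve-∀
    r₃ : ∀ b x y → x + b * y - b * y ≡ x
    r₃ = solve-∀
    r₄ : ∀ q y z → q * y + z - q * y ≡ z
    r₄ = solve-∀
    r₅ : ∀ b x x′ y y′ → x + x′ + b * (y + y′) ≡ x + b * y + (x′ + b * y′)
    r₅ = solve-∀
    r₆ : ∀ q y y′ z z′ → q * (y + y′) + (z + z′) ≡ q * y + z + (q * y′ + z′)
    r₆ = solve-∀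
    r₇ : ∀ k b x y → k * x + b * (k * y) ≡ k * (x + b * y)
    r₇ = solve-∀
    r₈ : ∀ k q y z → q * (k * y) + k * z ≡ k * (q * y + z)
    r₈ = solve-∀

-- The facets opposite to `v₀` and `v₂` need (0, m, n) as transversal basis vector, where (m, n)
-- completes (b, q) to a basis of ℤ². Such a pair exists because b is invertible modulo q.
module FacetCharts (b q m n : ℤ) (bn-qm : b * n - q * m ≡ 1ℤ) where

  private
    unit : ∀ x → (b * n - q * m) * x ≡ x
    unit x = trans (cong (_* x) bn-qm) (ℤ.*-identityˡ x)

  private
    solve₁ : ∀ b q m n y z → b * (n * y - m * z) + m * (- q * y + b * z) ≡ (b * n - q * m) * y
    solve₁ = solve-∀
    solve₂ : ∀ b q m n y z → q * (n * y - m * z) + n * (- q * y + b * z) ≡ (b * n - q * m) * z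
    solve₂ = solve-∀
    solve₃ : ∀ b q m n y z → n * (b * y + m * z) - m * (q * y + n * z) ≡ (b * n - q * m) * y
    solve₃ = solve-∀
    solve₄ : ∀ b q m n y z → - q * (b * y + m * z) + b * (q * y + n * z) ≡ (b * n - q * m) * z
    solve₄ = solve-∀
    add₂ : ∀ b m y y′ z z′ → b * (y + y′) + m * (z + z′) ≡ b * y + m * z + (b * y′ + m * z′)
    add₂ = solve-∀
    scale₂ : ∀ k b m y z → b * (k * y) + m * (k * z) ≡ k * (b * y + m * z)
    scale₂ = solve-∀

  chart₀ : Chart
  chart₀ = chart (λ (x , y , z) → - x , x + (b * y + m * z) , q * y + n * z)
    (λ (x , y , z) → - x , n * (x + y) - m * z , - q * (x + y) + b * z)
    (λ (x , y , z) → ×³-≡ (ℤ.neg-involutive x)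
      (trans (cong (λ w → - x + w) (trans (solve₁ b q m n (x + y) z) (unit (x + y)))) (r₁ x y)) (trans (solve₂ b q m n (x + y) z) (unit z)))
    (λ (x , y , z) → ×³-≡ (ℤ.neg-involutive x)
      (trans (cong (λ w → n * w - m * (q * y + n * z)) (r₂ x (b * y + m * z))) (trans (solve₃ b q m n y z) (unit y)))
      (trans (cong (λ w → - q * w + b * (q * y + n * z)) (r₂ x (b * y + m * z))) (trans (solve₄ b q m n y z) (unit z))))
    (λ (x , y , z) (x′ , y′ , z′) → ×³-≡ (ℤ.neg-distrib-+ x x′)
      (trans (cong (λ w → x + x′ + w) (add₂ b m y y′ z z′)) (r₃ x x′ (b * y + m * z) (b * y′ + m * z′))) (add₂ q n y y′ z z′))
    (λ k (x , y , z) → ×³-≡ (r₄ k x) (trans (cong (λ w → k * x + w) (scale₂ k b m y z)) (sym (ℤ.*-distribˡ-+ k x (b * y + m * z)))) (scale₂ k q n y z))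
    where
      r₁ : ∀ x y → - x + (x + y) ≡ y
      r₁ = solve-∀
      r₂ : ∀ x y → - x + (x + y) ≡ y
      r₂ = solve-∀
      r₃ : ∀ x x′ u v → x + x′ + (u + v) ≡ x + u + (x′ + v)
      r₃ = solve-∀
      r₄ : ∀ k x → - (k * x) ≡ k * (- x)
      r₄ = solve-∀

  chart₂ : Chart
  chart₂ = chart (λ (x , y , z) → x + y , b * y + m * z , q * y + n * z)
    (λ (x , y , z) → x - (n * y - m * z) , n * y - m * z , - q * y + b * z)
    (λ (x , y , z) → ×³-≡ (r₁ x (n * y - m * z)) (trans (solve₁ b q m n y z) (unit y)) (trans (solve₂ b q m n y z) (unit z)))
    (λ (x , y , z) → let e = trans (solve₃ b q m n y z) (unit y) in
      ×³-≡ (trans (cong (λ w → x + y - w) e) (r₂ x y)) e (trans (solve₄ b q m n y z) (unit z)))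
    (λ (x , y , z) (x′ , y′ , z′) → ×³-≡ (r₃ x x′ y y′) (add₂ b m y y′ z z′) (add₂ q n y y′ z z′))
    (λ k (x , y , z) → ×³-≡ (sym (ℤ.*-distribˡ-+ k x y)) (scale₂ k b m y z) (scale₂ k q n y z))
    where
      r₁ : ∀ x y → x - y + y ≡ x
      r₁ = solve-∀
      r₂ : ∀ x y → x + y - y ≡ x
      r₂ = solve-∀
      r₃ : ∀ x x′ y y′ → x + x′ + (y + y′) ≡ x + y + (x′ + y′)
      r₃ = solve-∀

-- These are the `from` maps of the charts, written out so that the tests evaluate without the proof
-- of b n - q m = 1. The third component is the height over the facet.
facet₁ : ℤ → ℤ → ℤ³ → ℤ³
facet₁ b q (x , y , z) = y - b * x , x , z - q * x

facet₀ facet₂ : ℤ → ℤ → ℤ → ℤ → ℤ³ → ℤ³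
facet₀ b q m n (x , y , z) = - x , n * (x + y) - m * z , - q * (x + y) + b * z
facet₂ b q m n (x , y , z) = x - (n * y - m * z) , n * y - m * z , - q * y + b * z

module _ {b q : ℤ} {T′ : ℤ³ → Set} where
  private
    S = Vert 1ℤ b q
    at : ∀ {u v} → S v → v ≡ u → S u
    at s eq = subst S eq s

  triple₃ : ∀ {s c} → T′ s → T′ (s +ᵥ c) → T (facet-test c) → Triple S T′
  triple₃ Ts Ts′ t = facet-triple identity-chart e₀ v₀ v₁ v₂ Ts Ts′ (facet-test-sound _ t)

  triple₁ : ∀ {s c} → T′ s → T′ (s +ᵥ c) → T (facet-test (facet₁ b q c)) → Triple S T′
  triple₁ Ts Ts′ t = facet-triple (chart₁ b q) e₀
    (at v₀ (×³-≡ refl (r b) (r′ q))) (at v₂ (×³-≡ refl (r″ b) (r′ q))) (at v₃ (×³-≡ refl (r₃ b) (r₄ q))) Ts Ts′ (facet-test-sound _ t)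
    where
      r : ∀ b → 0ℤ ≡ 0ℤ + (0ℤ + b * 0ℤ)
      r = solve-∀
      r′ : ∀ q → 0ℤ ≡ 0ℤ + (q * 0ℤ + 0ℤ)
      r′ = solve-∀
      r″ : ∀ b → 1ℤ ≡ 0ℤ + (1ℤ + b * 0ℤ)
      r″ = solve-∀
      r₃ : ∀ b → b ≡ 0ℤ + (0ℤ + b * 1ℤ)
      r₃ = solve-∀
      r₄ : ∀ q → q ≡ 0ℤ + (q * 1ℤ + 0ℤ)
      r₄ = solve-∀

  module _ {m n : ℤ} (bn-qm : b * n - q * m ≡ 1ℤ) where
    open FacetCharts b q m n bn-qm

    triple₀ : ∀ {s c} → T′ s → T′ (s +ᵥ c) → T (facet-test (facet₀ b q m n c)) → Triple S T′
    triple₀ Ts Ts′ t = facet-triple chart₀ e₁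
      (at v₁ (×³-≡ refl (r b m) (r′ q n))) (at v₂ (×³-≡ refl (r″ b m) (r′ q n))) (at v₃ (×³-≡ refl (r₃ b m) (r₄ q n))) Ts Ts′ (facet-test-sound _ t)
      where
        r : ∀ b m → 0ℤ ≡ 0ℤ + (0ℤ + (b * 0ℤ + m * 0ℤ))
        r = solve-∀
        r′ : ∀ q n → 0ℤ ≡ 0ℤ + (q * 0ℤ + n * 0ℤ)
        r′ = solve-∀
        r″ : ∀ b m → 1ℤ ≡ 0ℤ + (1ℤ + (b * 0ℤ + m * 0ℤ))
        r″ = solve-∀
        r₃ : ∀ b m → b ≡ 0ℤ + (0ℤ + (b * 1ℤ + m * 0ℤ))
        r₃ = solve-∀
        r₄ : ∀ q n → q ≡ 0ℤ + (q * 1ℤ + n * 0ℤ)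
        r₄ = solve-∀

    triple₂ : ∀ {s c} → T′ s → T′ (s +ᵥ c) → T (facet-test (facet₂ b q m n c)) → Triple S T′
    triple₂ Ts Ts′ t = facet-triple chart₂ e₀
      (at v₀ (×³-≡ refl (r b m) (r q n))) (at v₁ (×³-≡ refl (r b m) (r q n))) (at v₃ (×³-≡ refl (r₃ b m) (r₃ q n))) Ts Ts′ (facet-test-sound _ t)
      where
        r : ∀ b m → 0ℤ ≡ 0ℤ + (b * 0ℤ + m * 0ℤ)
        r = solve-∀
        r₃ : ∀ q n → q ≡ 0ℤ + (q * 1ℤ + n * 0ℤ)
        r₃ = solve-∀

even : ℤ³ → Bool
even (x , y , z) = (x ℤ.%ℕ 2 ℕ.≡ᵇ 0) ∧ (y ℤ.%ℕ 2 ℕ.≡ᵇ 0) ∧ (z ℤ.%ℕ 2 ℕ.≡ᵇ 0)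

even-sound : ∀ c → T (even c) → ∃ λ v → c ≡ + 2 *ᵥ v
even-sound (x , y , z) t =
  let (tx , tyz) = ∧-sound {x ℤ.%ℕ 2 ℕ.≡ᵇ 0} t
      (ty , tz) = ∧-sound {y ℤ.%ℕ 2 ℕ.≡ᵇ 0} tyz
  in (x ℤ./ℕ 2 , y ℤ./ℕ 2 , z ℤ./ℕ 2) , ×³-≡ (half x tx) (half y ty) (half z tz)
  where
    half : ∀ x → T (x ℤ.%ℕ 2 ℕ.≡ᵇ 0) → x ≡ + 2 * (x ℤ./ℕ 2)
    half x t = trans (sym (residue-form 2 x)) (trans (cong (λ r → + r + (x ℤ./ℕ 2) * + 2) (ℕ.≡ᵇ⇒≡ (x ℤ.%ℕ 2) 0 t))
      (trans (ℤ.+-identityˡ ((x ℤ./ℕ 2) * + 2)) (ℤ.*-comm (x ℤ./ℕ 2) (+ 2))))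

reject : ℤ → ℤ → ℤ → ℤ → ℤ³ → Bool
reject b q m n c = facet-test c ∨ facet-test (facet₁ b q c) ∨ facet-test (facet₀ b q m n c) ∨ facet-test (facet₂ b q m n c) ∨ even c

reject-sound : ∀ {b q m n T′ s c} → b * n - q * m ≡ 1ℤ → c ≢ e₀ → T′ s → T′ (s +ᵥ c) → T (reject b q m n c) → Triple (Vert 1ℤ b q) T′
reject-sound {b} {q} {m} {n} {T′} {s} {c} bn-qm c≢0 Ts Ts′ t = [ triple₃ Ts Ts′ , (λ t → [ triple₁ {b} {q} Ts Ts′ , (λ t →
  [ triple₀ {b} {q} bn-qm Ts Ts′ , (λ t → [ triple₂ {b} {q} bn-qm Ts Ts′ , (λ t → shrink (even-sound c t)) ]′
  (∨-sound {facet-test (facet₂ b q m n c)} t)) ]′ (∨-sound {facet-test (facet₀ b q m n c)} t)) ]′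
  (∨-sound {facet-test (facet₁ b q c)} t)) ]′ (∨-sound {facet-test c} t)
  where
    shrink : _ → Triple (Vert 1ℤ b q) T′
    shrink (v , c≡) = multiple-triple {v = v} (+ 2) v₀ v₁ Ts Ts′ (cong (s +ᵥ_) c≡) ℤ.≤-refl
      (λ v≡0 → c≢0 (trans c≡ (cong (+ 2 *ᵥ_) v≡0))) (λ ())

-- The heights over the facets opposite to v₃ and v₁ differ by q times the first coordinate.
heights-bound : ∀ {b q c} → ¬ T (facet-test c) → ¬ T (facet-test (facet₁ b q c)) → ∣ q * π₁ c ∣ ℕ.≤ 34
heights-bound {b} {q} {x , y , z} ¬t₃ ¬t₁ = subst (λ w → ∣ w ∣ ℕ.≤ 34) (ring q x z)
  (ℕ.≤-trans (ℤ.∣i-j∣≤∣i∣+∣j∣ z (z - q * x)) (ℕ.+-mono-≤ (facet-test-height (x , y , z) ¬t₃) (facet-test-height (facet₁ b q (x , y , z)) ¬t₁)))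
  where
    ring : ∀ q x z → z - (z - q * x) ≡ q * x
    ring = solve-∀

-- The finite search and its certificates

all-of : ∀ {A : Set} → (A → Bool) → List A → Bool
all-of p [] = true
all-of p (x ∷ xs) = p x ∧ all-of p xs

any-of : ∀ {A : Set} → (A → Bool) → List A → Bool
any-of p [] = false
any-of p (x ∷ xs) = p x ∨ any-of p xs

keep : ∀ {A : Set} → (A → Bool) → List A → List A
keep p [] = []
keep p (x ∷ xs) = if p x then x ∷ keep p xs else keep p xs

each : (Bool → Bool) → Bool
each p = p false ∧ p true

nonneg : ℤ → Bool
nonneg (+ _) = true
nonneg -[1+ _ ] = false

is-zero : ℤ³ → Bool
is-zero (+ 0 , + 0 , + 0) = true
is-zero _ = false

infix 4 _≡ⱽ_
_≡ⱽ_ : ℤ³ → ℤ³ → Bool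
u ≡ⱽ v = is-zero (u -ℤ³ v)

_≡ᴸ_ : List ℤ³ → List ℤ³ → Bool
[] ≡ᴸ [] = true
(u ∷ us) ≡ᴸ (v ∷ vs) = (u ≡ⱽ v) ∧ (us ≡ᴸ vs)
_ ≡ᴸ _ = false

-- A linear functional: when the vertices of the second tetrahedron are sorted by `key`, all edge
-- vectors taken in this order have nonnegative key, so one orientation of each is searched. The
-- coefficient of z dominates on the box.
key : ℤ³ → ℤ
key (x , y , z) = + 10000 * z + + 100 * x + y

within : ℕ → ℤ → Bool
within n i = ∣ i ∣ ≤ᵇ n

range : ℕ → List ℤ
range n = List.map +_ (upTo (suc n)) ++ List.map -[1+_] (upTo n)

-- Three segments a, b, c from x inside P + conv (0 ∷ shape).
record Cert : Set where
  constructor cert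
  field
    shape : List ℤ³
    x a b c : ℤ³

record Certs : Set where
  constructor certs
  field
    for-edges for-triangles for-tetrahedra : List Cert

bad : List Cert → List ℤ³ → Bool
bad cs us = any-of (λ c → us ≡ᴸ Cert.shape c) cs

relation : ℤ³ → ℤ³ → ℤ³ → ℤ³ → Bool
relation u v w c = not (is-zero c) ∧ is-zero (lin₃ c u v w)

-- Cofactors of two coordinate rows: as coefficients they annihilate these two rows, and `relation`
-- tests the remaining one. Three choices of rows are tried because the cofactors of a single choice
-- may all vanish.
minors₁₂ minors₁₃ minors₂₃ : ℤ³ → ℤ³ → ℤ³ → ℤ³
minors₁₂ (x , y , _) (x′ , y′ , _) (x″ , y″ , _) = x′ * y″ - y′ * x″ , x″ * y - y″ * x , x * y′ - y * x′
minors₁₃ (x , _ , z) (x′ , _ , z′) (x″ , _ , z″) = x′ * z″ - z′ * x″ , x″ * z - z″ * x , x * z′ - z * x′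
minors₂₃ (_ , y , z) (_ , y′ , z′) (_ , y″ , z″) = y′ * z″ - z′ * y″ , y″ * z - z″ * y , y * z′ - z * y′

dependent : ℤ³ → ℤ³ → ℤ³ → Bool
dependent u v w = relation u v w (minors₁₂ u v w) ∨ relation u v w (minors₁₃ u v w) ∨ relation u v w (minors₂₃ u v w)

-- If |c - q x| ≤ 17, then q times the distance from x to the quotient of c by q is less than q +
-- 17; hence the radius 17 / q + 1.
around : (q : ℕ) .{{_ : ℕ.NonZero q}} → ℤ → List ℤ
around q c = List.map (λ δ → c ℤ./ℕ q + δ) (range (17 ℕ./ q ℕ.+ 1))

module Search (b : ℤ) (q′ : ℕ) .{{_ : ℕ.NonZero q′}} (m n : ℤ) where
  q = + q′

  -- The four bounded quantities are the heights over the facets of the first tetrahedron, with the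
  -- bound of `facet-test-height`.
  low : ℤ³ → Bool
  low (x , y , z) = nonneg z ∧ within 17 z ∧ within 17 (z - q * x) ∧ within 17 (- q * (x + y) + b * z) ∧ within 17 (- q * y + b * z)

  row : ℤ → ℤ → List ℤ³
  row z x = keep low (List.map (λ y → x , y , z) (around q′ (b * z)))

  box : List ℤ³
  box = concatMap (λ z → concatMap (row z) (around q′ z)) (List.map +_ (upTo 18))

  module _ (C : Certs) where
    open Certs C

    edge : ℤ³ → Bool
    edge c = nonneg (key c) ∧ not (reject b q m n c) ∧ not (bad for-edges (c ∷ []))

    -- `low` is a cheap filter that comes before the expensive `reject` hidden in `edge`.
    next : ℤ³ → ℤ³ → Bool
    next u v = low (v -ℤ³ u) ∧ edge (v -ℤ³ u) ∧ not (bad for-triangles (u ∷ v ∷ []))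

    -- The candidate tetrahedron is 0, u, v, w. Its three faces at the origin are tested through
    -- `next`; the face u, v, w is tested here, moved to the origin by -u.
    excluded : ℤ³ → ℤ³ → ℤ³ → Bool
    excluded u v w = not (next v w) ∨ bad for-triangles (v -ℤ³ u ∷ w -ℤ³ u ∷ []) ∨ dependent u v w ∨ bad for-tetrahedra (u ∷ v ∷ w ∷ [])

    -- The lists are passed as arguments to be evaluated only once.
    check-third : ℤ³ → List ℤ³ → Bool
    check-third u vs = all-of (λ v → all-of (excluded u v) vs) vs

    check-second : List ℤ³ → Bool
    check-second us = all-of (λ u → check-third u (keep (next u) us)) us

    check : Bool
    check = check-second (keep edge box)

  -- Signs of the barycentric numerators, over the denominator `q`, of a point in the D-fold
  -- dilation of the tetrahedron 0, e₁, e₂, (1, b, q).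
  inside : ℤ → ℤ³ → Bool
  inside D (x , y , z) = nonneg z ∧ nonneg (q * x - z) ∧ nonneg (q * y - b * z) ∧
    nonneg (q * D - (q * x - z) - (q * y - b * z) - z)

  -- Distributes t units of weight over the points of us.
  place place-at : ℤ → List ℤ³ → ℕ → ℤ³ → Bool
  -- The `t` units left over go to the origin, the vertex of the shape that is not listed.
  place D [] t r = inside D r
  place D (u ∷ us) t r = place-at D (u ∷ us) t r
  place-at D [] t r = false
  place-at D (u ∷ us) zero r = place D us 0 r
  place-at D (u ∷ us) (suc t) r = place D us (suc t) r ∨ place-at D (u ∷ us) t (r -ℤ³ u)

  -- `D` is the denominator of the weights on the second polytope. Denominators up to 11 suffice for
  -- every certificate in the table.
  covers : List ℤ³ → ℤ³ → Bool
  covers us z = any-of (λ D → place (+ suc D) us (suc D) (+ suc D *ᵥ z)) (upTo 11)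

  valid : Cert → Bool
  valid (cert us x a b c) = not (is-zero a) ∧ not (is-zero b) ∧ not (is-zero c) ∧
    each λ i → each λ j → each λ k → covers us (x +ᵥ bit i a +ᵥ bit j b +ᵥ bit k c)

  all-valid : Certs → Bool
  all-valid (certs es ts qs) = all-of valid es ∧ all-of valid ts ∧ all-of valid qs

-- The arguments are q and b. The entries carry no proof, as `all-valid` re-checks each of them. For
-- the pairs with empty lists the tests on single edges and on linear dependence already exclude
-- everything.
certificates : ℕ → ℕ → Certs
certificates 3 1 = certs
  ( cert ((- + 5 , + 2 , + 1) ∷ []) (- + 4 , + 2 , + 1) (+ 1 , + 0 , + 1) (+ 1 , + 0 , + 1) (+ 3 , - + 1 , + 0)
  ∷ cert ((- + 3 , + 2 , + 1) ∷ []) (- + 3 , + 2 , + 1) (+ 1 , + 0 , + 1) (+ 1 , + 0 , + 1) (+ 2 , - + 1 , + 0)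
  ∷ cert ((- + 3 , + 5 , + 1) ∷ []) (- + 3 , + 6 , + 1) (+ 1 , - + 1 , + 1) (+ 1 , - + 1 , + 1) (+ 2 , - + 3 , + 0)
  ∷ cert ((+ 0 , + 2 , + 1) ∷ []) (+ 1 , + 0 , + 0) (+ 0 , + 1 , + 1) (+ 0 , + 1 , + 1) (+ 0 , + 1 , + 2)
  ∷ cert ((+ 2 , - + 5 , + 1) ∷ []) (+ 0 , + 1 , + 0) (+ 1 , - + 2 , + 1) (+ 1 , - + 2 , + 1) (+ 1 , - + 1 , + 2)
  ∷ cert ((+ 2 , - + 3 , + 1) ∷ []) (+ 0 , + 0 , + 0) (+ 0 , + 1 , + 0) (+ 1 , - + 1 , + 1) (+ 1 , - + 1 , + 1)
  ∷ cert ((+ 2 , + 0 , + 1) ∷ []) (+ 0 , + 1 , + 0) (+ 1 , + 0 , + 1) (+ 1 , + 0 , + 1) (+ 1 , + 0 , + 2)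
  ∷ cert ((+ 2 , + 2 , + 1) ∷ []) (+ 0 , + 0 , + 0) (+ 1 , + 1 , + 1) (+ 1 , + 1 , + 1) (+ 1 , + 1 , + 2)
  ∷ cert ((+ 2 , + 3 , + 1) ∷ []) (+ 0 , + 0 , + 0) (+ 0 , + 1 , + 0) (+ 1 , + 1 , + 1) (+ 1 , + 1 , + 1)
  ∷ cert ((+ 2 , + 4 , + 1) ∷ []) (+ 0 , + 0 , + 0) (+ 1 , + 1 , + 2) (+ 1 , + 2 , + 1) (+ 1 , + 2 , + 1)
  ∷ cert ((+ 3 , + 2 , + 1) ∷ []) (+ 0 , + 0 , + 0) (+ 1 , + 0 , + 0) (+ 1 , + 1 , + 1) (+ 1 , + 1 , + 1)
  ∷ cert ((+ 4 , + 2 , + 1) ∷ []) (+ 0 , + 0 , + 0) (+ 1 , + 1 , + 2) (+ 2 , + 1 , + 1) (+ 2 , + 1 , + 1)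
  ∷ cert ((+ 5 , - + 3 , + 1) ∷ []) (+ 1 , + 0 , + 0) (+ 1 , + 0 , + 2) (+ 2 , - + 1 , + 1) (+ 2 , - + 1 , + 1)
  ∷ cert ((- + 5 , + 2 , + 2) ∷ []) (- + 4 , + 2 , + 2) (+ 1 , + 0 , + 0) (+ 2 , - + 1 , - + 1) (+ 2 , - + 1 , - + 1)
  ∷ cert ((+ 2 , - + 5 , + 2) ∷ []) (+ 0 , + 0 , + 0) (+ 0 , + 1 , + 0) (+ 1 , - + 2 , + 1) (+ 1 , - + 2 , + 1)
  ∷ cert ((+ 2 , + 3 , + 2) ∷ []) (+ 0 , + 0 , + 0) (+ 0 , + 1 , + 0) (+ 1 , + 1 , + 1) (+ 1 , + 1 , + 1)
  ∷ cert ((+ 3 , + 2 , + 2) ∷ []) (+ 0 , + 0 , + 0) (+ 1 , + 0 , + 0) (+ 1 , + 1 , + 1) (+ 1 , + 1 , + 1)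
  ∷ cert ((- + 3 , + 2 , + 4) ∷ []) (- + 2 , + 2 , + 4) (+ 1 , - + 1 , - + 2) (+ 1 , - + 1 , - + 2) (+ 1 , + 0 , + 0)
  ∷ cert ((- + 2 , + 3 , + 4) ∷ []) (- + 2 , + 3 , + 4) (+ 1 , - + 1 , - + 2) (+ 1 , - + 1 , - + 1) (+ 1 , - + 1 , - + 1)
  ∷ cert ((- + 2 , + 5 , + 4) ∷ []) (- + 2 , + 6 , + 4) (+ 1 , - + 2 , - + 1) (+ 1 , - + 2 , - + 1) (+ 1 , - + 1 , + 1)
  ∷ cert ((+ 2 , - + 3 , + 4) ∷ []) (+ 0 , + 0 , + 0) (+ 0 , + 1 , + 0) (+ 1 , - + 1 , + 2) (+ 1 , - + 1 , + 2)
  ∷ cert ((+ 2 , + 5 , + 4) ∷ []) (+ 0 , + 0 , + 0) (+ 0 , + 1 , + 0) (+ 1 , + 2 , + 2) (+ 1 , + 2 , + 2)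
  ∷ cert ((+ 3 , - + 2 , + 4) ∷ []) (+ 0 , + 0 , + 0) (+ 1 , + 0 , + 2) (+ 1 , + 0 , + 2) (+ 2 , - + 1 , + 3)
  ∷ cert ((+ 5 , - + 2 , + 4) ∷ []) (+ 1 , + 0 , + 0) (+ 1 , + 0 , + 2) (+ 1 , + 0 , + 2) (+ 3 , - + 1 , + 3)
  ∷ cert ((+ 5 , + 2 , + 4) ∷ []) (+ 0 , + 0 , + 0) (+ 1 , + 0 , + 0) (+ 2 , + 1 , + 2) (+ 2 , + 1 , + 2)
  ∷ cert ((- + 4 , + 2 , + 5) ∷ []) (- + 4 , + 3 , + 5) (+ 1 , - + 1 , - + 1) (+ 2 , - + 1 , - + 2) (+ 2 , - + 1 , - + 2)
  ∷ cert ((- + 3 , + 2 , + 5) ∷ []) (- + 2 , + 2 , + 4) (+ 1 , - + 1 , - + 2) (+ 1 , - + 1 , - + 2) (+ 1 , + 0 , + 0)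
  ∷ cert ((- + 3 , + 5 , + 5) ∷ []) (- + 3 , + 5 , + 5) (+ 1 , - + 1 , - + 1) (+ 1 , - + 1 , - + 1) (+ 2 , - + 3 , - + 3)
  ∷ cert ((- + 2 , + 2 , + 5) ∷ []) (- + 2 , + 3 , + 5) (+ 1 , - + 1 , - + 2) (+ 1 , - + 1 , - + 2) (+ 1 , - + 1 , - + 1)
  ∷ cert ((- + 2 , + 5 , + 5) ∷ []) (- + 2 , + 5 , + 5) (+ 1 , - + 2 , - + 2) (+ 1 , - + 2 , - + 2) (+ 1 , - + 1 , - + 1)
  ∷ cert ((+ 0 , + 2 , + 5) ∷ []) (+ 0 , + 0 , + 0) (+ 0 , + 1 , + 1) (+ 0 , + 1 , + 2) (+ 0 , + 1 , + 2)
  ∷ cert ((+ 2 , - + 4 , + 5) ∷ []) (+ 0 , + 1 , + 0) (+ 1 , - + 2 , + 2) (+ 1 , - + 2 , + 2) (+ 1 , - + 1 , + 1)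
  ∷ cert ((+ 2 , - + 3 , + 5) ∷ []) (+ 0 , + 0 , + 0) (+ 0 , + 1 , + 0) (+ 1 , - + 1 , + 2) (+ 1 , - + 1 , + 2)
  ∷ cert ((+ 2 , - + 2 , + 5) ∷ []) (+ 0 , + 1 , + 0) (+ 1 , - + 1 , + 1) (+ 1 , - + 1 , + 2) (+ 1 , - + 1 , + 2)
  ∷ cert ((+ 2 , + 0 , + 5) ∷ []) (+ 0 , + 0 , + 0) (+ 1 , + 0 , + 1) (+ 1 , + 0 , + 2) (+ 1 , + 0 , + 2)
  ∷ cert ((+ 2 , + 3 , + 5) ∷ []) (+ 0 , + 0 , + 0) (+ 0 , + 1 , + 0) (+ 1 , + 1 , + 2) (+ 1 , + 1 , + 2)
  ∷ cert ((+ 2 , + 5 , + 5) ∷ []) (+ 0 , + 0 , + 0) (+ 1 , + 1 , + 1) (+ 1 , + 2 , + 2) (+ 1 , + 2 , + 2)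
  ∷ cert ((+ 3 , + 2 , + 5) ∷ []) (+ 0 , + 0 , + 0) (+ 1 , + 0 , + 0) (+ 1 , + 1 , + 2) (+ 1 , + 1 , + 2)
  ∷ cert ((+ 5 , - + 3 , + 5) ∷ []) (+ 0 , + 0 , + 0) (+ 1 , + 0 , + 1) (+ 2 , - + 1 , + 2) (+ 2 , - + 1 , + 2)
  ∷ cert ((+ 5 , - + 2 , + 5) ∷ []) (+ 0 , + 0 , + 0) (+ 1 , + 0 , + 1) (+ 1 , + 0 , + 1) (+ 3 , - + 1 , + 3)
  ∷ cert ((+ 5 , + 2 , + 5) ∷ []) (+ 0 , + 0 , + 0) (+ 1 , + 1 , + 1) (+ 2 , + 1 , + 2) (+ 2 , + 1 , + 2)
  ∷ cert ((- + 2 , + 3 , + 7) ∷ []) (- + 1 , + 2 , + 4) (+ 0 , + 1 , + 3) (+ 1 , - + 1 , - + 2) (+ 1 , - + 1 , - + 2)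
  ∷ cert ((+ 3 , - + 2 , + 7) ∷ []) (+ 0 , + 1 , + 0) (+ 1 , - + 1 , + 2) (+ 1 , - + 1 , + 2) (+ 1 , + 0 , + 3)
  ∷ cert ((- + 2 , + 3 , + 8) ∷ []) (- + 1 , + 2 , + 4) (+ 0 , + 1 , + 3) (+ 1 , - + 1 , - + 2) (+ 1 , - + 1 , - + 2)
  ∷ cert ((+ 3 , - + 2 , + 8) ∷ []) (+ 0 , + 1 , + 0) (+ 1 , - + 1 , + 2) (+ 1 , - + 1 , + 2) (+ 1 , + 0 , + 3)
  ∷ cert ((- + 2 , + 5 , + 10) ∷ []) (- + 2 , + 5 , + 10) (+ 1 , - + 2 , - + 4) (+ 1 , - + 2 , - + 4) (+ 1 , - + 1 , - + 2)
  ∷ cert ((+ 2 , + 3 , + 10) ∷ []) (+ 0 , + 1 , + 0) (+ 1 , + 0 , + 2) (+ 1 , + 1 , + 4) (+ 1 , + 1 , + 4)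
  ∷ cert ((+ 2 , + 5 , + 10) ∷ []) (+ 0 , + 0 , + 0) (+ 1 , + 1 , + 2) (+ 1 , + 2 , + 4) (+ 1 , + 2 , + 4)
  ∷ cert ((+ 3 , + 2 , + 10) ∷ []) (+ 0 , + 1 , + 0) (+ 1 , + 0 , + 2) (+ 1 , + 0 , + 2) (+ 2 , + 1 , + 6)
  ∷ cert ((+ 3 , + 5 , + 10) ∷ []) (+ 0 , + 0 , + 0) (+ 1 , + 1 , + 2) (+ 1 , + 1 , + 2) (+ 2 , + 3 , + 6)
  ∷ cert ((+ 5 , - + 2 , + 10) ∷ []) (+ 0 , + 0 , + 0) (+ 1 , + 0 , + 2) (+ 1 , + 0 , + 2) (+ 3 , - + 1 , + 6)
  ∷ cert ((+ 5 , + 2 , + 10) ∷ []) (+ 0 , + 0 , + 0) (+ 1 , + 1 , + 2) (+ 2 , + 1 , + 4) (+ 2 , + 1 , + 4)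
  ∷ cert ((+ 5 , + 3 , + 10) ∷ []) (+ 0 , + 0 , + 0) (+ 1 , + 1 , + 2) (+ 1 , + 1 , + 2) (+ 3 , + 2 , + 6)
  ∷ cert ((- + 2 , + 4 , + 11) ∷ []) (- + 2 , + 5 , + 11) (+ 1 , - + 2 , - + 5) (+ 1 , - + 2 , - + 5) (+ 1 , - + 1 , - + 1)
  ∷ cert ((- + 2 , + 5 , + 11) ∷ []) (- + 1 , + 4 , + 8) (+ 0 , + 1 , + 3) (+ 1 , - + 2 , - + 4) (+ 1 , - + 2 , - + 4)
  ∷ cert ((+ 2 , + 2 , + 11) ∷ []) (+ 0 , + 0 , + 0) (+ 1 , + 1 , + 4) (+ 1 , + 1 , + 5) (+ 1 , + 1 , + 5)
  ∷ cert ((+ 2 , + 5 , + 11) ∷ []) (+ 0 , + 1 , + 0) (+ 1 , + 1 , + 4) (+ 1 , + 2 , + 5) (+ 1 , + 2 , + 5)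
  ∷ cert ((+ 4 , - + 2 , + 11) ∷ []) (+ 0 , + 1 , + 0) (+ 1 , - + 1 , + 1) (+ 2 , - + 1 , + 5) (+ 2 , - + 1 , + 5)
  ∷ cert ((+ 5 , - + 2 , + 11) ∷ []) (+ 0 , + 1 , + 0) (+ 1 , + 0 , + 3) (+ 2 , - + 1 , + 4) (+ 2 , - + 1 , + 4)
  ∷ cert ((+ 5 , + 2 , + 11) ∷ []) (+ 1 , + 0 , + 0) (+ 1 , + 1 , + 4) (+ 2 , + 1 , + 5) (+ 2 , + 1 , + 5)
  ∷ cert ((+ 2 , + 3 , + 13) ∷ []) (+ 1 , + 1 , + 3) (+ 0 , + 1 , + 3) (+ 1 , + 1 , + 5) (+ 1 , + 1 , + 5)
  ∷ cert ((+ 3 , + 2 , + 13) ∷ []) (+ 1 , + 1 , + 3) (+ 1 , + 0 , + 3) (+ 1 , + 1 , + 5) (+ 1 , + 1 , + 5)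
  ∷ cert ((+ 2 , + 3 , + 14) ∷ []) (+ 1 , + 1 , + 4) (+ 0 , + 1 , + 3) (+ 1 , + 1 , + 5) (+ 1 , + 1 , + 5)
  ∷ cert ((+ 3 , + 2 , + 14) ∷ []) (+ 1 , + 1 , + 4) (+ 1 , + 0 , + 3) (+ 1 , + 1 , + 5) (+ 1 , + 1 , + 5)
  ∷ cert ((+ 3 , + 5 , + 14) ∷ []) (+ 0 , + 1 , + 0) (+ 1 , + 1 , + 4) (+ 1 , + 1 , + 4) (+ 2 , + 3 , + 9)
  ∷ cert ((+ 5 , + 3 , + 14) ∷ []) (+ 1 , + 0 , + 0) (+ 1 , + 1 , + 4) (+ 1 , + 1 , + 4) (+ 3 , + 2 , + 9)
  ∷ cert ((+ 2 , + 5 , + 16) ∷ []) (+ 0 , + 1 , + 0) (+ 1 , + 1 , + 5) (+ 1 , + 2 , + 7) (+ 1 , + 2 , + 7)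
  ∷ cert ((+ 5 , + 2 , + 16) ∷ []) (+ 1 , + 0 , + 0) (+ 1 , + 1 , + 5) (+ 2 , + 1 , + 7) (+ 2 , + 1 , + 7)
  ∷ cert ((+ 2 , + 4 , + 17) ∷ []) (+ 0 , + 0 , + 0) (+ 1 , + 1 , + 4) (+ 1 , + 2 , + 8) (+ 1 , + 2 , + 8)
  ∷ cert ((+ 2 , + 5 , + 17) ∷ []) (+ 1 , + 1 , + 3) (+ 0 , + 1 , + 3) (+ 1 , + 2 , + 7) (+ 1 , + 2 , + 7)
  ∷ cert ((+ 4 , + 2 , + 17) ∷ []) (+ 0 , + 0 , + 0) (+ 1 , + 1 , + 4) (+ 2 , + 1 , + 8) (+ 2 , + 1 , + 8)
  ∷ cert ((+ 5 , + 2 , + 17) ∷ []) (+ 1 , + 1 , + 3) (+ 1 , + 0 , + 3) (+ 2 , + 1 , + 7) (+ 2 , + 1 , + 7)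
  ∷ [])
  ( cert ((+ 1 , - + 1 , + 0) ∷ (+ 1 , + 0 , + 1) ∷ []) (+ 1 , + 1 , + 1) (+ 0 , + 0 , + 1) (+ 0 , + 0 , + 1) (+ 1 , - + 1 , + 0)
  ∷ cert ((+ 0 , + 1 , + 2) ∷ (+ 1 , + 0 , + 2) ∷ []) (+ 0 , + 1 , + 0) (+ 0 , + 0 , + 1) (+ 0 , + 0 , + 1) (+ 1 , - + 1 , + 0)
  ∷ cert ((+ 0 , + 1 , + 2) ∷ (+ 1 , + 1 , + 3) ∷ []) (+ 0 , + 1 , + 0) (+ 0 , + 0 , + 1) (+ 0 , + 0 , + 1) (+ 1 , + 1 , + 3)
  ∷ cert ((+ 1 , + 0 , + 2) ∷ (+ 1 , + 1 , + 3) ∷ []) (+ 1 , + 0 , + 0) (+ 0 , + 0 , + 1) (+ 0 , + 0 , + 1) (+ 1 , + 1 , + 3)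
  ∷ cert ((+ 1 , - + 1 , + 0) ∷ (+ 0 , + 1 , + 2) ∷ []) (+ 0 , + 0 , + 0) (+ 0 , + 1 , + 1) (+ 0 , + 1 , + 1) (+ 1 , - + 1 , + 0)
  ∷ cert ((+ 1 , - + 1 , + 0) ∷ (+ 2 , - + 1 , + 2) ∷ []) (+ 0 , + 0 , + 0) (+ 1 , - + 1 , + 0) (+ 1 , + 0 , + 1) (+ 1 , + 0 , + 1)
  ∷ cert ((+ 1 , + 0 , + 2) ∷ (+ 2 , + 1 , + 5) ∷ []) (+ 0 , + 0 , + 0) (+ 1 , + 0 , + 1) (+ 1 , + 0 , + 1) (+ 1 , + 1 , + 3)
  ∷ cert ((- + 1 , + 2 , + 2) ∷ (+ 0 , + 1 , + 2) ∷ []) (+ 0 , + 1 , + 0) (+ 0 , + 1 , + 2) (+ 0 , + 1 , + 3) (+ 1 , - + 1 , + 0)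
  ∷ cert ((+ 1 , + 0 , + 2) ∷ (+ 2 , - + 1 , + 2) ∷ []) (+ 0 , + 1 , + 0) (+ 1 , - + 1 , + 0) (+ 1 , + 0 , + 2) (+ 1 , + 0 , + 3)
  ∷ cert ((+ 0 , + 1 , + 1) ∷ (+ 1 , + 2 , + 4) ∷ []) (+ 0 , + 0 , + 0) (+ 0 , + 1 , + 0) (+ 0 , + 1 , + 1) (+ 1 , + 1 , + 3)
  ∷ cert ((+ 1 , + 1 , + 3) ∷ (+ 2 , + 1 , + 5) ∷ []) (+ 0 , + 1 , + 0) (+ 1 , + 0 , + 2) (+ 1 , + 0 , + 3) (+ 1 , + 1 , + 3)
  ∷ cert ((+ 1 , + 1 , + 3) ∷ (+ 1 , + 2 , + 4) ∷ []) (+ 1 , + 0 , + 0) (+ 0 , + 1 , + 2) (+ 0 , + 1 , + 2) (+ 1 , + 1 , + 3)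
  ∷ cert ((+ 1 , - + 1 , + 0) ∷ (+ 0 , + 1 , + 1) ∷ []) (+ 0 , + 0 , + 0) (+ 0 , + 1 , + 0) (+ 0 , + 1 , + 1) (+ 1 , - + 1 , + 0)
  ∷ cert ((+ 1 , - + 1 , + 0) ∷ (+ 2 , - + 1 , + 1) ∷ []) (+ 0 , + 0 , + 0) (+ 1 , - + 1 , + 0) (+ 1 , + 0 , + 0) (+ 1 , + 0 , + 1)
  ∷ cert ((+ 1 , + 0 , + 1) ∷ (+ 2 , + 1 , + 4) ∷ []) (+ 0 , + 0 , + 0) (+ 1 , + 0 , + 0) (+ 1 , + 0 , + 1) (+ 1 , + 1 , + 3)
  ∷ cert ((+ 1 , + 1 , + 3) ∷ (+ 1 , + 2 , + 5) ∷ []) (+ 1 , + 0 , + 0) (+ 0 , + 1 , + 2) (+ 0 , + 1 , + 3) (+ 1 , + 1 , + 3)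
  ∷ cert ((+ 1 , - + 1 , + 0) ∷ (+ 2 , + 1 , + 4) ∷ []) (+ 0 , + 0 , + 0) (+ 1 , - + 1 , + 0) (+ 1 , + 1 , + 2) (+ 1 , + 1 , + 2)
  ∷ cert ((+ 1 , + 0 , + 1) ∷ (+ 2 , - + 1 , + 1) ∷ []) (+ 0 , + 1 , + 0) (+ 1 , - + 1 , + 0) (+ 1 , + 0 , + 2) (+ 1 , + 0 , + 2)
  ∷ cert ((- + 2 , + 3 , + 2) ∷ (- + 1 , + 2 , + 2) ∷ []) (- + 2 , + 3 , + 2) (+ 1 , - + 1 , - + 1) (+ 1 , - + 1 , - + 1) (+ 1 , - + 1 , + 0)
  ∷ cert ((+ 2 , - + 1 , + 2) ∷ (+ 1 , + 1 , + 3) ∷ []) (+ 0 , + 1 , + 0) (+ 1 , - + 1 , + 1) (+ 1 , - + 1 , + 1) (+ 1 , + 1 , + 3)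
  ∷ cert ((+ 1 , + 1 , + 3) ∷ (+ 3 , + 2 , + 8) ∷ []) (+ 1 , + 0 , + 0) (+ 1 , + 1 , + 3) (+ 1 , + 1 , + 4) (+ 1 , + 1 , + 4)
  ∷ cert ((+ 0 , + 1 , + 2) ∷ (+ 1 , + 2 , + 5) ∷ []) (+ 0 , + 0 , + 0) (+ 0 , + 1 , + 1) (+ 0 , + 1 , + 1) (+ 1 , + 1 , + 3)
  ∷ cert ((+ 1 , - + 1 , + 0) ∷ (+ 3 , + 2 , + 7) ∷ []) (+ 1 , + 1 , + 3) (+ 1 , - + 1 , + 0) (+ 1 , + 1 , + 2) (+ 1 , + 1 , + 2)
  ∷ cert ((- + 2 , + 3 , + 2) ∷ (+ 1 , + 1 , + 3) ∷ []) (- + 2 , + 3 , + 2) (+ 1 , - + 1 , - + 1) (+ 1 , - + 1 , - + 1) (+ 1 , + 1 , + 3)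
  ∷ cert ((- + 1 , + 2 , + 2) ∷ (+ 1 , + 1 , + 3) ∷ []) (- + 1 , + 2 , + 2) (+ 1 , - + 1 , - + 1) (+ 1 , - + 1 , - + 1) (+ 1 , + 1 , + 3)
  ∷ cert ((- + 1 , + 2 , + 1) ∷ (+ 0 , + 1 , + 1) ∷ []) (+ 0 , + 1 , + 0) (+ 0 , + 1 , + 2) (+ 0 , + 1 , + 2) (+ 1 , - + 1 , + 0)
  ∷ cert ((+ 3 , - + 2 , + 2) ∷ (+ 1 , + 1 , + 3) ∷ []) (+ 1 , + 0 , + 0) (+ 1 , - + 1 , + 1) (+ 1 , - + 1 , + 1) (+ 1 , + 1 , + 3)
  ∷ cert ((+ 1 , + 1 , + 3) ∷ (+ 2 , + 1 , + 4) ∷ []) (+ 0 , + 1 , + 0) (+ 1 , + 0 , + 2) (+ 1 , + 0 , + 2) (+ 1 , + 1 , + 3)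
  ∷ cert ((+ 1 , + 2 , + 5) ∷ (+ 2 , + 1 , + 5) ∷ []) (+ 0 , + 1 , + 0) (+ 1 , - + 1 , + 0) (+ 1 , + 1 , + 4) (+ 1 , + 1 , + 4)
  ∷ cert ((+ 2 , + 3 , + 8) ∷ (+ 3 , + 2 , + 8) ∷ []) (+ 0 , + 1 , + 0) (+ 1 , - + 1 , + 0) (+ 1 , + 1 , + 4) (+ 1 , + 1 , + 4)
  ∷ cert ((+ 1 , - + 1 , + 0) ∷ (+ 2 , + 1 , + 7) ∷ []) (+ 1 , + 0 , + 0) (+ 0 , + 0 , + 1) (+ 0 , + 0 , + 1) (+ 1 , + 1 , + 5)
  ∷ cert ((- + 2 , + 1 , + 1) ∷ (- + 1 , + 2 , + 4) ∷ []) (- + 1 , + 2 , + 2) (+ 0 , + 0 , + 1) (+ 0 , + 0 , + 1) (+ 1 , - + 1 , - + 2)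
  ∷ cert ((+ 1 , - + 2 , + 1) ∷ (+ 2 , - + 1 , + 4) ∷ []) (+ 1 , + 0 , + 0) (+ 0 , + 0 , + 1) (+ 0 , + 0 , + 1) (+ 1 , - + 1 , + 2)
  ∷ cert ((+ 1 , + 2 , + 2) ∷ (+ 2 , + 1 , + 2) ∷ []) (+ 1 , + 1 , + 1) (+ 0 , + 0 , + 1) (+ 0 , + 0 , + 1) (+ 1 , + 1 , + 1)
  ∷ cert ((+ 1 , - + 1 , + 0) ∷ (- + 1 , + 2 , + 1) ∷ []) (- + 1 , + 3 , + 1) (+ 1 , - + 1 , + 0) (+ 1 , - + 1 , + 1) (+ 1 , - + 1 , + 1)
  ∷ cert ((+ 1 , - + 1 , + 0) ∷ (+ 3 , - + 2 , + 1) ∷ []) (+ 1 , + 1 , + 3) (+ 1 , - + 1 , - + 1) (+ 1 , - + 1 , - + 1) (+ 1 , - + 1 , + 0)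
  ∷ cert ((+ 2 , - + 1 , + 2) ∷ (+ 3 , - + 2 , + 2) ∷ []) (+ 0 , + 1 , + 0) (+ 1 , - + 1 , + 0) (+ 1 , - + 1 , + 1) (+ 1 , - + 1 , + 1)
  ∷ cert ((+ 1 , + 1 , + 3) ∷ (+ 2 , + 3 , + 8) ∷ []) (+ 0 , + 1 , + 0) (+ 1 , + 1 , + 3) (+ 1 , + 1 , + 4) (+ 1 , + 1 , + 4)
  ∷ cert ((+ 1 , + 2 , + 4) ∷ (+ 2 , + 3 , + 7) ∷ []) (+ 0 , + 0 , + 0) (+ 1 , + 1 , + 2) (+ 1 , + 1 , + 2) (+ 1 , + 1 , + 3)
  ∷ cert ((+ 2 , + 1 , + 4) ∷ (+ 3 , + 2 , + 7) ∷ []) (+ 0 , + 0 , + 0) (+ 1 , + 1 , + 2) (+ 1 , + 1 , + 2) (+ 1 , + 1 , + 3)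
  ∷ cert ((+ 1 , - + 1 , + 0) ∷ (- + 1 , + 1 , + 1) ∷ []) (- + 1 , + 2 , + 1) (+ 1 , - + 1 , - + 1) (+ 1 , - + 1 , + 0) (+ 1 , - + 1 , + 0)
  ∷ cert ((+ 1 , - + 1 , + 0) ∷ (+ 2 , + 1 , + 2) ∷ []) (+ 0 , + 0 , + 0) (+ 1 , - + 1 , + 0) (+ 1 , + 1 , + 1) (+ 1 , + 1 , + 1)
  ∷ cert ((+ 1 , - + 1 , + 0) ∷ (+ 2 , - + 2 , + 1) ∷ []) (+ 0 , + 1 , + 0) (+ 1 , - + 1 , + 0) (+ 1 , - + 1 , + 0) (+ 1 , - + 1 , + 1)
  ∷ cert ((+ 1 , + 1 , + 3) ∷ (- + 1 , + 2 , + 4) ∷ []) (- + 1 , + 2 , + 4) (+ 1 , - + 1 , - + 2) (+ 1 , - + 1 , - + 2) (+ 1 , + 1 , + 3)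
  ∷ cert ((+ 1 , + 1 , + 3) ∷ (+ 2 , - + 1 , + 4) ∷ []) (+ 0 , + 1 , + 0) (+ 1 , - + 1 , + 2) (+ 1 , - + 1 , + 2) (+ 1 , + 1 , + 3)
  ∷ cert ((+ 1 , + 2 , + 7) ∷ (+ 2 , + 1 , + 7) ∷ []) (+ 0 , + 1 , + 0) (+ 1 , - + 1 , + 0) (+ 1 , + 1 , + 5) (+ 1 , + 1 , + 5)
  ∷ cert ((+ 1 , + 1 , + 3) ∷ (+ 2 , + 2 , + 5) ∷ []) (+ 0 , + 0 , + 0) (+ 1 , + 1 , + 2) (+ 1 , + 1 , + 3) (+ 1 , + 1 , + 3)
  ∷ cert ((+ 1 , + 1 , + 4) ∷ (+ 2 , + 2 , + 7) ∷ []) (+ 0 , + 0 , + 0) (+ 1 , + 1 , + 3) (+ 1 , + 1 , + 3) (+ 1 , + 1 , + 4)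
  ∷ cert ((+ 1 , - + 1 , + 0) ∷ (+ 2 , + 1 , + 8) ∷ []) (+ 0 , + 0 , + 0) (+ 1 , - + 1 , + 0) (+ 1 , + 1 , + 4) (+ 1 , + 1 , + 4)
  ∷ cert ((- + 2 , + 1 , + 2) ∷ (- + 1 , + 2 , + 5) ∷ []) (- + 2 , + 2 , + 2) (+ 1 , - + 1 , - + 1) (+ 1 , - + 1 , - + 1) (+ 1 , + 1 , + 3)
  ∷ cert ((+ 1 , - + 2 , + 2) ∷ (+ 2 , - + 1 , + 5) ∷ []) (+ 0 , + 0 , + 0) (+ 1 , - + 1 , + 1) (+ 1 , - + 1 , + 1) (+ 1 , + 1 , + 3)
  ∷ cert ((+ 1 , + 2 , + 1) ∷ (+ 2 , + 1 , + 1) ∷ []) (+ 0 , + 1 , + 0) (+ 1 , - + 1 , + 0) (+ 1 , + 1 , + 2) (+ 1 , + 1 , + 2)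
  ∷ cert ((+ 1 , - + 1 , + 0) ∷ (- + 1 , + 2 , + 2) ∷ []) (+ 0 , + 1 , + 0) (+ 0 , + 1 , + 3) (+ 1 , - + 1 , + 0) (+ 1 , - + 1 , + 0)
  ∷ cert ((+ 1 , - + 1 , + 0) ∷ (+ 3 , - + 2 , + 2) ∷ []) (+ 0 , + 1 , + 0) (+ 1 , - + 1 , + 0) (+ 1 , - + 1 , + 0) (+ 1 , + 0 , + 3)
  ∷ cert ((+ 1 , - + 1 , + 0) ∷ (+ 2 , + 1 , + 5) ∷ []) (+ 0 , + 0 , + 0) (+ 1 , - + 1 , + 0) (+ 1 , + 1 , + 2) (+ 1 , + 1 , + 3)
  ∷ cert ((+ 1 , + 1 , + 3) ∷ (+ 2 , + 3 , + 7) ∷ []) (+ 0 , + 0 , + 0) (+ 0 , + 1 , + 0) (+ 1 , + 1 , + 3) (+ 1 , + 1 , + 3)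
  ∷ cert ((+ 1 , - + 1 , + 0) ∷ (+ 2 , + 1 , + 1) ∷ []) (+ 0 , + 0 , + 0) (+ 0 , + 1 , + 0) (+ 1 , + 0 , + 1) (+ 1 , + 0 , + 1)
  ∷ cert ((+ 1 , + 1 , + 3) ∷ (- + 1 , + 2 , + 5) ∷ []) (+ 0 , + 0 , + 0) (+ 0 , + 1 , + 2) (+ 0 , + 1 , + 2) (+ 1 , + 0 , + 0)
  ∷ cert ((+ 1 , + 1 , + 3) ∷ (+ 2 , - + 1 , + 5) ∷ []) (+ 0 , + 0 , + 0) (+ 0 , + 1 , + 0) (+ 1 , + 0 , + 2) (+ 1 , + 0 , + 2)
  ∷ cert ((+ 1 , + 2 , + 8) ∷ (+ 2 , + 1 , + 8) ∷ []) (+ 1 , + 1 , + 4) (+ 0 , + 1 , + 2) (+ 0 , + 1 , + 2) (+ 1 , + 0 , + 3)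
  ∷ cert ((+ 0 , + 0 , + 1) ∷ (+ 1 , + 0 , + 2) ∷ []) (+ 1 , + 0 , + 0) (+ 0 , + 0 , + 1) (+ 0 , + 0 , + 1) (+ 0 , + 1 , + 2)
  ∷ cert ((+ 0 , + 0 , + 1) ∷ (+ 0 , + 1 , + 2) ∷ []) (+ 0 , + 1 , + 0) (+ 0 , + 0 , + 1) (+ 0 , + 0 , + 1) (+ 1 , + 0 , + 2)
  ∷ cert ((+ 0 , + 1 , + 1) ∷ (+ 0 , + 1 , + 2) ∷ []) (+ 0 , + 1 , + 0) (+ 0 , + 0 , + 1) (+ 0 , + 0 , + 1) (+ 1 , + 0 , + 1)
  ∷ cert ((+ 1 , + 0 , + 1) ∷ (+ 1 , + 0 , + 2) ∷ []) (+ 1 , + 0 , + 0) (+ 0 , + 0 , + 1) (+ 0 , + 0 , + 1) (+ 0 , + 1 , + 1)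
  ∷ cert ((- + 2 , + 3 , + 1) ∷ (- + 1 , + 2 , + 1) ∷ []) (- + 2 , + 3 , + 1) (+ 0 , + 1 , + 0) (+ 1 , - + 1 , + 0) (+ 1 , - + 1 , + 0)
  ∷ cert ((- + 1 , + 2 , + 1) ∷ (+ 1 , + 1 , + 3) ∷ []) (- + 1 , + 2 , + 1) (+ 1 , - + 1 , - + 1) (+ 1 , - + 1 , + 0) (+ 1 , + 1 , + 3)
  ∷ cert ((+ 2 , - + 1 , + 1) ∷ (+ 1 , + 1 , + 3) ∷ []) (+ 0 , + 1 , + 0) (+ 1 , - + 1 , + 0) (+ 1 , - + 1 , + 1) (+ 1 , + 1 , + 3)
  ∷ cert ((+ 1 , + 1 , + 3) ∷ (+ 3 , + 2 , + 7) ∷ []) (+ 0 , + 0 , + 0) (+ 1 , + 0 , + 0) (+ 1 , + 1 , + 3) (+ 1 , + 1 , + 3)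
  ∷ cert ((+ 2 , - + 1 , + 1) ∷ (+ 3 , - + 2 , + 1) ∷ []) (+ 1 , + 0 , + 1) (+ 1 , - + 1 , + 0) (+ 1 , - + 1 , + 0) (+ 1 , + 0 , + 0)
  ∷ cert ((+ 1 , + 2 , + 4) ∷ (+ 2 , + 1 , + 4) ∷ []) (+ 0 , + 1 , + 0) (+ 1 , - + 1 , + 0) (+ 1 , + 1 , + 3) (+ 1 , + 1 , + 4)
  ∷ cert ((+ 1 , + 2 , + 5) ∷ (+ 2 , + 3 , + 8) ∷ []) (+ 1 , + 1 , + 2) (+ 0 , + 1 , + 3) (+ 1 , + 1 , + 3) (+ 1 , + 1 , + 3)
  ∷ cert ((+ 2 , + 1 , + 5) ∷ (+ 3 , + 2 , + 8) ∷ []) (+ 1 , + 1 , + 2) (+ 1 , + 0 , + 3) (+ 1 , + 1 , + 3) (+ 1 , + 1 , + 3)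
  ∷ cert ((+ 1 , - + 1 , + 0) ∷ (+ 3 , + 2 , + 8) ∷ []) (+ 0 , + 0 , + 0) (+ 1 , - + 1 , + 0) (+ 1 , + 1 , + 2) (+ 1 , + 1 , + 3)
  ∷ cert ((- + 2 , + 3 , + 1) ∷ (+ 1 , + 1 , + 3) ∷ []) (- + 2 , + 3 , + 1) (+ 1 , - + 1 , + 0) (+ 1 , - + 1 , + 0) (+ 1 , + 0 , + 1)
  ∷ cert ((+ 3 , - + 2 , + 1) ∷ (+ 1 , + 1 , + 3) ∷ []) (+ 0 , + 1 , + 0) (+ 1 , - + 1 , + 0) (+ 1 , - + 1 , + 1) (+ 1 , + 1 , + 3)
  ∷ cert ((+ 2 , + 3 , + 7) ∷ (+ 3 , + 2 , + 7) ∷ []) (+ 0 , + 1 , + 0) (+ 1 , - + 1 , + 0) (+ 1 , + 1 , + 3) (+ 1 , + 1 , + 3)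
  ∷ cert ((+ 1 , - + 1 , + 0) ∷ (- + 2 , + 1 , + 2) ∷ []) (- + 2 , + 2 , + 2) (+ 1 , - + 1 , - + 1) (+ 1 , - + 1 , - + 1) (+ 1 , - + 1 , + 0)
  ∷ cert ((+ 1 , - + 1 , + 0) ∷ (- + 1 , + 2 , + 5) ∷ []) (- + 1 , + 3 , + 5) (+ 1 , - + 1 , - + 1) (+ 1 , - + 1 , - + 1) (+ 1 , - + 1 , + 0)
  ∷ cert ((+ 1 , - + 1 , + 0) ∷ (+ 2 , - + 3 , + 2) ∷ []) (+ 0 , + 0 , + 0) (+ 1 , - + 1 , + 0) (+ 1 , - + 1 , + 1) (+ 1 , - + 1 , + 1)
  ∷ cert ((+ 1 , - + 1 , + 0) ∷ (+ 3 , - + 2 , + 5) ∷ []) (+ 1 , + 1 , + 3) (+ 1 , - + 1 , + 0) (+ 1 , - + 1 , + 1) (+ 1 , - + 1 , + 1)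
  ∷ cert ((- + 2 , + 1 , + 1) ∷ (- + 3 , + 2 , + 2) ∷ []) (- + 3 , + 2 , + 2) (+ 1 , + 0 , + 1) (+ 1 , + 0 , + 1) (+ 2 , - + 1 , - + 1)
  ∷ cert ((+ 1 , - + 2 , + 1) ∷ (+ 2 , - + 3 , + 2) ∷ []) (+ 1 , - + 1 , + 1) (+ 0 , + 1 , + 1) (+ 0 , + 1 , + 1) (+ 1 , - + 2 , + 1)
  ∷ cert ((+ 1 , + 2 , + 2) ∷ (+ 2 , + 3 , + 4) ∷ []) (+ 1 , + 0 , + 0) (+ 0 , + 1 , + 1) (+ 0 , + 1 , + 1) (+ 1 , + 2 , + 2)
  ∷ cert ((+ 2 , + 1 , + 2) ∷ (+ 3 , + 2 , + 4) ∷ []) (+ 0 , + 1 , + 0) (+ 1 , + 0 , + 1) (+ 1 , + 0 , + 1) (+ 2 , + 1 , + 2)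
  ∷ cert ((+ 1 , + 1 , + 2) ∷ (+ 2 , + 3 , + 4) ∷ []) (+ 1 , + 0 , + 0) (+ 0 , + 1 , + 1) (+ 0 , + 1 , + 1) (+ 1 , + 1 , + 2)
  ∷ cert ((+ 1 , + 1 , + 2) ∷ (+ 3 , + 2 , + 4) ∷ []) (+ 0 , + 1 , + 0) (+ 1 , + 0 , + 1) (+ 1 , + 0 , + 1) (+ 1 , + 1 , + 2)
  ∷ cert ((+ 1 , + 1 , + 4) ∷ (+ 2 , + 3 , + 11) ∷ []) (+ 1 , + 0 , + 0) (+ 0 , + 1 , + 2) (+ 0 , + 1 , + 2) (+ 1 , + 2 , + 7)
  ∷ cert ((+ 1 , + 1 , + 4) ∷ (+ 3 , + 2 , + 11) ∷ []) (+ 0 , + 1 , + 0) (+ 1 , + 0 , + 2) (+ 1 , + 0 , + 2) (+ 2 , + 1 , + 7)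
  ∷ cert ((- + 1 , + 2 , + 4) ∷ (- + 2 , + 3 , + 5) ∷ []) (- + 1 , + 2 , + 4) (+ 0 , + 1 , + 2) (+ 0 , + 1 , + 2) (+ 1 , - + 2 , - + 4)
  ∷ cert ((+ 2 , - + 1 , + 4) ∷ (+ 3 , - + 2 , + 5) ∷ []) (+ 0 , + 0 , + 0) (+ 1 , + 0 , + 2) (+ 1 , + 0 , + 2) (+ 2 , - + 1 , + 4)
  ∷ cert ((+ 1 , + 2 , + 7) ∷ (+ 2 , + 3 , + 11) ∷ []) (+ 1 , + 1 , + 3) (+ 0 , + 1 , + 2) (+ 0 , + 1 , + 2) (+ 1 , + 1 , + 4)
  ∷ cert ((+ 2 , + 1 , + 7) ∷ (+ 3 , + 2 , + 11) ∷ []) (+ 1 , + 1 , + 3) (+ 1 , + 0 , + 2) (+ 1 , + 0 , + 2) (+ 1 , + 1 , + 4)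
  ∷ [])
  ( cert ((+ 0 , + 1 , + 1) ∷ (+ 1 , + 0 , + 1) ∷ (+ 1 , + 1 , + 3) ∷ []) (+ 0 , + 1 , + 0) (+ 0 , + 0 , + 1) (+ 1 , - + 1 , + 0) (+ 1 , + 1 , + 3)
  ∷ [])
certificates 4 1 = certs
  ( cert ((- + 4 , + 2 , + 1) ∷ []) (- + 2 , + 2 , + 1) (+ 0 , + 0 , + 1) (+ 0 , + 0 , + 1) (+ 2 , - + 1 , - + 1)
  ∷ cert ((+ 2 , - + 4 , + 1) ∷ []) (+ 1 , + 0 , + 0) (+ 0 , + 0 , + 1) (+ 0 , + 0 , + 1) (+ 1 , - + 2 , + 1)
  ∷ cert ((- + 2 , + 3 , + 2) ∷ []) (- + 2 , + 3 , + 2) (+ 1 , - + 1 , - + 1) (+ 1 , - + 1 , - + 1) (+ 1 , - + 1 , + 0)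
  ∷ cert ((+ 0 , + 1 , + 2) ∷ []) (+ 0 , + 1 , + 0) (+ 0 , + 0 , + 1) (+ 0 , + 0 , + 1) (+ 1 , + 0 , + 2)
  ∷ cert ((+ 1 , + 0 , + 2) ∷ []) (+ 1 , + 0 , + 0) (+ 0 , + 0 , + 1) (+ 0 , + 0 , + 1) (+ 0 , + 1 , + 2)
  ∷ cert ((+ 3 , - + 2 , + 2) ∷ []) (+ 0 , + 0 , + 0) (+ 1 , + 0 , + 2) (+ 1 , + 0 , + 2) (+ 2 , - + 1 , + 2)
  ∷ cert ((- + 2 , + 4 , + 3) ∷ []) (- + 1 , + 3 , + 2) (+ 0 , + 0 , + 1) (+ 0 , + 1 , + 2) (+ 1 , - + 2 , - + 2)
  ∷ cert ((+ 4 , - + 2 , + 3) ∷ []) (+ 1 , + 0 , + 0) (+ 0 , + 0 , + 1) (+ 1 , + 0 , + 2) (+ 2 , - + 1 , + 2)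
  ∷ cert ((- + 2 , + 4 , + 5) ∷ []) (- + 1 , + 3 , + 3) (+ 0 , + 0 , + 1) (+ 0 , + 1 , + 2) (+ 1 , - + 2 , - + 2)
  ∷ cert ((+ 4 , - + 2 , + 5) ∷ []) (+ 1 , + 0 , + 1) (+ 0 , + 0 , + 1) (+ 1 , + 0 , + 2) (+ 2 , - + 1 , + 2)
  ∷ cert ((+ 2 , + 4 , + 7) ∷ []) (+ 1 , + 1 , + 2) (+ 0 , + 0 , + 1) (+ 0 , + 0 , + 1) (+ 1 , + 2 , + 3)
  ∷ cert ((+ 4 , + 2 , + 7) ∷ []) (+ 1 , + 1 , + 2) (+ 0 , + 0 , + 1) (+ 0 , + 0 , + 1) (+ 2 , + 1 , + 3)
  ∷ cert ((- + 2 , + 4 , + 9) ∷ []) (- + 1 , + 3 , + 5) (+ 0 , + 0 , + 1) (+ 0 , + 0 , + 1) (+ 1 , - + 2 , - + 5)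
  ∷ cert ((+ 4 , - + 2 , + 9) ∷ []) (+ 1 , + 0 , + 0) (+ 0 , + 0 , + 1) (+ 0 , + 0 , + 1) (+ 2 , - + 1 , + 5)
  ∷ cert ((+ 2 , + 3 , + 10) ∷ []) (+ 0 , + 0 , + 0) (+ 1 , + 1 , + 3) (+ 1 , + 1 , + 3) (+ 1 , + 1 , + 4)
  ∷ cert ((+ 3 , + 2 , + 10) ∷ []) (+ 0 , + 0 , + 0) (+ 1 , + 1 , + 3) (+ 1 , + 1 , + 3) (+ 1 , + 1 , + 4)
  ∷ cert ((+ 2 , + 4 , + 11) ∷ []) (+ 1 , + 1 , + 2) (+ 0 , + 0 , + 1) (+ 0 , + 1 , + 2) (+ 1 , + 2 , + 6)
  ∷ cert ((+ 4 , + 2 , + 11) ∷ []) (+ 1 , + 1 , + 2) (+ 0 , + 0 , + 1) (+ 1 , + 0 , + 2) (+ 2 , + 1 , + 6)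
  ∷ cert ((+ 2 , + 4 , + 13) ∷ []) (+ 1 , + 1 , + 3) (+ 0 , + 0 , + 1) (+ 0 , + 1 , + 2) (+ 1 , + 2 , + 6)
  ∷ cert ((+ 4 , + 2 , + 13) ∷ []) (+ 1 , + 1 , + 3) (+ 0 , + 0 , + 1) (+ 1 , + 0 , + 2) (+ 2 , + 1 , + 6)
  ∷ cert ((+ 2 , + 4 , + 17) ∷ []) (+ 1 , + 2 , + 6) (+ 0 , + 0 , + 1) (+ 0 , + 0 , + 1) (+ 1 , + 2 , + 9)
  ∷ cert ((+ 4 , + 2 , + 17) ∷ []) (+ 2 , + 1 , + 6) (+ 0 , + 0 , + 1) (+ 0 , + 0 , + 1) (+ 2 , + 1 , + 9)
  ∷ [])
  ( cert ((+ 1 , - + 2 , + 0) ∷ (+ 2 , - + 1 , + 4) ∷ []) (+ 0 , + 0 , + 0) (+ 1 , - + 1 , + 0) (+ 1 , - + 1 , + 0) (+ 1 , + 1 , + 4)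
  ∷ cert ((+ 1 , - + 1 , + 0) ∷ (+ 2 , + 1 , + 8) ∷ []) (+ 0 , + 0 , + 0) (+ 1 , - + 1 , + 0) (+ 1 , + 1 , + 4) (+ 1 , + 1 , + 4)
  ∷ cert ((+ 2 , - + 1 , + 0) ∷ (+ 1 , + 1 , + 4) ∷ []) (+ 0 , + 1 , + 0) (+ 1 , - + 1 , + 0) (+ 1 , - + 1 , + 0) (+ 1 , + 1 , + 4)
  ∷ cert ((+ 1 , + 2 , + 4) ∷ (+ 2 , + 1 , + 4) ∷ []) (+ 0 , + 1 , + 0) (+ 1 , - + 1 , + 0) (+ 1 , + 1 , + 4) (+ 1 , + 1 , + 4)
  ∷ cert ((+ 1 , - + 1 , + 0) ∷ (+ 2 , + 1 , + 4) ∷ []) (+ 0 , + 0 , + 0) (+ 0 , + 1 , + 0) (+ 1 , + 0 , + 2) (+ 1 , + 0 , + 2)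
  ∷ cert ((+ 0 , + 0 , + 1) ∷ (+ 1 , + 1 , + 4) ∷ []) (+ 1 , + 1 , + 2) (+ 0 , + 0 , + 1) (+ 0 , + 0 , + 1) (+ 0 , + 0 , + 1)
  ∷ cert ((+ 1 , + 1 , + 4) ∷ (+ 1 , + 1 , + 5) ∷ []) (+ 1 , + 1 , + 2) (+ 0 , + 0 , + 1) (+ 0 , + 0 , + 1) (+ 0 , + 0 , + 1)
  ∷ cert ((+ 1 , + 2 , + 8) ∷ (+ 2 , + 1 , + 8) ∷ []) (+ 0 , + 1 , + 0) (+ 1 , - + 1 , + 0) (+ 1 , + 1 , + 6) (+ 1 , + 1 , + 6)
  ∷ cert ((- + 1 , + 2 , + 3) ∷ (+ 1 , + 1 , + 4) ∷ []) (- + 1 , + 2 , + 3) (+ 1 , - + 1 , - + 2) (+ 1 , - + 1 , - + 1) (+ 1 , + 1 , + 4)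
  ∷ cert ((+ 2 , - + 1 , + 3) ∷ (+ 1 , + 1 , + 4) ∷ []) (+ 0 , + 0 , + 0) (+ 0 , + 1 , + 0) (+ 1 , + 0 , + 2) (+ 1 , + 0 , + 2)
  ∷ cert ((- + 1 , + 1 , + 1) ∷ (+ 0 , + 0 , + 1) ∷ []) (+ 0 , + 1 , + 0) (+ 0 , + 0 , + 1) (+ 0 , + 0 , + 1) (+ 0 , + 0 , + 1)
  ∷ cert ((+ 0 , + 0 , + 1) ∷ (+ 1 , - + 1 , + 1) ∷ []) (+ 1 , + 0 , + 0) (+ 0 , + 0 , + 1) (+ 0 , + 0 , + 1) (+ 0 , + 0 , + 1)
  ∷ cert ((+ 1 , - + 1 , + 0) ∷ (+ 2 , + 1 , + 5) ∷ []) (+ 0 , + 0 , + 0) (+ 0 , + 1 , + 0) (+ 1 , + 0 , + 2) (+ 1 , + 0 , + 2)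
  ∷ cert ((+ 1 , + 2 , + 7) ∷ (+ 2 , + 1 , + 7) ∷ []) (+ 0 , + 1 , + 0) (+ 1 , - + 1 , + 0) (+ 1 , + 1 , + 5) (+ 1 , + 1 , + 6)
  ∷ cert ((- + 1 , + 2 , + 4) ∷ (+ 1 , + 1 , + 4) ∷ []) (- + 1 , + 2 , + 4) (+ 1 , - + 1 , - + 2) (+ 1 , - + 1 , - + 2) (+ 1 , + 1 , + 4)
  ∷ cert ((+ 1 , + 1 , + 4) ∷ (+ 2 , - + 1 , + 4) ∷ []) (+ 0 , + 0 , + 0) (+ 0 , + 1 , + 0) (+ 1 , + 0 , + 2) (+ 1 , + 0 , + 2)
  ∷ [])
  []
certificates 5 1 = certs
  ( cert ((- + 1 , + 2 , + 2) ∷ []) (+ 0 , + 1 , + 0) (+ 0 , + 0 , + 1) (+ 0 , + 0 , + 1) (+ 0 , + 1 , + 2)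
  ∷ cert ((+ 2 , - + 1 , + 2) ∷ []) (+ 1 , + 0 , + 0) (+ 0 , + 0 , + 1) (+ 0 , + 0 , + 1) (+ 1 , + 0 , + 2)
  ∷ cert ((- + 1 , + 2 , + 3) ∷ []) (+ 0 , + 1 , + 0) (+ 0 , + 0 , + 1) (+ 0 , + 0 , + 1) (+ 0 , + 1 , + 3)
  ∷ cert ((+ 2 , - + 1 , + 3) ∷ []) (+ 1 , + 0 , + 0) (+ 0 , + 0 , + 1) (+ 0 , + 0 , + 1) (+ 1 , + 0 , + 3)
  ∷ cert ((+ 0 , + 2 , + 5) ∷ []) (+ 0 , + 0 , + 0) (+ 0 , + 1 , + 1) (+ 0 , + 1 , + 2) (+ 0 , + 1 , + 2)
  ∷ cert ((+ 2 , + 0 , + 5) ∷ []) (+ 0 , + 0 , + 0) (+ 1 , + 0 , + 1) (+ 1 , + 0 , + 2) (+ 1 , + 0 , + 2)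
  ∷ cert ((+ 1 , + 2 , + 7) ∷ []) (+ 1 , + 1 , + 3) (+ 0 , + 0 , + 1) (+ 0 , + 0 , + 1) (+ 0 , + 1 , + 2)
  ∷ cert ((+ 2 , + 1 , + 7) ∷ []) (+ 1 , + 1 , + 3) (+ 0 , + 0 , + 1) (+ 0 , + 0 , + 1) (+ 1 , + 0 , + 2)
  ∷ cert ((+ 1 , + 2 , + 8) ∷ []) (+ 1 , + 1 , + 3) (+ 0 , + 0 , + 1) (+ 0 , + 0 , + 1) (+ 0 , + 1 , + 3)
  ∷ cert ((+ 2 , + 1 , + 8) ∷ []) (+ 1 , + 1 , + 3) (+ 0 , + 0 , + 1) (+ 0 , + 0 , + 1) (+ 1 , + 0 , + 3)
  ∷ [])
  []
  []
certificates 5 2 = certs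
  ( cert ((+ 0 , + 1 , + 0) ∷ []) (+ 1 , + 0 , + 0) (+ 0 , + 1 , + 1) (+ 0 , + 1 , + 2) (+ 0 , + 1 , + 2)
  ∷ cert ((+ 2 , - + 1 , + 0) ∷ []) (+ 0 , + 0 , + 0) (+ 1 , + 0 , + 1) (+ 1 , + 0 , + 1) (+ 1 , + 1 , + 3)
  ∷ cert ((+ 0 , + 2 , + 5) ∷ []) (+ 0 , + 0 , + 0) (+ 0 , + 1 , + 1) (+ 0 , + 1 , + 2) (+ 0 , + 1 , + 2)
  ∷ cert ((+ 2 , + 0 , + 5) ∷ []) (+ 0 , + 0 , + 0) (+ 1 , + 0 , + 1) (+ 1 , + 0 , + 2) (+ 1 , + 0 , + 2)
  ∷ cert ((+ 2 , + 2 , + 5) ∷ []) (+ 0 , + 1 , + 0) (+ 1 , + 1 , + 3) (+ 1 , + 1 , + 3) (+ 1 , + 1 , + 4)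
  ∷ cert ((+ 2 , + 3 , + 10) ∷ []) (+ 0 , + 1 , + 0) (+ 1 , + 0 , + 2) (+ 1 , + 1 , + 4) (+ 1 , + 1 , + 4)
  ∷ [])
  ( cert ((+ 0 , + 0 , + 1) ∷ (+ 1 , + 0 , + 2) ∷ []) (+ 1 , + 0 , + 0) (+ 0 , + 0 , + 1) (+ 0 , + 0 , + 1) (+ 0 , + 1 , + 2)
  ∷ cert ((+ 1 , + 0 , + 1) ∷ (+ 1 , + 0 , + 2) ∷ []) (+ 1 , + 0 , + 0) (+ 0 , + 0 , + 1) (+ 0 , + 0 , + 1) (+ 0 , + 1 , + 1)
  ∷ cert ((+ 1 , + 0 , + 0) ∷ (+ 0 , + 1 , + 2) ∷ []) (+ 0 , + 1 , + 0) (+ 0 , + 0 , + 1) (+ 0 , + 0 , + 1) (+ 1 , + 0 , + 0)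
  ∷ cert ((+ 0 , + 1 , + 2) ∷ (+ 1 , + 1 , + 4) ∷ []) (+ 0 , + 1 , + 0) (+ 0 , + 0 , + 1) (+ 0 , + 0 , + 1) (+ 1 , + 0 , + 2)
  ∷ cert ((+ 0 , + 1 , + 2) ∷ (+ 1 , + 1 , + 3) ∷ []) (+ 0 , + 1 , + 0) (+ 0 , + 0 , + 1) (+ 0 , + 0 , + 1) (+ 1 , + 1 , + 3)
  ∷ cert ((+ 0 , + 1 , + 2) ∷ (+ 1 , + 2 , + 7) ∷ []) (+ 0 , + 1 , + 0) (+ 0 , + 0 , + 1) (+ 0 , + 0 , + 1) (+ 1 , + 1 , + 5)
  ∷ cert ((+ 1 , + 2 , + 4) ∷ (+ 1 , + 2 , + 5) ∷ []) (+ 1 , + 0 , + 0) (+ 0 , + 1 , + 2) (+ 0 , + 1 , + 2) (+ 1 , + 2 , + 5)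
  ∷ cert ((+ 0 , + 0 , + 1) ∷ (+ 1 , + 2 , + 5) ∷ []) (+ 1 , + 0 , + 0) (+ 0 , + 0 , + 1) (+ 0 , + 1 , + 2) (+ 0 , + 1 , + 2)
  ∷ cert ((- + 2 , + 1 , + 1) ∷ (+ 0 , + 1 , + 2) ∷ []) (- + 1 , + 1 , + 1) (+ 0 , + 1 , + 2) (+ 1 , - + 1 , - + 1) (+ 1 , + 0 , + 0)
  ∷ cert ((+ 2 , + 2 , + 9) ∷ (+ 2 , + 3 , + 11) ∷ []) (+ 1 , + 1 , + 3) (+ 0 , + 1 , + 2) (+ 1 , + 1 , + 5) (+ 1 , + 2 , + 6)
  ∷ cert ((+ 1 , - + 1 , + 0) ∷ (+ 2 , + 1 , + 5) ∷ []) (+ 0 , + 0 , + 0) (+ 1 , - + 1 , + 0) (+ 1 , + 0 , + 0) (+ 1 , + 2 , + 5)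
  ∷ cert ((+ 1 , + 0 , + 0) ∷ (+ 2 , + 1 , + 5) ∷ []) (+ 0 , + 1 , + 0) (+ 1 , - + 1 , + 0) (+ 1 , + 0 , + 0) (+ 1 , + 1 , + 5)
  ∷ cert ((+ 1 , + 2 , + 5) ∷ (+ 2 , + 1 , + 5) ∷ []) (+ 0 , + 1 , + 0) (+ 1 , - + 1 , + 0) (+ 1 , + 1 , + 5) (+ 1 , + 2 , + 5)
  ∷ cert ((+ 1 , + 1 , + 5) ∷ (+ 2 , + 1 , + 5) ∷ []) (+ 0 , + 0 , + 0) (+ 1 , + 0 , + 0) (+ 1 , + 1 , + 5) (+ 1 , + 2 , + 5)
  ∷ cert ((+ 1 , - + 1 , + 1) ∷ (+ 2 , - + 1 , + 3) ∷ []) (+ 1 , + 0 , + 1) (+ 0 , + 1 , + 2) (+ 0 , + 1 , + 2) (+ 1 , - + 1 , + 1)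
  ∷ cert ((+ 0 , + 0 , + 1) ∷ (+ 1 , + 1 , + 4) ∷ []) (+ 1 , + 0 , + 0) (+ 0 , + 0 , + 1) (+ 0 , + 1 , + 2) (+ 0 , + 1 , + 2)
  ∷ cert ((+ 1 , + 0 , + 2) ∷ (+ 2 , - + 1 , + 3) ∷ []) (+ 1 , + 0 , + 1) (+ 0 , + 1 , + 2) (+ 0 , + 1 , + 2) (+ 1 , + 0 , + 2)
  ∷ cert ((+ 1 , + 2 , + 4) ∷ (+ 2 , + 3 , + 7) ∷ []) (+ 1 , + 0 , + 0) (+ 0 , + 1 , + 2) (+ 0 , + 1 , + 2) (+ 1 , + 2 , + 4)
  ∷ [])
  []
certificates 7 2 = certs
  ( cert ((+ 2 , + 1 , + 7) ∷ []) (+ 2 , + 1 , + 5) (+ 0 , + 0 , + 1) (+ 0 , + 0 , + 1) (+ 0 , + 1 , + 2)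
  ∷ [])
  []
  []
certificates 7 3 = certs
  ( cert ((+ 2 , + 2 , + 7) ∷ []) (+ 1 , + 0 , + 0) (+ 0 , + 1 , + 2) (+ 0 , + 1 , + 2) (+ 0 , + 1 , + 3)
  ∷ [])
  []
  []
certificates 8 3 = certs
  ( cert ((+ 1 , + 1 , + 4) ∷ []) (+ 1 , + 0 , + 0) (+ 0 , + 1 , + 2) (+ 0 , + 1 , + 2) (+ 0 , + 1 , + 4)
  ∷ cert ((+ 2 , + 1 , + 5) ∷ []) (+ 1 , + 0 , + 0) (+ 0 , + 1 , + 2) (+ 0 , + 1 , + 3) (+ 1 , + 1 , + 4)
  ∷ cert ((+ 2 , + 2 , + 7) ∷ []) (+ 1 , + 1 , + 2) (+ 0 , + 0 , + 1) (+ 0 , + 1 , + 2) (+ 1 , + 1 , + 4)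
  ∷ cert ((+ 2 , + 2 , + 9) ∷ []) (+ 1 , + 1 , + 3) (+ 0 , + 0 , + 1) (+ 0 , + 1 , + 2) (+ 1 , + 1 , + 4)
  ∷ cert ((+ 2 , + 3 , + 11) ∷ []) (+ 1 , + 1 , + 3) (+ 0 , + 1 , + 2) (+ 0 , + 1 , + 3) (+ 1 , + 1 , + 4)
  ∷ [])
  []
  []
certificates _ _ = certs [] [] []

-- Soundness and completeness of the search

not-sound : ∀ {x} → T (not x) → ¬ T x
not-sound {false} _ ()

not-complete : ∀ {x} → ¬ T x → T (not x)
not-complete {false} _ = tt
not-complete {true} ¬t = ⊥-elim (¬t tt)

∧-complete : ∀ {x y} → T x → T y → T (x ∧ y)
∧-complete t u = Equivalence.from T-∧ (t , u)

all-of-sound : ∀ {A : Set} (p : A → Bool) {xs} → T (all-of p xs) → ∀ {x} → x L.∈ xs → T (p x)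
all-of-sound p {y ∷ _} t (here refl) = proj₁ (∧-sound {p y} t)
all-of-sound p {y ∷ _} t (there x∈) = all-of-sound p (proj₂ (∧-sound {p y} t)) x∈

any-of-sound : ∀ {A : Set} (p : A → Bool) xs → T (any-of p xs) → ∃ λ x → x L.∈ xs × T (p x)
any-of-sound p (x ∷ xs) t = [ (λ px → x , here refl , px) ,
  (λ h → let (y , y∈ , py) = any-of-sound p xs h in y , there y∈ , py) ]′ (∨-sound {p x} t)

keep-∈ : ∀ {A : Set} (p : A → Bool) {xs x} → x L.∈ xs → T (p x) → x L.∈ keep p xs
keep-∈ p {y ∷ _} (here refl) px with p y
... | true = here refl
keep-∈ p {y ∷ _} (there x∈) px with p y
... | true = there (keep-∈ p x∈ px)
... | false = keep-∈ p x∈ px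

concatMap-∈ : ∀ {A B : Set} (f : A → List B) {xs x y} → x L.∈ xs → y L.∈ f x → y L.∈ concatMap f xs
concatMap-∈ f (here refl) y∈ = ∈-++⁺ˡ y∈
concatMap-∈ f {x′ ∷ _} (there x∈) y∈ = ∈-++⁺ʳ (f x′) (concatMap-∈ f x∈ y∈)

each-sound : ∀ p → T (each p) → ∀ i → T (p i)
each-sound p t false = proj₁ (∧-sound {p false} t)
each-sound p t true = proj₂ (∧-sound {p false} t)

nonneg-sound : ∀ {i} → T (nonneg i) → 0ℤ ≤ i
nonneg-sound {+ n} _ = 0≤+ n

nonneg-complete : ∀ {i} → 0ℤ ≤ i → T (nonneg i)
nonneg-complete {+ n} _ = tt

is-zero-sound : ∀ v → T (is-zero v) → v ≡ e₀
is-zero-sound (+ zero , + zero , + zero) _ = refl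

is-zero-complete : ∀ {v} → v ≡ e₀ → T (is-zero v)
is-zero-complete refl = tt

difference-zero : ∀ u v → u -ℤ³ v ≡ e₀ → u ≡ v
difference-zero (a , b , c) (d , e , f) eq =
  ×³-≡ (ℤ.i-j≡0⇒i≡j a d (cong π₁ eq)) (ℤ.i-j≡0⇒i≡j b e (cong π₂ eq)) (ℤ.i-j≡0⇒i≡j c f (cong π₃ eq))

≡ᴸ-sound : ∀ us vs → T (us ≡ᴸ vs) → us ≡ vs
≡ᴸ-sound [] [] _ = refl
≡ᴸ-sound (u ∷ us) (v ∷ vs) t = let (p , r) = ∧-sound {u ≡ⱽ v} t in
  cong₂ _∷_ (difference-zero u v (is-zero-sound (u -ℤ³ v) p)) (≡ᴸ-sound us vs r)

range-∈ : ∀ n {i} → ∣ i ∣ ℕ.≤ n → i L.∈ range n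
range-∈ n {+ k} k≤n = ∈-++⁺ˡ (∈-map⁺ +_ (∈-upTo⁺ (ℕ.s≤s k≤n)))
range-∈ n { -[1+ k ]} k<n = ∈-++⁺ʳ (List.map +_ (upTo (suc n))) (∈-map⁺ -[1+_] (∈-upTo⁺ k<n))

around-∈ : ∀ q .{{_ : ℕ.NonZero q}} {c x} → ∣ c - + q * x ∣ ℕ.≤ 17 → x L.∈ around q c
around-∈ q {c} {x} near = subst (L._∈ around q c) (ring (c ℤ./ℕ q) x) (∈-map⁺ (λ δ → c ℤ./ℕ q + δ) (range-∈ (17 ℕ./ q ℕ.+ 1) δ≤))
  where
    ring : ∀ a x → a + (x - a) ≡ x
    ring = solve-∀
    δ = x - c ℤ./ℕ q
    r = c ℤ.%ℕ q
    qδ : + q * δ ≡ + r - (c - + q * x)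
    qδ = trans (ring′ (+ q) x (c ℤ./ℕ q) (+ r)) (cong (λ c → + r - (c - + q * x)) (residue-form q c))
      where
        ring′ : ∀ q x a r → q * (x - a) ≡ r - ((r + a * q) - q * x)
        ring′ = solve-∀
    bound : q ℕ.* ∣ δ ∣ ℕ.< q ℕ.+ 17
    bound = subst (ℕ._< q ℕ.+ 17) (trans (cong ∣_∣ (sym qδ)) (ℤ.∣i*j∣≡∣i∣*∣j∣ (+ q) δ))
      (ℕ.≤-<-trans (ℤ.∣i-j∣≤∣i∣+∣j∣ (+ r) (c - + q * x)) (ℕ.+-mono-<-≤ (ℤ.n%ℕd<d c q) near))
    δ≤ : ∣ δ ∣ ℕ.≤ 17 ℕ./ q ℕ.+ 1
    δ≤ = ℕ.≮⇒≥ λ lt → ℕ.<-irrefl refl (ℕ.<-trans bound (begin-strict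
      q ℕ.+ 17                                   <⟨ ℕ.+-monoʳ-< q (x<[1+x/q]*q 17 q) ⟩
      q ℕ.+ suc (17 ℕ./ q) ℕ.* q                 ≡⟨ ℕ.*-comm (suc (suc (17 ℕ./ q))) q ⟩
      q ℕ.* suc (suc (17 ℕ./ q))                 ≤⟨ ℕ.*-monoʳ-≤ q (subst (λ k → suc k ℕ.≤ ∣ δ ∣) (ℕ.+-comm (17 ℕ./ q) 1) lt) ⟩
      q ℕ.* ∣ δ ∣                                ∎))
      where open ℕ.≤-Reasoning

within-complete : ∀ {n i} → ∣ i ∣ ℕ.≤ n → T (within n i)
within-complete = ℕ.≤⇒≤ᵇ

key-- : ∀ u v → key (u -ℤ³ v) ≡ key u - key v
key-- (x , y , z) (x′ , y′ , z′) = ring x y z x′ y′ z′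
  where
    ring : ∀ x y z x′ y′ z′ → + 10000 * (z - z′) + + 100 * (x - x′) + (y - y′)
      ≡ (+ 10000 * z + + 100 * x + y) - (+ 10000 * z′ + + 100 * x′ + y′)
    ring = solve-∀

relation-sound : ∀ {u v w} c → Indep u v w → ¬ T (relation u v w c)
relation-sound {u} {v} {w} c ind t = let (nz , z) = ∧-sound {not (is-zero c)} t in
  not-sound nz (is-zero-complete (ind c (is-zero-sound (lin₃ c u v w) z)))

dependent-sound : ∀ {u v w} → Indep u v w → ¬ T (dependent u v w)
dependent-sound {u} {v} {w} ind t =
  [ relation-sound {u} {v} {w} (minors₁₂ u v w) ind , (λ t →
  [ relation-sound {u} {v} {w} (minors₁₃ u v w) ind , relation-sound {u} {v} {w} (minors₂₃ u v w) ind ]′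
    (∨-sound {relation u v w (minors₁₃ u v w)} t)) ]′ (∨-sound {relation u v w (minors₁₂ u v w)} t)

-- The weights on T have total `D`, those on the first tetrahedron q D; scaling by `q` makes the
-- totals agree, as `InSum` demands.
cone-scale : ∀ {S n y} k → 0ℤ ≤ k → Cone S n y → Cone S (k * n) (k *ᵥ y)
cone-scale {S} k 0≤k nil = subst (λ n → Cone S n (k *ᵥ e₀)) (sym (ℤ.*-zeroʳ k))
  (subst (Cone S 0ℤ) (sym (×³-≡ (ℤ.*-zeroʳ k) (ℤ.*-zeroʳ k) (ℤ.*-zeroʳ k))) nil)
cone-scale {S} k 0≤k (add {v} {n} {y} s a 0≤a c) = subst₂ (Cone S) (sym (ℤ.*-distribˡ-+ k a n)) (vec v y)
  (add s (k * a) (0≤i*j 0≤k 0≤a) (cone-scale k 0≤k c))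
  where
    ring : ∀ k a v y → k * a * v + k * y ≡ k * (a * v + y)
    ring = solve-∀
    vec : ∀ v y → (k * a) *ᵥ v +ᵥ k *ᵥ y ≡ k *ᵥ (a *ᵥ v +ᵥ y)
    vec (v , v′ , v″) (y , y′ , y″) = ×³-≡ (ring k a v y) (ring k a v′ y′) (ring k a v″ y″)

module SearchSound (b : ℤ) (q′ : ℕ) .{{_ : ℕ.NonZero q′}} (m n : ℤ) where
  open Search b q′ m n

  private
    S = Vert 1ℤ b q

  inside-cone : ∀ D p → T (inside D p) → Cone S (q * D) (q *ᵥ p)
  inside-cone D p@(x , y , z) t =
    let (tz , t₁) = ∧-sound {nonneg z} t
        (t₁ , t₂) = ∧-sound {nonneg (q * x - z)} t₁
        (t₂ , t₀) = ∧-sound {nonneg (q * y - b * z)} t₂ in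
    subst₂ (Cone S) (total q D (q * x - z) (q * y - b * z) z) (×³-≡ (row₁ q D x y z b) (row₂ q D x y z b) (row₃ q D x y z b))
      (add v₀ (q * D - (q * x - z) - (q * y - b * z) - z) (nonneg-sound t₀)
        (add v₁ (q * x - z) (nonneg-sound t₁) (add v₂ (q * y - b * z) (nonneg-sound t₂) (add v₃ z (nonneg-sound tz) nil))))
    where
      total : ∀ q D u v w → q * D - u - v - w + (u + (v + (w + 0ℤ))) ≡ q * D
      total = solve-∀
      row₁ : ∀ q D x y z b → (q * D - (q * x - z) - (q * y - b * z) - z) * 0ℤ + ((q * x - z) * 1ℤ + ((q * y - b * z) * 0ℤ + (z * 1ℤ + 0ℤ))) ≡ q * x
      row₁ = solve-∀
      row₂ : ∀ q D x y z b → (q * D - (q * x - z) - (q * y - b * z) - z) * 0ℤ + ((q * x - z) * 0ℤ + ((q * y - b * z) * 1ℤ + (z * b + 0ℤ))) ≡ q * y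
      row₂ = solve-∀
      row₃ : ∀ q D x y z b → (q * D - (q * x - z) - (q * y - b * z) - z) * 0ℤ + ((q * x - z) * 0ℤ + ((q * y - b * z) * 0ℤ + (z * q + 0ℤ))) ≡ q * z
      row₃ = solve-∀

  module _ {T′ : ℤ³ → Set} {s : ℤ³} (Ts : T′ s) where

    Placed : ℤ → ℕ → ℤ³ → Set
    Placed D t r = ∃ λ p → T (inside D p) × Cone T′ (+ t) (+ t *ᵥ s +ᵥ (r -ℤ³ p))

    place-sound : ∀ D us t r → L.All (λ u → T′ (s +ᵥ u)) us → T (place D us t r) → Placed D t r
    place-at-sound : ∀ D us t r → L.All (λ u → T′ (s +ᵥ u)) us → T (place-at D us t r) → Placed D t r
    place-sound D [] t r _ h = r , h , subst₂ (Cone T′) (ℤ.+-identityʳ (+ t)) (vec s r) (add Ts (+ t) (0≤+ t) nil)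
      where
        ring : ∀ t s r → t * s + 0ℤ ≡ t * s + (r - r)
        ring = solve-∀
        vec : ∀ s r → + t *ᵥ s +ᵥ e₀ ≡ + t *ᵥ s +ᵥ (r -ℤ³ r)
        vec (s , s′ , s″) (r , r′ , r″) = ×³-≡ (ring (+ t) s r) (ring (+ t) s′ r′) (ring (+ t) s″ r″)
    place-sound D (u ∷ us) t r pts h = place-at-sound D (u ∷ us) t r pts h
    place-at-sound D (u ∷ us) zero r (_ ∷ pts) h = place-sound D us 0 r pts h
    place-at-sound D (u ∷ us) (suc t) r pts@(Tu ∷ pts′) h =
      [ place-sound D us (suc t) r pts′ , (λ h → extend (place-at-sound D (u ∷ us) t (r -ℤ³ u) pts h)) ]′
      (∨-sound {place D us (suc t) r} h)
      where
        ring : ∀ t s u r p → 1ℤ * (s + u) + (t * s + (r - u - p)) ≡ (1ℤ + t) * s + (r - p)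
        ring = solve-∀
        vec : ∀ s u r p → 1ℤ *ᵥ (s +ᵥ u) +ᵥ (+ t *ᵥ s +ᵥ ((r -ℤ³ u) -ℤ³ p)) ≡ + suc t *ᵥ s +ᵥ (r -ℤ³ p)
        vec (s , s′ , s″) (u , u′ , u″) (r , r′ , r″) (p , p′ , p″) =
          ×³-≡ (ring (+ t) s u r p) (ring (+ t) s′ u′ r′ p′) (ring (+ t) s″ u″ r″ p″)
        extend : Placed D t (r -ℤ³ u) → Placed D (suc t) r
        extend (p , ins , c) = p , ins , subst (Cone T′ (+ suc t)) (vec s u r p) (add Tu 1ℤ (0≤+ 1) c)

    covers-sound : ∀ us z → L.All (λ u → T′ (s +ᵥ u)) us → T (covers us z) → InSum S T′ (s +ᵥ z)
    covers-sound us z pts h = let (D , _ , h) = any-of-sound (λ D → place (+ suc D) us (suc D) (+ suc D *ᵥ z)) (upTo 11) h in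
      at (suc D) (ℕ.s≤s ℕ.z≤n) (place-sound (+ suc D) us (suc D) (+ suc D *ᵥ z) pts h)
      where
        at : ∀ D → 0 ℕ.< D → Placed (+ D) D (+ D *ᵥ z) → InSum S T′ (s +ᵥ z)
        at D 0<D (p , ins , c) = inSum {N = q * + D} (ℤ.positive⁻¹ (q * + D) ⦃ positive ⦄)
          (inside-cone (+ D) p ins) (cone-scale q (0≤+ q′) c) (vec s z p)
          where
            positive : ℤ.Positive (q * + D)
            positive = subst ℤ.Positive (ℤ.pos-* q′ D) (ℤ.positive (ℤ.+<+ (ℕ.*-mono-< {0} {q′} {0} (ℕ.>-nonZero⁻¹ q′) 0<D)))
            ring : ∀ q D s z p → q * D * (s + z) ≡ q * p + q * (D * s + (D * z - p))
            ring = solve-∀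
            vec : ∀ s z p → (q * + D) *ᵥ (s +ᵥ z) ≡ q *ᵥ p +ᵥ q *ᵥ (+ D *ᵥ s +ᵥ ((+ D *ᵥ z) -ℤ³ p))
            vec (s , s′ , s″) (z , z′ , z″) (p , p′ , p″) =
              ×³-≡ (ring q (+ D) s z p) (ring q (+ D) s′ z′ p′) (ring q (+ D) s″ z″ p″)

    valid-sound : ∀ c → T (valid c) → L.All (λ u → T′ (s +ᵥ u)) (Cert.shape c) → Triple S T′
    valid-sound (cert us x u v w) h pts =
      let (hu , h) = ∧-sound {not (is-zero u)} h
          (hv , h) = ∧-sound {not (is-zero v)} h
          (hw , h) = ∧-sound {not (is-zero w)} h in
      triple (s +ᵥ x) u v w (λ e → not-sound hu (is-zero-complete e)) (λ e → not-sound hv (is-zero-complete e))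
        (λ e → not-sound hw (is-zero-complete e))
        λ i j k → subst (InSum S T′) (regroup s x (bit i u) (bit j v) (bit k w))
          (covers-sound us (x +ᵥ bit i u +ᵥ bit j v +ᵥ bit k w) pts
            (each-sound (λ k → covers us (x +ᵥ bit i u +ᵥ bit j v +ᵥ bit k w))
              (each-sound (λ j → each λ k → covers us (x +ᵥ bit i u +ᵥ bit j v +ᵥ bit k w))
                (each-sound (λ i → each λ j → each λ k → covers us (x +ᵥ bit i u +ᵥ bit j v +ᵥ bit k w)) h i) j) k))
      where
        regroup : ∀ s x u v w → s +ᵥ (x +ᵥ u +ᵥ v +ᵥ w) ≡ s +ᵥ x +ᵥ u +ᵥ v +ᵥ w
        regroup s x u v w = trans (sym (+ᵥ-assoc s (x +ᵥ u +ᵥ v) w)) (cong (_+ᵥ w)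
          (trans (sym (+ᵥ-assoc s (x +ᵥ u) v)) (cong (_+ᵥ v) (sym (+ᵥ-assoc s x u)))))

    bad-sound : ∀ cs us → T (all-of valid cs) → T (bad cs us) → L.All (λ u → T′ (s +ᵥ u)) us → Triple S T′
    bad-sound cs us valids h pts =
      let (c , c∈ , same) = any-of-sound (λ c → us ≡ᴸ Cert.shape c) cs h in
      valid-sound c (all-of-sound valid valids c∈) (subst (L.All (λ u → T′ (s +ᵥ u))) (≡ᴸ-sound us (Cert.shape c) same) pts)

inverse : (q : ℕ) .{{_ : ℕ.NonZero q}} → ℕ → ℕ → ℕ
inverse q b zero = 0
inverse q b (suc n) = if b ℕ.* suc n ℕ.% q ℕ.≡ᵇ 1 then suc n else inverse q b n

-- A whole row of values b is evaluated uniformly, so pairs that are not coprime have to pass too.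
-- They do so by exhibiting a k below q with q dividing k b, which `Coprime′` later contradicts.
verify : (q : ℕ) .{{_ : ℕ.NonZero q}} → ℕ → ℕ → Certs → Bool
verify q b n C = if b ℕ.* n ℕ.% q ℕ.≡ᵇ 1
  then all-valid C ∧ check C
  else some (q ℕ.∸ 1) (λ k → k ℕ.* b ℕ.% q ℕ.≡ᵇ 0)
  where open Search (+ b) q (+ (b ℕ.* n ℕ./ q)) (+ n) using (all-valid; check)

verified : (q : ℕ) .{{_ : ℕ.NonZero q}} → ℕ → Bool
verified q b = verify q b (inverse q b q) (certificates q b)

-- Half of the residues suffice because of the symmetry between b and q - b in `always-coprime`.
verified-row : (q : ℕ) .{{_ : ℕ.NonZero q}} → Bool
verified-row q = every (q ℕ./ 2) (λ b → verified q (suc b))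

module CheckSound (b′ q′ : ℕ) .{{_ : ℕ.NonZero q′}} (m n : ℤ) (b≤q : b′ ℕ.≤ q′) (bn-qm : + b′ * n - + q′ * m ≡ 1ℤ)
  {T′ : ℤ³ → Set} (none : ¬ Triple (Vert 1ℤ (+ b′) (+ q′)) T′) where
  private
    b = + b′
  open Search b q′ m n
  open SearchSound b q′ m n

  module _ {s c : ℤ³} (Ts : T′ s) (Ts′ : T′ (s +ᵥ c)) (c≢0 : c ≢ e₀) where

    not-rejected : ¬ T (reject b q m n c)
    not-rejected t = none (reject-sound {b} {q} {m} {n} bn-qm c≢0 Ts Ts′ t)

    private
      ∨ˡ : ∀ {x y} → T x → T (x ∨ y)
      ∨ˡ t = Equivalence.from T-∨ (inj₁ t)
      ∨ʳ : ∀ {x y} → T y → T (x ∨ y)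
      ∨ʳ {x} t = Equivalence.from (T-∨ {x}) (inj₂ t)
      ¬facet₃ : ¬ T (facet-test c)
      ¬facet₃ t = not-rejected (∨ˡ t)
      ¬facet₁ : ¬ T (facet-test (facet₁ b q c))
      ¬facet₁ t = not-rejected (∨ʳ {facet-test c} (∨ˡ t))
      ¬facet₀ : ¬ T (facet-test (facet₀ b q m n c))
      ¬facet₀ t = not-rejected (∨ʳ {facet-test c} (∨ʳ {facet-test (facet₁ b q c)} (∨ˡ t)))
      ¬facet₂ : ¬ T (facet-test (facet₂ b q m n c))
      ¬facet₂ t = not-rejected (∨ʳ {facet-test c} (∨ʳ {facet-test (facet₁ b q c)} (∨ʳ {facet-test (facet₀ b q m n c)} (∨ˡ t))))
      height₃ = facet-test-height c ¬facet₃
      height₁ = facet-test-height (facet₁ b q c) ¬facet₁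
      height₀ = facet-test-height (facet₀ b q m n c) ¬facet₀
      height₂ = facet-test-height (facet₂ b q m n c) ¬facet₂

      cancel-q : ∀ {k i} → q′ ℕ.* ∣ i ∣ ℕ.≤ q′ ℕ.* k → ∣ i ∣ ℕ.≤ k
      cancel-q {k} {i} = ℕ.*-cancelˡ-≤ {∣ i ∣} {k} q′

      x-bound : ∣ π₁ c ∣ ℕ.≤ 34
      x-bound = cancel-q {34} {π₁ c} (ℕ.≤-trans (subst (ℕ._≤ 34) (ℤ.∣i*j∣≡∣i∣*∣j∣ q (π₁ c)) (heights-bound {b} {q} {c} ¬facet₃ ¬facet₁)) (ℕ.m≤n*m 34 q′))

      -- The height over the facet opposite to `v₂` is b z - q y, and |b z| ≤ 17 q because b ≤ q.
      y-bound : ∣ π₂ c ∣ ℕ.≤ 34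
      y-bound = cancel-q {34} {π₂ c} (begin
        q′ ℕ.* ∣ π₂ c ∣                                                ≡⟨ ℤ.∣i*j∣≡∣i∣*∣j∣ q (π₂ c) ⟨
        ∣ q * π₂ c ∣                                                  ≡⟨ cong ∣_∣ (ring q (π₂ c) b (π₃ c)) ⟩
        ∣ b * π₃ c - (- q * π₂ c + b * π₃ c) ∣                        ≤⟨ ℤ.∣i-j∣≤∣i∣+∣j∣ (b * π₃ c) (- q * π₂ c + b * π₃ c) ⟩
        ∣ b * π₃ c ∣ ℕ.+ ∣ - q * π₂ c + b * π₃ c ∣                    ≤⟨ ℕ.+-mono-≤ bz height₂ ⟩
        q′ ℕ.* 17 ℕ.+ 17                                              ≤⟨ ℕ.+-monoʳ-≤ (q′ ℕ.* 17) (ℕ.m≤n*m 17 q′) ⟩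
        q′ ℕ.* 17 ℕ.+ q′ ℕ.* 17                                       ≡⟨ ℕ.*-distribˡ-+ q′ 17 17 ⟨
        q′ ℕ.* 34                                                     ∎)
        where
          open ℕ.≤-Reasoning
          ring : ∀ q y b z → q * y ≡ b * z - (- q * y + b * z)
          ring = solve-∀
          bz : ∣ b * π₃ c ∣ ℕ.≤ q′ ℕ.* 17
          bz = subst (ℕ._≤ q′ ℕ.* 17) (sym (ℤ.∣i*j∣≡∣i∣*∣j∣ b (π₃ c))) (ℕ.*-mono-≤ b≤q height₃)

      i≤∣i∣ : ∀ i → i ≤ + ∣ i ∣
      i≤∣i∣ (+ k) = ℤ.≤-refl
      i≤∣i∣ -[1+ k ] = ℤ.-≤+

      -- |x|, |y| ≤ 34 make the sign of key that of z.
      z-nonneg : 0ℤ ≤ key c → 0ℤ ≤ π₃ c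
      z-nonneg 0≤key = by-sign (π₃ c) refl
        where
          by-sign : ∀ z → π₃ c ≡ z → 0ℤ ≤ π₃ c
          by-sign (+ k) e = subst (0ℤ ≤_) (sym e) (0≤+ k)
          by-sign -[1+ k ] e = ⊥-elim (ℤ.≤⇒≯ (ℤ.≤-trans 0≤key upper) ℤ.-<+)
            where
              -- The bound is -10000 + 100 · 34 + 34.
              upper : key c ≤ - + 6566
              upper = ℤ.+-mono-≤ {+ 10000 * π₃ c + + 100 * π₁ c} { - + 6600} {π₂ c} {+ 34}
                (ℤ.+-mono-≤ {+ 10000 * π₃ c} { - + 10000} {+ 100 * π₁ c} {+ 3400}
                  (ℤ.*-monoˡ-≤-nonNeg (+ 10000) {π₃ c} { -1ℤ } (subst (_≤ -1ℤ) (sym e) (ℤ.-≤- ℕ.z≤n)))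
                  (ℤ.*-monoˡ-≤-nonNeg (+ 100) {π₁ c} {+ 34} (ℤ.≤-trans (i≤∣i∣ (π₁ c)) (ℤ.+≤+ x-bound))))
                (ℤ.≤-trans (i≤∣i∣ (π₂ c)) (ℤ.+≤+ y-bound))

    low-complete : 0ℤ ≤ key c → T (low c)
    low-complete 0≤key = ∧-complete (nonneg-complete (z-nonneg 0≤key)) (∧-complete (within-complete {17} {π₃ c} height₃)
      (∧-complete (within-complete {17} {π₃ (facet₁ b q c)} height₁)
      (∧-complete (within-complete {17} {π₃ (facet₀ b q m n c)} height₀) (within-complete {17} {π₃ (facet₂ b q m n c)} height₂))))

    box-complete : 0ℤ ≤ key c → c L.∈ box
    box-complete 0≤key = concatMap-∈ (λ z → concatMap (row z) (around q′ z)) z∈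
      (concatMap-∈ (row (π₃ c)) (around-∈ q′ {π₃ c} {π₁ c} height₁)
        (keep-∈ low (∈-map⁺ (λ y → π₁ c , y , π₃ c) (around-∈ q′ {b * π₃ c} {π₂ c}
          (subst (λ i → ∣ i ∣ ℕ.≤ 17) (ring q (π₂ c) (b * π₃ c)) height₂))) (low-complete 0≤key)))
      where
        ring : ∀ q y w → - q * y + w ≡ w - q * y
        ring = solve-∀
        z∈ : π₃ c L.∈ List.map +_ (upTo 18)
        z∈ = subst (L._∈ List.map +_ (upTo 18)) (ℤ.0≤i⇒+∣i∣≡i (z-nonneg 0≤key)) (∈-map⁺ +_ (∈-upTo⁺ (ℕ.s≤s height₃)))

  module _ (C : Certs) (valids : T (all-valid C)) (checked : T (check C)) where
    open Certs C
    private
      valids₁ : T (all-of valid for-edges)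
      valids₁ = proj₁ (∧-sound {all-of valid for-edges} valids)
      valids₂₃ = ∧-sound {all-of valid for-triangles} (proj₂ (∧-sound {all-of valid for-edges} valids))

    edge-complete : ∀ {s c} → T′ s → T′ (s +ᵥ c) → c ≢ e₀ → 0ℤ ≤ key c → T (edge C c)
    edge-complete {s} {c} Ts Ts′ c≢0 0≤key = ∧-complete (nonneg-complete 0≤key)
      (∧-complete (not-complete (not-rejected Ts Ts′ c≢0))
        (not-complete λ t → none (bad-sound Ts for-edges (c ∷ []) valids₁ t (Ts′ ∷ []))))

    next-complete : ∀ {s u v} → T′ s → T′ (s +ᵥ u) → T′ (s +ᵥ v) → v -ℤ³ u ≢ e₀ → 0ℤ ≤ key (v -ℤ³ u) → T (next C u v)
    next-complete {s} {u} {v} Ts Tu Tv v≢u 0≤key =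
      ∧-complete (low-complete Tu Tv′ v≢u 0≤key) (∧-complete (edge-complete Tu Tv′ v≢u 0≤key)
        (not-complete λ t → none (bad-sound Ts for-triangles (u ∷ v ∷ []) (proj₁ valids₂₃) t (Tu ∷ Tv ∷ []))))
      where
        Tv′ : T′ (s +ᵥ u +ᵥ (v -ℤ³ u))
        Tv′ = subst T′ (sym (trans (+ᵥ-assoc s u (v -ℤ³ u)) (cong (s +ᵥ_) (+ᵥ-base u v)))) Tv

    -- Nonnegative keys of consecutive differences give nonnegative keys for all six edges. In the
    -- absence of a triple every edge and face then survives its test, so u, v and w occur in the
    -- lists that `check` runs through, where none of the reasons for exclusion can hold.
    check-sound : ∀ {s u v w} → T′ s → T′ (s +ᵥ u) → T′ (s +ᵥ v) → T′ (s +ᵥ w) → Indep u v w →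
      0ℤ ≤ key u → 0ℤ ≤ key (v -ℤ³ u) → 0ℤ ≤ key (w -ℤ³ v) → ⊥
    check-sound {s} {u} {v} {w} Ts Tu Tv Tw ind 0≤u 0≤vu 0≤wv =
      [ (λ t → not-sound t next-vw) , (λ t →
      [ (λ t → none (bad-sound Tu for-triangles (v -ℤ³ u ∷ w -ℤ³ u ∷ []) (proj₁ valids₂₃) t (shift Tv ∷ shift Tw ∷ []))) , (λ t →
      [ dependent-sound {u} {v} {w} ind ,
        (λ t → none (bad-sound Ts for-tetrahedra (u ∷ v ∷ w ∷ []) (proj₂ valids₂₃) t (Tu ∷ Tv ∷ Tw ∷ []))) ]′
      (∨-sound {dependent u v w} t)) ]′ (∨-sound {bad for-triangles (v -ℤ³ u ∷ w -ℤ³ u ∷ [])} t)) ]′ (∨-sound {not (next C v w)} excluded-uvw)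
      where
        shift : ∀ {t} → T′ (s +ᵥ t) → T′ (s +ᵥ u +ᵥ (t -ℤ³ u))
        shift {t} = subst T′ (sym (trans (+ᵥ-assoc s u (t -ℤ³ u)) (cong (s +ᵥ_) (+ᵥ-base u t))))
        0≤+key : ∀ x y z → 0ℤ ≤ key (y -ℤ³ x) → 0ℤ ≤ key (z -ℤ³ y) → 0ℤ ≤ key (z -ℤ³ x)
        0≤+key x y z p r = subst (0ℤ ≤_) (trans (cong₂ _+_ (key-- y x) (key-- z y)) (trans (ring (key x) (key y) (key z)) (sym (key-- z x)))) (0≤i+j p r)
          where
            ring : ∀ x y z → (y - x) + (z - y) ≡ z - x
            ring = solve-∀
        from-origin : ∀ x y → 0ℤ ≤ key x → 0ℤ ≤ key (y -ℤ³ x) → 0ℤ ≤ key y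
        from-origin x y p r = subst (0ℤ ≤_) (trans (cong (λ k → key x + k) (key-- y x)) (ring (key x) (key y))) (0≤i+j p r)
          where
            ring : ∀ x y → x + (y - x) ≡ y
            ring = solve-∀
        0≤v = from-origin u v 0≤u 0≤vu
        0≤w = from-origin v w 0≤v 0≤wv
        0≤wu = 0≤+key u v w 0≤vu 0≤wv
        unit₂ : lin₃ (0ℤ , 1ℤ , 0ℤ) u v w ≡ v
        unit₂ = trans (sym (lin₃-cycle 0ℤ 1ℤ 0ℤ u v w)) (lin₃-unit₁ v w u)
        unit₃ : lin₃ (0ℤ , 0ℤ , 1ℤ) u v w ≡ w
        unit₃ = trans (sym (lin₃-cycle 0ℤ 0ℤ 1ℤ u v w)) (trans (sym (lin₃-cycle 0ℤ 1ℤ 0ℤ v w u)) (lin₃-unit₁ w u v))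
        u≢0 : u ≢ e₀
        u≢0 e = indep-zero 1ℤ 0ℤ 0ℤ ind (trans (lin₃-unit₁ u v w) e) (inj₁ λ ())
        v≢0 : v ≢ e₀
        v≢0 e = indep-zero 0ℤ 1ℤ 0ℤ ind (trans unit₂ e) (inj₂ (inj₁ λ ()))
        w≢0 : w ≢ e₀
        w≢0 e = indep-zero 0ℤ 0ℤ 1ℤ ind (trans unit₃ e) (inj₂ (inj₂ λ ()))
        minus : ∀ u v w → lin₃ (-1ℤ , 1ℤ , 0ℤ) u v w ≡ v -ℤ³ u
        minus (u , u′ , u″) (v , v′ , v″) (w , w′ , w″) = ×³-≡ (ring u v w) (ring u′ v′ w′) (ring u″ v″ w″)
          where
            ring : ∀ u v w → -1ℤ * u + (1ℤ * v + 0ℤ * w) ≡ v - u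
            ring = solve-∀
        minus₁₃ : ∀ u v w → lin₃ (-1ℤ , 0ℤ , 1ℤ) u v w ≡ w -ℤ³ u
        minus₁₃ (u , u′ , u″) (v , v′ , v″) (w , w′ , w″) = ×³-≡ (ring u v w) (ring u′ v′ w′) (ring u″ v″ w″)
          where
            ring : ∀ u v w → -1ℤ * u + (0ℤ * v + 1ℤ * w) ≡ w - u
            ring = solve-∀
        minus₂₃ : ∀ u v w → lin₃ (0ℤ , -1ℤ , 1ℤ) u v w ≡ w -ℤ³ v
        minus₂₃ (u , u′ , u″) (v , v′ , v″) (w , w′ , w″) = ×³-≡ (ring u v w) (ring u′ v′ w′) (ring u″ v″ w″)
          where
            ring : ∀ u v w → 0ℤ * u + (-1ℤ * v + 1ℤ * w) ≡ w - v
            ring = solve-∀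
        v≢u : v -ℤ³ u ≢ e₀
        v≢u e = indep-zero -1ℤ 1ℤ 0ℤ ind (trans (minus u v w) e) (inj₁ λ ())
        w≢u : w -ℤ³ u ≢ e₀
        w≢u e = indep-zero -1ℤ 0ℤ 1ℤ ind (trans (minus₁₃ u v w) e) (inj₁ λ ())
        w≢v : w -ℤ³ v ≢ e₀
        w≢v e = indep-zero 0ℤ -1ℤ 1ℤ ind (trans (minus₂₃ u v w) e) (inj₂ (inj₁ λ ()))
        next-vw = next-complete Ts Tv Tw w≢v 0≤wv
        us = keep (edge C) box
        member : ∀ {c} → T′ (s +ᵥ c) → c ≢ e₀ → 0ℤ ≤ key c → c L.∈ us
        member Tc c≢0 0≤c = keep-∈ (edge C) (box-complete Ts Tc c≢0 0≤c) (edge-complete Ts Tc c≢0 0≤c)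
        vs = keep (next C u) us
        v∈ : v L.∈ vs
        v∈ = keep-∈ (next C u) (member Tv v≢0 0≤v) (next-complete Ts Tu Tv v≢u 0≤vu)
        w∈ : w L.∈ vs
        w∈ = keep-∈ (next C u) (member Tw w≢0 0≤w) (next-complete Ts Tu Tw w≢u 0≤wu)
        excluded-uvw : T (excluded C u v w)
        excluded-uvw = all-of-sound (excluded C u v) (all-of-sound (λ v → all-of (excluded C u v) vs)
          (all-of-sound (λ u → check-third C u (keep (next C u) us)) checked (member Tu u≢0 0≤u)) v∈) w∈

-- A triple for every first tetrahedron of volume at least 3

record Quad (T′ : ℤ³ → Set) : Set where
  constructor quad
  field
    {y₀ y₁ y₂ y₃} : ℤ³
    Ty₀ : T′ y₀
    Ty₁ : T′ y₁
    Ty₂ : T′ y₂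
    Ty₃ : T′ y₃
    indep : Indep (y₁ -ℤ³ y₀) (y₂ -ℤ³ y₀) (y₃ -ℤ³ y₀)

-- Permutations of the vertices; the lists of inequalities are the sorted prefix.
module _ {T′ : ℤ³ → Set} where
  open Quad

  swap₂₃ : Quad T′ → Quad T′
  swap₂₃ (quad {y₀} {y₁} {y₂} {y₃} t₀ t₁ t₂ t₃ ind) = quad t₀ t₁ t₃ t₂ λ (a , b , c) e →
    let f = ind (a , c , b) (trans (exchange a b c (y₁ -ℤ³ y₀) (y₃ -ℤ³ y₀) (y₂ -ℤ³ y₀)) e) in ×³-≡ (cong π₁ f) (cong π₃ f) (cong π₂ f)
    where
      exchange : ∀ a b c u v w → lin₃ (a , c , b) u w v ≡ lin₃ (a , b , c) u v w
      exchange a b c u v w = cong (a *ᵥ u +ᵥ_) (+ᵥ-comm (c *ᵥ w) (b *ᵥ v))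

  swap₁₂ : Quad T′ → Quad T′
  swap₁₂ (quad {y₀} {y₁} {y₂} {y₃} t₀ t₁ t₂ t₃ ind) = quad t₀ t₂ t₁ t₃ λ (a , b , c) e →
    let f = ind (b , a , c) (trans (exchange a b c (y₂ -ℤ³ y₀) (y₁ -ℤ³ y₀) (y₃ -ℤ³ y₀)) e) in ×³-≡ (cong π₂ f) (cong π₁ f) (cong π₃ f)
    where
      exchange : ∀ a b c u v w → lin₃ (b , a , c) v u w ≡ lin₃ (a , b , c) u v w
      exchange a b c u v w = trans (sym (+ᵥ-assoc (b *ᵥ v) (a *ᵥ u) (c *ᵥ w)))
        (trans (cong (_+ᵥ c *ᵥ w) (+ᵥ-comm (b *ᵥ v) (a *ᵥ u))) (+ᵥ-assoc (a *ᵥ u) (b *ᵥ v) (c *ᵥ w)))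

  swap₀₁ : Quad T′ → Quad T′
  swap₀₁ (quad {y₀} {y₁} {y₂} {y₃} t₀ t₁ t₂ t₃ ind) = quad t₁ t₀ t₂ t₃ λ (a , b , c) e →
    -- Rewriting the combination based at `y₁` with the base `y₀` gives the exchanged point the
    -- coefficient -(a + b + c).
    let f = ind (- (a + b + c) , b , c) (trans (rebase a b c y₀ y₁ y₂ y₃) e)
        b≡0 = cong π₂ f
        c≡0 = cong π₃ f in
    ×³-≡ (trans (solve-a a b c) (trans (cong₂ (λ x y → - x - y - c) (cong π₁ f) b≡0) (cong (λ x → - 0ℤ - 0ℤ - x) c≡0))) b≡0 c≡0
    where
      solve-a : ∀ a b c → a ≡ - (- (a + b + c)) - b - c
      solve-a = solve-∀
      ring : ∀ a b c p q r s → - (a + b + c) * (q - p) + (b * (r - p) + c * (s - p)) ≡ a * (p - q) + (b * (r - q) + c * (s - q))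
      ring = solve-∀
      rebase : ∀ a b c p q r s → lin₃ (- (a + b + c) , b , c) (q -ℤ³ p) (r -ℤ³ p) (s -ℤ³ p) ≡ lin₃ (a , b , c) (p -ℤ³ q) (r -ℤ³ q) (s -ℤ³ q)
      rebase a b c (p , p′ , p″) (q , q′ , q″) (r , r′ , r″) (s , s′ , s″) =
        ×³-≡ (ring a b c p q r s) (ring a b c p′ q′ r′ s′) (ring a b c p″ q″ r″ s″)

  k₀ k₁ k₂ k₃ : Quad T′ → ℤ
  k₀ Q = key (y₀ Q)
  k₁ Q = key (y₁ Q)
  k₂ Q = key (y₂ Q)
  k₃ Q = key (y₃ Q)

  sort₂ : Quad T′ → Σ (Quad T′) λ Q → k₀ Q ≤ k₁ Q
  sort₂ Q = [ (λ le → Q , le) , (λ ge → swap₀₁ Q , ge) ]′ (ℤ.≤-total (k₀ Q) (k₁ Q))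

  sort₃ : Quad T′ → Σ (Quad T′) λ Q → k₀ Q ≤ k₁ Q × k₁ Q ≤ k₂ Q
  sort₃ Q = insert (sort₂ Q)
    where
      insert : Σ (Quad T′) (λ Q → k₀ Q ≤ k₁ Q) → Σ (Quad T′) λ Q → k₀ Q ≤ k₁ Q × k₁ Q ≤ k₂ Q
      insert (Q , 0≤1) = [ (λ 1≤2 → Q , 0≤1 , 1≤2) , (λ 2≤1 →
        [ (λ 0≤2 → swap₁₂ Q , 0≤2 , 2≤1) , (λ 2≤0 → swap₀₁ (swap₁₂ Q) , 2≤0 , 0≤1) ]′ (ℤ.≤-total (k₀ Q) (k₂ Q))) ]′ (ℤ.≤-total (k₁ Q) (k₂ Q))

  sort₄ : Quad T′ → Σ (Quad T′) λ Q → k₀ Q ≤ k₁ Q × k₁ Q ≤ k₂ Q × k₂ Q ≤ k₃ Q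
  sort₄ Q = insert (sort₃ Q)
    where
      insert : Σ (Quad T′) (λ Q → k₀ Q ≤ k₁ Q × k₁ Q ≤ k₂ Q) → Σ (Quad T′) λ Q → k₀ Q ≤ k₁ Q × k₁ Q ≤ k₂ Q × k₂ Q ≤ k₃ Q
      insert (Q , 0≤1 , 1≤2) = [ (λ 2≤3 → Q , 0≤1 , 1≤2 , 2≤3) , (λ 3≤2 →
        [ (λ 1≤3 → swap₂₃ Q , 0≤1 , 1≤3 , 3≤2) , (λ 3≤1 →
        [ (λ 0≤3 → swap₁₂ (swap₂₃ Q) , 0≤3 , 3≤1 , 1≤2) , (λ 3≤0 → swap₀₁ (swap₁₂ (swap₂₃ Q)) , 3≤0 , 0≤1 , 1≤2) ]′
          (ℤ.≤-total (k₀ Q) (k₃ Q))) ]′ (ℤ.≤-total (k₁ Q) (k₃ Q))) ]′ (ℤ.≤-total (k₂ Q) (k₃ Q))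

-- Three vectors with first coordinate 0 are dependent.
flat-dependent : ∀ {u v w} → Indep u v w → π₁ u ≡ 0ℤ → π₁ v ≡ 0ℤ → π₁ w ≡ 0ℤ → ⊥
flat-dependent {_ , y , z} {_ , y′ , z′} {w@(_ , y″ , z″)} ind refl refl refl = indep-zero 1ℤ 0ℤ 0ℤ ind
  (trans (lin₃-unit₁ u v w) (×³-≡ refl y≡0 z≡0)) (inj₁ λ ())
  where
    u v : ℤ³
    u = 0ℤ , y , z
    v = 0ℤ , y′ , z′
    zero-row : ∀ a b c → a * 0ℤ + (b * 0ℤ + c * 0ℤ) ≡ 0ℤ
    zero-row = solve-∀
    row₂ : ∀ x y z x′ y′ z′ → (y * z′ - z * y′) * x + ((y′ * x - z′ * x′) * 0ℤ + (x * y′ - x * y′) * 0ℤ) ≡ (y * z′ - z * y′) * x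
    row₂ = solve-∀
    minors : minors₂₃ u v w ≡ e₀
    minors = ind (minors₂₃ u v w) (×³-≡ (zero-row (y′ * z″ - z′ * y″) (y″ * z - z″ * y) (y * z′ - z * y′)) (second y z y′ z′ y″ z″) (third y z y′ z′ y″ z″))
      where
        second : ∀ y z y′ z′ y″ z″ → (y′ * z″ - z′ * y″) * y + ((y″ * z - z″ * y) * y′ + (y * z′ - z * y′) * y″) ≡ 0ℤ
        second = solve-∀
        third : ∀ y z y′ z′ y″ z″ → (y′ * z″ - z′ * y″) * z + ((y″ * z - z″ * y) * z′ + (y * z′ - z * y′) * z″) ≡ 0ℤ
        third = solve-∀
    yz′ : y * z′ - z * y′ ≡ 0ℤ
    yz′ = cong π₃ minors
    y-relation : ∀ y z y′ z′ → z′ * y + (- z * y′ + 0ℤ * y″) ≡ y * z′ - z * y′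
    y-relation = ring y″
      where
        ring : ∀ w y z y′ z′ → z′ * y + (- z * y′ + 0ℤ * w) ≡ y * z′ - z * y′
        ring = solve-∀
    z-relation : ∀ z z′ → z′ * z + (- z * z′ + 0ℤ * z″) ≡ 0ℤ
    z-relation = ring z″
      where
        ring : ∀ w z z′ → z′ * z + (- z * z′ + 0ℤ * w) ≡ 0ℤ
        ring = solve-∀
    y-relation′ : ∀ y y′ → y′ * y + (- y * y′ + 0ℤ * y″) ≡ 0ℤ
    y-relation′ = ring y″
      where
        ring : ∀ w y y′ → y′ * y + (- y * y′ + 0ℤ * w) ≡ 0ℤ
        ring = solve-∀
    z-relation′ : ∀ y z y′ z′ → y′ * z + (- y * z′ + 0ℤ * z″) ≡ - (y * z′ - z * y′)
    z-relation′ = ring z″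
      where
        ring : ∀ w y z y′ z′ → y′ * z + (- y * z′ + 0ℤ * w) ≡ - (y * z′ - z * y′)
        ring = solve-∀
    neg-zero : ∀ {x} → - x ≡ 0ℤ → x ≡ 0ℤ
    neg-zero {x} e = trans (sym (ℤ.neg-involutive x)) (cong -_ e)
    z≡0 : z ≡ 0ℤ
    z≡0 = neg-zero (cong π₂ (ind (z′ , - z , 0ℤ) (×³-≡ (zero-row z′ (- z) 0ℤ) (trans (y-relation y z y′ z′) yz′) (z-relation z z′))))
    y≡0 : y ≡ 0ℤ
    y≡0 = neg-zero (cong π₂ (ind (y′ , - y , 0ℤ) (×³-≡ (zero-row y′ (- y) 0ℤ) (y-relation′ y y′) (trans (z-relation′ y z y′ z′) (cong -_ yz′)))))

-- The double negation is there because the search refutes the absence of a triple instead of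
-- producing one; the final goal is a contradiction anyway.
Always : ℤ → ℤ → ℤ → Set₁
Always a b q = ∀ {T′ : ℤ³ → Set} → Quad T′ → ¬ ¬ Triple (Vert a b q) T′

at-vertex : ∀ (T′ : ℤ³ → Set) s y → T′ y → T′ (s +ᵥ (y -ℤ³ s))
at-vertex T′ s y = subst T′ (sym (+ᵥ-base s y))

-- The bound |q x| ≤ 34 < q makes the first coordinate of all edges at `y₀` vanish, so the four
-- points would be coplanar.
always-large : ∀ b q → 35 ℕ.≤ q → Always 1ℤ b (+ q)
always-large b q 35≤q {T′} (quad {y₀} {y₁} {y₂} {y₃} t₀ t₁ t₂ t₃ ind) none =
  flat-dependent ind (flat y₁ t₁) (flat y₂ t₂) (flat y₃ t₃)
  where
    flat : ∀ y → T′ y → π₁ (y -ℤ³ y₀) ≡ 0ℤ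
    flat y t = small (π₁ (y -ℤ³ y₀)) (heights-bound {b} {+ q} {y -ℤ³ y₀}
      (λ h → none (triple₃ {s = y₀} {y -ℤ³ y₀} t₀ (at-vertex T′ y₀ y t) h)) (λ h → none (triple₁ {b} {+ q} {s = y₀} {y -ℤ³ y₀} t₀ (at-vertex T′ y₀ y t) h)))
      where
        small : ∀ x → ∣ + q * x ∣ ℕ.≤ 34 → x ≡ 0ℤ
        small x le = ℤ.∣i∣≡0⇒i≡0 (ℕ.n<1⇒n≡0 (ℕ.*-cancelˡ-< q ∣ x ∣ 1 (ℕ.≤-<-trans (subst (ℕ._≤ 34) (ℤ.∣i*j∣≡∣i∣*∣j∣ (+ q) x) le)
          (subst (34 ℕ.<_) (sym (ℕ.*-identityʳ q)) 35≤q))))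

if-sound : ∀ c {x y} → T (if c then x else y) → (T c × T x) ⊎ T y
if-sound true t = inj₁ (tt , t)
if-sound false t = inj₂ t

-- Coprimality of `q` and `b`, in the form that positive residues provide and that a failed
-- inversion in `verify` contradicts.
Coprime′ : ℕ → ℕ → Set
Coprime′ q b = ∀ k → 0 ℕ.< k → k ℕ.< q → ¬ q ℕ.∣ k ℕ.* b

always-verified : ∀ b q .{{_ : ℕ.NonZero q}} → b ℕ.≤ q → Coprime′ q b → T (verified q b) → Always 1ℤ (+ b) (+ q)
always-verified b q b≤q coprime t {T′} Q none = conclude (if-sound (b ℕ.* n ℕ.% q ℕ.≡ᵇ 1) t) (sort₄ Q)
  where
    n = inverse q b q
    m = b ℕ.* n ℕ./ q
    conclude : _ → _ → ⊥
    conclude (inj₂ h) _ = let (k , 0<k , k≤ , h) = some-sound (q ℕ.∸ 1) {λ k → k ℕ.* b ℕ.% q ℕ.≡ᵇ 0} h in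
      coprime k 0<k (ℕ.≤-<-trans k≤ (ℕ.∸-monoʳ-< {q} {1} {0} (ℕ.s≤s ℕ.z≤n) (ℕ.>-nonZero⁻¹ q)))
        (ℕ.m%n≡0⇒n∣m (k ℕ.* b) q (ℕ.≡ᵇ⇒≡ (k ℕ.* b ℕ.% q) 0 h))
    conclude (inj₁ (e , h)) (quad {y₀} {y₁} {y₂} {y₃} t₀ t₁ t₂ t₃ ind , 0≤1 , 1≤2 , 2≤3) =
      let (valids , checked) = ∧-sound {Search.all-valid (+ b) q (+ m) (+ n) (certificates q b)} h in
      CheckSound.check-sound b q (+ m) (+ n) b≤q bn-qm none (certificates q b) valids checked {y₀} t₀
        (at-vertex T′ y₀ y₁ t₁) (at-vertex T′ y₀ y₂ t₂) (at-vertex T′ y₀ y₃ t₃) ind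
        (ordered y₀ y₁ 0≤1) (relative y₁ y₂ 1≤2) (relative y₂ y₃ 2≤3)
      where
        bn-qm : + b * + n - + q * + m ≡ 1ℤ
        bn-qm = trans (cong₂ _-_ (trans (sym (ℤ.pos-* b n)) (trans (cong +_ (trans (ℕ.m≡m%n+[m/n]*n (b ℕ.* n) q) (cong (ℕ._+ m ℕ.* q) (ℕ.≡ᵇ⇒≡ (b ℕ.* n ℕ.% q) 1 e))))
          (cong (λ x → 1ℤ + x) (ℤ.pos-* m q)))) refl) (ring (+ m) (+ q))
          where
            ring : ∀ m q → 1ℤ + m * q - q * m ≡ 1ℤ
            ring = solve-∀
        ordered : ∀ x y → key x ≤ key y → 0ℤ ≤ key (y -ℤ³ x)
        ordered x y le = subst (0ℤ ≤_) (sym (key-- y x)) (ℤ.i≤j⇒0≤j-i le)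
        relative : ∀ x y → key x ≤ key y → 0ℤ ≤ key ((y -ℤ³ y₀) -ℤ³ (x -ℤ³ y₀))
        relative x y le = subst (0ℤ ≤_) (cong key (sym (telescope x y y₀))) (ordered x y le)
          where
            ring : ∀ x y z → (y - z) - (x - z) ≡ y - x
            ring = solve-∀
            telescope : ∀ x y z → (y -ℤ³ z) -ℤ³ (x -ℤ³ z) ≡ y -ℤ³ x
            telescope (x , x′ , x″) (y , y′ , y″) (z , z′ , z″) = ×³-≡ (ring x y z) (ring x′ y′ z′) (ring x″ y″ z″)

row-at : ℕ → Bool
row-at zero = true
row-at (suc q) = verified-row (suc q)

-- A record, so that the type checker does not compare rows by evaluating them.
record Row (q : ℕ) : Set where
  constructor row
  field
    holds : T (row-at q)

-- The `tt` evaluates the search for all 3 ≤ q ≤ 34 and 1 ≤ b ≤ q / 2; from q = 35 on `always-large`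
-- applies.
row-from-3 : ∀ k → k ℕ.< 32 → Row (3 ℕ.+ k)
row-from-3 k k<32 = row (every-sound 32 (λ k → row-at (3 ℕ.+ k)) tt {k} k<32)

row-entry : ∀ q′ b → Row (suc q′) → b ℕ.< suc q′ ℕ./ 2 → T (verified (suc q′) (suc b))
row-entry q′ b (row h) = every-sound (suc q′ ℕ./ 2) (λ b → verified (suc q′) (suc b)) h

always-half : ∀ b q → 3 ℕ.≤ q → 0 ℕ.< b → 2 ℕ.* b ℕ.≤ q → Coprime′ q b → Always 1ℤ (+ b) (+ q)
always-half (suc b) q@(suc q′) 3≤q _ 2b≤q coprime = by-size (q ℕ.<? 35)
  where
    b<q/2 : b ℕ.< q ℕ./ 2
    b<q/2 = subst (ℕ._≤ q ℕ./ 2) (ℕ.m*n/n≡m (suc b) 2) (ℕ./-monoˡ-≤ 2 (subst (ℕ._≤ q) (ℕ.*-comm 2 (suc b)) 2b≤q))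
    by-size : _ → Always 1ℤ (+ suc b) (+ q)
    by-size (no q≮35) = always-large (+ suc b) q (ℕ.≮⇒≥ q≮35)
    by-size (yes q<35) = always-verified (suc b) q (ℕ.≤-trans (ℕ.m≤n*m (suc b) 2) 2b≤q) coprime
      (row-entry q′ b (subst Row (ℕ.m+[n∸m]≡n 3≤q) (row-from-3 (q ℕ.∸ 3) (ℕ.∸-monoˡ-< q<35 3≤q))) b<q/2)

module _ (φ : Chart) where
  open Chart φ

  to-lin₃ : ∀ c u v w → to (lin₃ c u v w) ≡ lin₃ c (to u) (to v) (to w)
  to-lin₃ (a , b , c) u v w = trans (to-+ (a *ᵥ u) (b *ᵥ v +ᵥ c *ᵥ w)) (cong₂ _+ᵥ_ (to-* a u)
    (trans (to-+ (b *ᵥ v) (c *ᵥ w)) (cong₂ _+ᵥ_ (to-* b v) (to-* c w))))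

  minus-as-sum : ∀ u v → u -ℤ³ v ≡ u +ᵥ -1ℤ *ᵥ v
  minus-as-sum (a , b , c) (d , e , f) = ×³-≡ (ring a d) (ring b e) (ring c f)
    where
      ring : ∀ a d → a - d ≡ a + -1ℤ * d
      ring = solve-∀

  to-minus : ∀ u v → to (u -ℤ³ v) ≡ to u -ℤ³ to v
  to-minus u v = trans (cong to (minus-as-sum u v)) (trans (to-+ u (-1ℤ *ᵥ v))
    (trans (cong (to u +ᵥ_) (to-* -1ℤ v)) (sym (minus-as-sum (to u) (to v)))))

  quad-transport : ∀ {T′ : ℤ³ → Set} → Quad T′ → Quad (λ v → T′ (e₀ +ᵥ to v))
  quad-transport {T′} (quad {y₀} {y₁} {y₂} {y₃} t₀ t₁ t₂ t₃ ind) = quad (at y₀ t₀) (at y₁ t₁) (at y₂ t₂) (at y₃ t₃) λ c e →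
    ind c (trans (sym (trans (to-lin₃ c (from y₁ -ℤ³ from y₀) (from y₂ -ℤ³ from y₀) (from y₃ -ℤ³ from y₀))
      (cong₂ (λ u (v , w) → lin₃ c u v w) (edge y₁) (cong₂ _,_ (edge y₂) (edge y₃))))) (trans (cong to e) to-e₀))
    where
      at : ∀ y → T′ y → T′ (e₀ +ᵥ to (from y))
      at y = subst T′ (sym (trans (+ᵥ-identityˡ (to (from y))) (to-from y)))
      edge : ∀ y → to (from y -ℤ³ from y₀) ≡ y -ℤ³ y₀
      edge y = trans (to-minus (from y) (from y₀)) (cong₂ _-ℤ³_ (to-from y) (to-from y₀))

  always-transport : ∀ {a b q} {S T′ : ℤ³ → Set} o → (∀ {v} → Vert a b q v → S (o +ᵥ to v)) →
    Always a b q → Quad T′ → ¬ ¬ Triple S T′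
  always-transport {T′ = T′} o f always Q none = always (quad-transport Q) λ t →
    none (triple-transport φ {T′ = λ v → T′ (e₀ +ᵥ to v)} {o} {e₀} f (λ x → x) t)

shear : ℤ → ℤ → Chart
shear A B = chart (λ (x , y , z) → x + A * z , y + B * z , z) (λ (x , y , z) → x - A * z , y - B * z , z)
  (λ (x , y , z) → ×³-≡ (r₁ x A z) (r₁ y B z) refl) (λ (x , y , z) → ×³-≡ (r₂ x A z) (r₂ y B z) refl)
  (λ (x , y , z) (x′ , y′ , z′) → ×³-≡ (r₃ A x x′ z z′) (r₃ B y y′ z z′) refl)
  (λ k (x , y , z) → ×³-≡ (r₄ k A x z) (r₄ k B y z) refl)
  where
    r₁ : ∀ x A z → x - A * z + A * z ≡ x
    r₁ = solve-∀
    r₂ : ∀ x A z → x + A * z - A * z ≡ x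
    r₂ = solve-∀
    r₃ : ∀ A x x′ z z′ → x + x′ + A * (z + z′) ≡ x + A * z + (x′ + A * z′)
    r₃ = solve-∀
    r₄ : ∀ k A x z → k * x + A * (k * z) ≡ k * (x + A * z)
    r₄ = solve-∀

exchange : Chart
exchange = chart (λ (x , y , z) → y , x , z) (λ (x , y , z) → y , x , z) (λ _ → refl) (λ _ → refl) (λ _ _ → refl) (λ _ _ → refl)

-- Moves the origin to v₁, exchanging v₀ and v₁.
turn₀₁ : Chart
turn₀₁ = chart to to involutive involutive (λ (x , y , z) (x′ , y′ , z′) → ×³-≡ (r₂ x x′ y y′) refl refl) (λ k (x , y , z) → ×³-≡ (r₃ k x y) refl refl)
  where
    to : ℤ³ → ℤ³
    to (x , y , z) = - x - y , y , z
    r₁ : ∀ x y → - (- x - y) - y ≡ x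
    r₁ = solve-∀
    involutive : ∀ v → to (to v) ≡ v
    involutive (x , y , z) = ×³-≡ (r₁ x y) refl refl
    r₂ : ∀ x x′ y y′ → - (x + x′) - (y + y′) ≡ - x - y + (- x′ - y′)
    r₂ = solve-∀
    r₃ : ∀ k x y → - (k * x) - k * y ≡ k * (- x - y)
    r₃ = solve-∀

-- Moves the origin to v₂, exchanging v₀ and v₂.
turn₀₂ : Chart
turn₀₂ = chart to to involutive involutive (λ (x , y , z) (x′ , y′ , z′) → ×³-≡ refl (r₂ x x′ y y′ z z′) refl) (λ k (x , y , z) → ×³-≡ refl (r₃ k x y z) refl)
  where
    to : ℤ³ → ℤ³
    to (x , y , z) = x , - x - y + z , z
    r₁ : ∀ x y z → - x - (- x - y + z) + z ≡ y
    r₁ = solve-∀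
    involutive : ∀ v → to (to v) ≡ v
    involutive (x , y , z) = ×³-≡ refl (r₁ x y z) refl
    r₂ : ∀ x x′ y y′ z z′ → - (x + x′) - (y + y′) + (z + z′) ≡ - x - y + z + (- x′ - y′ + z′)
    r₂ = solve-∀
    r₃ : ∀ k x y z → - (k * x) - k * y + k * z ≡ k * (- x - y + z)
    r₃ = solve-∀

vert : ∀ {a b q u v} → Vert a b q u → u ≡ v → Vert a b q v
vert s refl = s

-- For a = 1 the weights are -b, 1, b modulo q. Exchanging `v₀` and `v₂` swaps the first and the
-- last, that is, b with q - b, so b may be taken at most q / 2.
always-coprime : ∀ b q → 3 ℕ.≤ q → b ℕ.< q → Coprime′ q b → Always 1ℤ (+ b) (+ q)
always-coprime b q 3≤q b<q coprime {T′} Q = by-half (2 ℕ.* b ℕ.≤? q)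
  where
    instance _ = ℕ.>-nonZero (ℕ.≤-trans (ℕ.s≤s ℕ.z≤n) b<q)
    0<b : 0 ℕ.< b
    0<b = ℕ.n≢0⇒n>0 λ b≡0 → coprime 1 (ℕ.s≤s ℕ.z≤n) (ℕ.≤-trans (ℕ.s≤s (ℕ.s≤s ℕ.z≤n)) 3≤q) (subst (λ x → q ℕ.∣ 1 ℕ.* x) (sym b≡0) (q ℕ.∣0))
    c = q ℕ.∸ b
    c+b : c ℕ.+ b ≡ q
    c+b = ℕ.m∸n+n≡m (ℕ.<⇒≤ b<q)
    coprime′ : Coprime′ q c
    coprime′ k 0<k k<q q∣kc = coprime k 0<k k<q (ℕ.∣m+n∣m⇒∣n (subst (q ℕ.∣_) (trans (cong (k ℕ.*_) (sym c+b)) (ℕ.*-distribˡ-+ k c b)) (ℕ.n∣m*n k)) q∣kc)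
    half : ¬ 2 ℕ.* b ℕ.≤ q → 2 ℕ.* c ℕ.≤ q
    half 2b≰q = ℕ.+-cancelʳ-≤ (2 ℕ.* b) (2 ℕ.* c) q (begin
      2 ℕ.* c ℕ.+ 2 ℕ.* b    ≡⟨ ℕ.*-distribˡ-+ 2 c b ⟨
      2 ℕ.* (c ℕ.+ b)        ≡⟨ cong (2 ℕ.*_) c+b ⟩
      2 ℕ.* q                ≡⟨ cong (q ℕ.+_) (ℕ.+-identityʳ q) ⟩
      q ℕ.+ q                ≤⟨ ℕ.+-monoʳ-≤ q (ℕ.<⇒≤ (ℕ.≰⇒> 2b≰q)) ⟩
      q ℕ.+ 2 ℕ.* b          ∎)
      where open ℕ.≤-Reasoning
    c≡ : + c + + b ≡ + q
    c≡ = cong +_ c+b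
    reflect : ∀ {v} → Vert 1ℤ (+ c) (+ q) v → Vert 1ℤ (+ b) (+ q) (e₂ +ᵥ Chart.to turn₀₂ v)
    reflect v₀ = v₂
    reflect v₁ = v₁
    reflect v₂ = v₀
    reflect v₃ = vert v₃ (×³-≡ refl (trans (ring (+ b) (+ c)) (cong (λ x → 1ℤ + (-1ℤ - + c + x)) c≡)) refl)
      where
        ring : ∀ b c → b ≡ 1ℤ + (-1ℤ - c + (c + b))
        ring = solve-∀
    by-half : _ → ¬ ¬ Triple (Vert 1ℤ (+ b) (+ q)) T′
    by-half (yes 2b≤q) = always-half b q 3≤q 0<b 2b≤q coprime Q
    by-half (no 2b≰q) = always-transport turn₀₂ e₂ reflect (always-half c q 3≤q (ℕ.m<n⇒0<n∸m b<q) (half 2b≰q) coprime′) Q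

residue-coprime : ∀ q .{{_ : ℕ.NonZero q}} b → (∀ k → 0 ℕ.< k → k ℕ.< q → 0 ℕ.< k ℕ.* b ℕ.% q) → Coprime′ q b
residue-coprime q b pos k 0<k k<q q∣kb = ℕ.<-irrefl (sym (ℕ.n∣m⇒m%n≡0 (k ℕ.* b) q q∣kb)) (pos k 0<k k<q)

module _ (q : ℕ) .{{_ : ℕ.NonZero q}} (3≤q : 3 ℕ.≤ q) where

  -- Shears that fix the plane of `v₀`, `v₁`, `v₂` change a and b by multiples of q, so both may be
  -- replaced by their residues.
  always-first : ∀ a b → a ℤ.%ℕ q ≡ 1 → Coprime′ q (b ℤ.%ℕ q) → Always a b (+ q)
  always-first a b a≡1 coprime {T′} = always-transport (shear (a ℤ./ℕ q) (b ℤ./ℕ q)) e₀ image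
    (always-coprime (b ℤ.%ℕ q) q 3≤q (ℤ.n%ℕd<d b q) coprime)
    where
      r : ∀ A → 0ℤ ≡ 0ℤ + (0ℤ + A * 0ℤ)
      r = solve-∀
      r′ : ∀ A → 1ℤ ≡ 0ℤ + (1ℤ + A * 0ℤ)
      r′ = solve-∀
      image : ∀ {v} → Vert 1ℤ (+ (b ℤ.%ℕ q)) (+ q) v → Vert a b (+ q) (e₀ +ᵥ Chart.to (shear (a ℤ./ℕ q) (b ℤ./ℕ q)) v)
      image v₀ = vert v₀ (×³-≡ (r (a ℤ./ℕ q)) (r (b ℤ./ℕ q)) refl)
      image v₁ = vert v₁ (×³-≡ (r′ (a ℤ./ℕ q)) (r (b ℤ./ℕ q)) refl)
      image v₂ = vert v₂ (×³-≡ (r (a ℤ./ℕ q)) (r′ (b ℤ./ℕ q)) refl)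
      image v₃ = vert v₃ (×³-≡
        (sym (trans (ℤ.+-identityˡ (1ℤ + a ℤ./ℕ q * + q)) (trans (cong (λ x → + x + a ℤ./ℕ q * + q) (sym a≡1)) (residue-form q a))))
        (sym (trans (ℤ.+-identityˡ (+ (b ℤ.%ℕ q) + b ℤ./ℕ q * + q)) (residue-form q b))) refl)

  always-second : ∀ a b → b ℤ.%ℕ q ≡ 1 → Coprime′ q (a ℤ.%ℕ q) → Always a b (+ q)
  always-second a b b≡1 coprime = always-transport exchange e₀ image (always-first b a b≡1 coprime)
    where
      image : ∀ {v} → Vert b a (+ q) v → Vert a b (+ q) (e₀ +ᵥ Chart.to exchange v)
      image v₀ = v₀
      image v₁ = v₂
      image v₂ = v₁
      image v₃ = vert v₃ (sym (+ᵥ-identityˡ (a , b , + q)))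

  -- Exchanging `v₀` and `v₁` swaps the weights 1 - a - b and a.
  always-zeroth : ∀ a b → (1ℤ - a - b) ℤ.%ℕ q ≡ 1 → Coprime′ q (b ℤ.%ℕ q) → Always a b (+ q)
  always-zeroth a b c≡1 coprime = always-transport turn₀₁ e₁ image (always-first (1ℤ - a - b) b c≡1 coprime)
    where
      ring : ∀ a b → a ≡ 1ℤ + (- (1ℤ - a - b) - b)
      ring = solve-∀
      image : ∀ {v} → Vert (1ℤ - a - b) b (+ q) v → Vert a b (+ q) (e₁ +ᵥ Chart.to turn₀₁ v)
      image v₀ = v₁
      image v₁ = v₀
      image v₂ = v₂
      image v₃ = vert v₃ (×³-≡ (ring a b) (sym (ℤ.+-identityˡ b)) refl)

-- White's theorem supplies a weight 1, and a permutation of the vertices makes it the weight of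
-- `v₁`. The positive residues of the other weight involved give its coprimality to q.
always-terminal : ∀ {q′ a b} → 2 ℕ.≤ q′ → Terminal (suc q′) ((1ℤ - a - b) ℤ.%ℕ suc q′) (a ℤ.%ℕ suc q′) (b ℤ.%ℕ suc q′) → Always a b (+ suc q′)
always-terminal {q′} {a} {b} 2≤q′ t {T′} =
  by-weight (terminal-weight 2≤q′ t (ℤ.n%ℕd<d (1ℤ - a - b) q) (ℤ.n%ℕd<d a q) (ℤ.n%ℕd<d b q))
  where
    q = suc q′
    3≤q = ℕ.s≤s 2≤q′
    coprime₁ = residue-coprime q (a ℤ.%ℕ q) (Terminal.residue₁ t)
    coprime₂ = residue-coprime q (b ℤ.%ℕ q) (Terminal.residue₂ t)
    by-weight : _ → Quad T′ → ¬ ¬ Triple (Vert a b (+ q)) T′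
    by-weight (inj₁ c≡1) = always-zeroth q 3≤q a b c≡1 coprime₂
    by-weight (inj₂ (inj₁ a≡1)) = always-first q 3≤q a b a≡1 coprime₂
    by-weight (inj₂ (inj₂ b≡1)) = always-second q 3≤q a b b≡1 coprime₁

-- Exclusion of all volumes above 2

frame-chart : Frame → Chart
frame-chart F = chart point coords point-coords coords-point (λ u v → additive f₁ f₂ f₃ u v) (λ k v → scale f₁ f₂ f₃ k v)
  where
    open Frame F
    add-ring : ∀ a b c a′ b′ c′ u v w → (a + a′) * u + ((b + b′) * v + (c + c′) * w) ≡ (a * u + (b * v + c * w)) + (a′ * u + (b′ * v + c′ * w))
    add-ring = solve-∀
    additive : ∀ u v w x y → lin₃ (x +ᵥ y) u v w ≡ lin₃ x u v w +ᵥ lin₃ y u v w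
    additive (u , u′ , u″) (v , v′ , v″) (w , w′ , w″) (a , b , c) (a′ , b′ , c′) =
      ×³-≡ (add-ring a b c a′ b′ c′ u v w) (add-ring a b c a′ b′ c′ u′ v′ w′) (add-ring a b c a′ b′ c′ u″ v″ w″)
    scale-ring : ∀ k a b c u v w → k * a * u + (k * b * v + k * c * w) ≡ k * (a * u + (b * v + c * w))
    scale-ring = solve-∀
    scale : ∀ u v w k x → lin₃ (k *ᵥ x) u v w ≡ k *ᵥ lin₃ x u v w
    scale (u , u′ , u″) (v , v′ , v″) (w , w′ , w″) k (a , b , c) =
      ×³-≡ (scale-ring k a b c u v w) (scale-ring k a b c u′ v′ w′) (scale-ring k a b c u″ v″ w″)

tetrahedron-quad : ∀ {w₀ w₁ w₂ w₃} → EmptyTetrahedron (w₀ ∷ w₁ ∷ w₂ ∷ w₃ ∷ []) → Quad (_∈ (w₀ ∷ w₁ ∷ w₂ ∷ w₃ ∷ []))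
tetrahedron-quad tet = quad (here refl) (there (here refl)) (there (there (here refl))) (there (there (there (here refl)))) (edges-indep tet)

module _ {p₀ p₁ p₂ p₃ : ℤ³} (tet : EmptyTetrahedron (p₀ ∷ p₁ ∷ p₂ ∷ p₃ ∷ [])) where
  private
    P : Vec ℤ³ 4
    P = p₀ ∷ p₁ ∷ p₂ ∷ p₃ ∷ []

  -- The normal form decides by its volume q: 1 and 2 are the two model simplices, and any larger q
  -- would produce a triple with the four points of `Q`.
  volume-at-most-2 : ∀ {T′} → Quad T′ → ¬ Triple (_∈ P) T′ → Equivalent (conv P) S₁ ⊎ Equivalent (conv P) S₂
  volume-at-most-2 {T′} Q none = by-volume (normal-form (empty-simplex tet) (edges-indep tet))
    where
      by-volume : Normal (p₁ -ℤ³ p₀) (p₂ -ℤ³ p₀) (p₃ -ℤ³ p₀) → _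
      by-volume (normal {q = + zero} (ℤ.+<+ ()) _ _ _)
      by-volume N@(normal {q = + 1} _ _ _ _) = inj₁ (volume-1 N refl)
      -- For q = 2 the positive residues at k = 1 say that a and b are odd, which is all that
      -- `volume-2` asks for.
      by-volume N@(normal {F} {a} {b} {+ 2} _ u₁≡ u₂≡ u₃≡) = inj₂ (volume-2 N (a ℤ./ℕ 2) (b ℤ./ℕ 2) (odd a (Terminal.residue₁ t 1 (ℕ.s≤s ℕ.z≤n) ℕ.≤-refl)) (odd b (Terminal.residue₂ t 1 (ℕ.s≤s ℕ.z≤n) ℕ.≤-refl)) refl)
        where
          t = empty-terminal {q′ = 1} {a} {b} {Frame.f₁ F} {Frame.f₂ F} {Frame.f₃ F} (empty-simplex tet) u₁≡ u₂≡ u₃≡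
          odd : ∀ a → 0 ℕ.< 1 ℕ.* (a ℤ.%ℕ 2) ℕ.% 2 → a ≡ 1ℤ + a ℤ./ℕ 2 * + 2
          odd a pos = trans (sym (residue-form 2 a)) (cong (λ r → + r + a ℤ./ℕ 2 * + 2) (remainder (a ℤ.%ℕ 2) (ℤ.n%ℕd<d a 2) pos))
            where
              remainder : ∀ r → r ℕ.< 2 → 0 ℕ.< 1 ℕ.* r ℕ.% 2 → r ≡ 1
              remainder 1 _ _ = refl
              remainder (suc (suc _)) (ℕ.s≤s (ℕ.s≤s ())) _
      by-volume (normal {F} {a} {b} {+ suc (suc (suc k))} _ u₁≡ u₂≡ u₃≡) =
        ⊥-elim (always-transport (frame-chart F) p₀ image
          (always-terminal (ℕ.s≤s (ℕ.s≤s ℕ.z≤n)) (empty-terminal {q′ = 2 ℕ.+ k} {a} {b} {f₁} {f₂} {f₃} (empty-simplex tet) u₁≡ u₂≡ u₃≡)) Q none)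
        where
          open Frame F using (f₁; f₂; f₃; point)
          at : ∀ {p v} → p ∈ P → p -ℤ³ p₀ ≡ v → (p₀ +ᵥ v) ∈ P
          at {p} p∈ refl = subst (_∈ P) (sym (+ᵥ-base p₀ p)) p∈
          self : ∀ p → p -ℤ³ p ≡ e₀
          self (x , y , z) = ×³-≡ (ℤ.+-inverseʳ x) (ℤ.+-inverseʳ y) (ℤ.+-inverseʳ z)
          image : ∀ {v} → Vert a b (+ suc (suc (suc k))) v → (p₀ +ᵥ point v) ∈ P
          image v₀ = at (here refl) (trans (self p₀) (sym (Chart.to-e₀ (frame-chart F))))
          image v₁ = at (there (here refl)) (trans u₁≡ (sym (lin₃-unit₁ f₁ f₂ f₃)))
          image v₂ = at (there (there (here refl))) (trans u₂≡ (sym (trans (sym (lin₃-cycle 0ℤ 1ℤ 0ℤ f₁ f₂ f₃)) (lin₃-unit₁ f₂ f₃ f₁))))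
          image v₃ = at (there (there (there (here refl)))) u₃≡

triple-comm : ∀ {S T′} → Triple S T′ → Triple T′ S
triple-comm (triple x a b c a≢0 b≢0 c≢0 corner) = triple x a b c a≢0 b≢0 c≢0 λ i j k → flip′ (corner i j k)
  where
    flip′ : ∀ {S T′ z} → InSum S T′ z → InSum T′ S z
    flip′ (inSum {y₁ = y₁} {y₂} 0<N c₁ c₂ eq) = inSum 0<N c₂ c₁ (trans eq (+ᵥ-comm y₁ y₂))

theorem3p4 : (P Q : Vec ℤ³ 4) → EmptyTetrahedron P → EmptyTetrahedron Q →
    MinkowskiLength≡ (conv P ⊕ conv Q) 2 →
    (Equivalent (conv P) S₁ ⊎ Equivalent (conv P) S₂) ×
    (Equivalent (conv Q) S₁ ⊎ Equivalent (conv Q) S₂)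
theorem3p4 P@(_ ∷ _ ∷ _ ∷ _ ∷ []) Q@(_ ∷ _ ∷ _ ∷ _ ∷ []) tetP tetQ length≡2 =
  volume-at-most-2 tetP (tetrahedron-quad tetQ) (triple-length {P = P} {Q} length≡2) ,
  volume-at-most-2 tetQ (tetrahedron-quad tetP) (λ t → triple-length {P = P} {Q} length≡2 (triple-comm t))
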